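{- $\mathcal{I}_{\mathrm{RDS}}\subset\mathcal{I}_{\mathrm{CF}}$; that is, the ideal of $(\mathcal{A}^0,ш)$ generated by the regularized double shuffle relations is contained in the module of confluence relations.
   Context: Let $\mathcal{A}_z=\mathbb{Z}\langle e_0,e_1,e_z\rangle$ be the free non-commutative (associative, unital) ring on formal symbols $e_0,e_1,e_z$, and $\mathcal{A}=\mathbb{Z}\langle e_0,e_1\rangle\subset\mathcal{A}_z$. Put $\mathcal{A}_z^0=\mathbb{Z}\oplus\mathbb{Z}e_z\oplus\bigoplus_{a\in\{1,z\},\,b\in\{0,z\}}e_a\mathcal{A}_ze_b$, $\mathcal{A}^0=\mathbb{Z}\oplus e_1\mathcal{A}e_0$, $\mathcal{A}_z^1=\mathbb{Z}\oplus e_1\mathcal{A}_z\oplus e_z\mathcal{A}_z$, $\mathcal{A}^1=\mathbb{Z}\oplus e_1\mathcal{A}$, $\mathcal{A}_z^{ -2}=\mathbb{Z}\oplus e_1\mathcal{A}_ze_0\oplus e_z\mathcal{A}_ze_0$, and $\mathcal{A}_z^{ -1}=\mathcal{A}_z^{ -2}\,\mathbb{Z}\langle e_z\rangle$ (the span of concatenations $ue_z^k$, $u\in\mathcal{A}_z^{ -2}$, $k\ge0$). Tensor products are over $\mathbb{Z}$. The shuffle product $ш$ on $\mathcal{A}_z$ is the bilinear product with $w\,ш\,1=1\,ш\,w=w$ and $e_au\,ш\,e_bv=e_a(u\,ш\,e_bv)+e_b(e_au\,ш\,v)$; $\mathcal{A}^0$, $\mathcal{A}^1$, $\mathcal{A}_z^0$,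 $\mathcal{A}_z^1$ are commutative rings under $ш$. The stuffle product $*:\mathcal{A}\times\mathcal{A}_z\to\mathcal{A}_z$ is the bilinear map with $u*1=u$, $1*v=v$ and $e_au*e_bv=e_{ab}(u*e_bv+e_au*v-e_0(u*v))$, where $ab$ is the product of the labels ($0\cdot b=0$, $a\cdot 0=0$, $1\cdot b=b$). For $w\in\mathcal{A}_z^1$, the shuffle regularization is $\mathrm{reg}_{ш}(w)=w_0\in\mathcal{A}_z^0$, where $w=\sum_{i=0}^{\deg w}w_i\,ш\,e_1^i$ is the unique such expression with $w_i\in\mathcal{A}_z^0$ ($e_1^i$ being the word $e_1\cdots e_1$). $\mathcal{I}_{\mathrm{RDS}}$ is the ideal of the ring $(\mathcal{A}^0,ш)$ generated by $\{\mathrm{reg}_{ш}(u\,ш\,v-u*v)\mid u\in\mathcal{A}^1,\ v\in\mathcal{A}^0\}$. For $\alpha,\beta\in\{0,1,z\}$ define the linear operator $\partial_{\alpha,\beta}$ on $\mathcal{A}_z$ by $\partial_{\alpha,\beta}(e_{a_1}\cdots e_{a_n})=\sum_{i=1}^n\left(\delta_{\{a_i,a_{i+1}\},\{\alpha,\beta\}}-\delta_{\{a_{i-1},a_i\},\{\alpha,\beta\}}\right)e_{a_1}\cdots\widehat{e_{a_i}}\cdots e_{a_n}$, where $a_0=0$, $a_{n+1}=1$, the hat denotes omission, and $\delta_{S,T}=1$ if $S=T$ as sets and $0$ otherwise. $\mathrm{Const}:\mathcal{A}_z\to\mathcal{A}$ is the linear map sending a word to itself if it contains no letter $e_z$, and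 to $0$ otherwise. The set of standard relations is $\mathcal{I}_{\mathrm{ST}}=\{w\in\mathcal{A}_z^0\mid \mathrm{Const}(\partial_{z,\alpha_1}\cdots\partial_{z,\alpha_r}w)=0\text{ for all }r\ge0\text{ and }\alpha_1,\dots,\alpha_r\in\{0,1\}\}$. The duality map $\tau_z$ is the anti-automorphism of the ring $\mathcal{A}_z$ with $\tau_z(e_0)=e_z-e_1$, $\tau_z(e_1)=e_z-e_0$, $\tau_z(e_z)=e_z$. The map $u\otimes v\mapsto u\,ш\,v$ is an isomorphism $\mathcal{A}_z^{ -2}\otimes(\mathcal{A}_z^0\cap\mathbb{Z}\langle e_1,e_z\rangle)\to\mathcal{A}_z^0$; let $\mathrm{reg}_{\{z,1\}}$ be its inverse. It is also an isomorphism $\mathcal{A}_z^{ -2}\otimes\mathbb{Z}\langle e_z\rangle\to\mathcal{A}_z^{ -1}$; let $\mathrm{reg}_{\{z\}}$ be its inverse. Define $N:\mathcal{A}_z^0\to\mathcal{A}_z^{ -1}$ as the composition of $\mathrm{reg}_{\{z,1\}}$, then $\mathrm{id}\otimes\tau_z$ (which lands in $\mathcal{A}_z^{ -2}\otimes(\mathcal{A}_z^0\cap\mathbb{Z}\langle e_0,e_z\rangle)$), then $u\otimes v\mapsto u\,ш\,v$. Define $\lambda:\mathcal{A}_z^0\to\mathcal{A}^0$ as the composition of $N$, then $\mathrm{reg}_{\{z\}}$, then $\mathrm{id}\otimes\mathrm{const}:\mathcal{A}_z^{ -2}\otimes\mathbb{Z}\langle e_z\rangle\to\mathcal{A}_z^{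 -2}$ (where $\mathrm{const}$ takes the constant term: $1\mapsto1$, $e_z^k\mapsto0$ for $k\ge1$), then $\lambda':\mathcal{A}_z^{ -2}\to\mathcal{A}^0$, the restriction of the ring homomorphism replacing $e_z$ by $e_1$. The module of confluence relations is $\mathcal{I}_{\mathrm{CF}}=\{\lambda(w)\mid w\in\mathcal{I}_{\mathrm{ST}}\}\subset\mathcal{A}^0$. -}

module Defs where

open import Data.Bool.Base using (if_then_else_)
open import Data.Integer.Base as ℤ using (ℤ; 0ℤ; 1ℤ; -1ℤ)
open import Data.List.Base
  using (List; []; _∷_; [_]; _++_; _∷ʳ_; map; concatMap; foldr; replicate; upTo)
open import Data.List.Membership.Propositional using (_∈_)
open import Data.List.Properties using (≡-dec)
open import Data.List.Relation.Unary.All using (All)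
open import Data.Nat.Base using (ℕ; suc)
open import Data.Product.Base using (_×_; _,_; proj₁; proj₂; ∃-syntax; Σ-syntax; map₁; map₂)
open import Level using (0ℓ)
open import Relation.Binary.Core using (Rel)
open import Relation.Binary.Definitions using (DecidableEquality)
open import Relation.Binary.PropositionalEquality.Core using (_≡_; refl)
open import Relation.Nullary.Decidable using (Dec; yes; no; does; _×-dec_)
open import Relation.Unary using (Pred; _∩_)

infixr 5 _◃_
infixl 6 _+_ _-_
infixr 7 _·_
infixl 7 _∙_ _шʷ_ _ш_ _*ʷ_ _*_
infixl 7 _·ˡ_
infix  8 -_
infix  4 _≈_ _≟ˡ_ _≟ʷ_

data Letter : Set where
  e0 e1 ez : Letter

_≟ˡ_ : DecidableEquality Letter
e0 ≟ˡ e0 = yes refl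
e0 ≟ˡ e1 = no λ ()
e0 ≟ˡ ez = no λ ()
e1 ≟ˡ e0 = no λ ()
e1 ≟ˡ e1 = yes refl
e1 ≟ˡ ez = no λ ()
ez ≟ˡ e0 = no λ ()
ez ≟ˡ e1 = no λ ()
ez ≟ˡ ez = yes refl

open import Data.List.Membership.DecPropositional _≟ˡ_ using (_∈?_)
open import Data.List.Relation.Binary.Subset.DecPropositional _≟ˡ_ using (_⊆?_)
open import Data.List.Relation.Unary.All using (all?)

Word : Set
Word = List Letter

_≟ʷ_ : DecidableEquality Word
_≟ʷ_ = ≡-dec _≟ˡ_

-- Elements of ℤ⟨e₀,e₁,e_z⟩ are formal sums of terms (coefficient , word), in
-- which words may repeat and coefficients may vanish; such sums are compared
-- by _≈_, never by _≡_.

𝒜z : Set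
𝒜z = List (ℤ × Word)

coeff : Word → 𝒜z → ℤ
coeff w []            = 0ℤ
coeff w ((c , v) ∷ p) = if does (v ≟ʷ w) then c ℤ.+ coeff w p else coeff w p

_≈_ : Rel 𝒜z 0ℓ
p ≈ q = ∀ w → coeff w p ≡ coeff w q

0# : 𝒜z
0# = []

word : Word → 𝒜z
word w = [ (1ℤ , w) ]

1# : 𝒜z
1# = word []

_+_ : 𝒜z → 𝒜z → 𝒜z
_+_ = _++_

_·_ : ℤ → 𝒜z → 𝒜z
c · p = map (map₁ (c ℤ.*_)) p

-_ : 𝒜z → 𝒜z
- p = -1ℤ · p

_-_ : 𝒜z → 𝒜z → 𝒜z
p - q = p + (- q)

∑ : {X : Set} → List X → (X → 𝒜z) → 𝒜z
∑ xs f = concatMap f xs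

linear : (Word → 𝒜z) → 𝒜z → 𝒜z
linear f p = ∑ p λ (c , w) → c · f w

bilinear : (Word → Word → 𝒜z) → 𝒜z → 𝒜z → 𝒜z
bilinear f p q = linear (λ u → linear (f u) q) p

_◃_ : Letter → 𝒜z → 𝒜z
a ◃ p = map (map₂ (a ∷_)) p

_∙_ : 𝒜z → 𝒜z → 𝒜z
_∙_ = bilinear λ u v → word (u ++ v)

-- ℤ-span of a set of words.
Span : Pred Word 0ℓ → Pred 𝒜z 0ℓ
Span P p = ∃[ q ] p ≈ q × All (λ (_ , w) → P w) q

Over : List Letter → Pred Word 0ℓ
Over S = All (_∈ S)

ℤ⟨_⟩ : List Letter → Pred 𝒜z 0ℓ
ℤ⟨ S ⟩ = Span (Over S)

01-letters : List Letter
01-letters = e0 ∷ e1 ∷ []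

data Word⁰ : Pred Word 0ℓ where
  empty : Word⁰ []
  inner : ∀ {w} → Over 01-letters w → Word⁰ (e1 ∷ w ∷ʳ e0)

data Word¹ : Pred Word 0ℓ where
  empty : Word¹ []
  inner : ∀ {w} → Over 01-letters w → Word¹ (e1 ∷ w)

data Wordz⁰ : Pred Word 0ℓ where
  empty  : Wordz⁰ []
  single : Wordz⁰ [ ez ]
  inner  : ∀ {a b} w → a ∈ e1 ∷ ez ∷ [] → b ∈ e0 ∷ ez ∷ [] → Wordz⁰ (a ∷ w ∷ʳ b)

data Wordz⁻² : Pred Word 0ℓ where
  empty : Wordz⁻² []
  inner : ∀ {a} w → a ∈ e1 ∷ ez ∷ [] → Wordz⁻² (a ∷ w ∷ʳ e0)

𝒜⁰ 𝒜¹ 𝒜z⁰ 𝒜z⁻² : Pred 𝒜z 0ℓ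
𝒜⁰   = Span Word⁰
𝒜¹   = Span Word¹
𝒜z⁰  = Span Wordz⁰
𝒜z⁻² = Span Wordz⁻²

_шʷ_ : Word → Word → 𝒜z
[]      шʷ v       = word v
(a ∷ u) шʷ []      = word (a ∷ u)
(a ∷ u) шʷ (b ∷ v) = (a ◃ u шʷ (b ∷ v)) + (b ◃ (a ∷ u) шʷ v)

_ш_ : 𝒜z → 𝒜z → 𝒜z
_ш_ = bilinear _шʷ_

-- Product of labels.  The stuffle product is only ever applied to a left
-- factor without e_z, so the value of z · z is irrelevant.
_·ˡ_ : Letter → Letter → Letter
e0 ·ˡ b  = e0
e1 ·ˡ b  = b
ez ·ˡ e0 = e0
ez ·ˡ e1 = ez
ez ·ˡ ez = ez

_*ʷ_ : Word → Word → 𝒜z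
[]      *ʷ v       = word v
(a ∷ u) *ʷ []      = word (a ∷ u)
(a ∷ u) *ʷ (b ∷ v) =
  (a ·ˡ b) ◃ (u *ʷ (b ∷ v) + (a ∷ u) *ʷ v - (e0 ◃ u *ʷ v))

_*_ : 𝒜z → 𝒜z → 𝒜z
_*_ = bilinear _*ʷ_

-- Graph of reg_ш.  The expansion of w need not stop at i = deg w: by uniqueness
-- any further terms vanish.
Regш : 𝒜z → Pred 𝒜z 0ℓ
Regш w w₀ = ∃[ n ] Σ[ wᵢ ∈ (ℕ → 𝒜z) ]
  (∀ i → 𝒜z⁰ (wᵢ i)) ×
  w ≈ ∑ (upTo (suc n)) (λ i → wᵢ i ш word (replicate i e1)) ×
  w₀ ≈ wᵢ 0

RDSGenerator : Pred 𝒜z 0ℓ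
RDSGenerator g = ∃[ u ] ∃[ v ] 𝒜¹ u × 𝒜⁰ v × Regш (u ш v - u * v) g

-- Ideals of (𝒜⁰ , ш).
data IdealGeneratedBy (S : Pred 𝒜z 0ℓ) : Pred 𝒜z 0ℓ where
  gen  : ∀ {g} → S g → IdealGeneratedBy S g
  zero : IdealGeneratedBy S 0#
  add  : ∀ {p q} → IdealGeneratedBy S p → IdealGeneratedBy S q →
         IdealGeneratedBy S (p + q)
  mul  : ∀ {a p} → 𝒜⁰ a → IdealGeneratedBy S p → IdealGeneratedBy S (a ш p)
  resp : ∀ {p q} → p ≈ q → IdealGeneratedBy S p → IdealGeneratedBy S q

𝓘RDS : Pred 𝒜z 0ℓ
𝓘RDS = IdealGeneratedBy RDSGenerator

-- δ S T compares S and T as sets, ignoring order and repetition.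
δ : List Letter → List Letter → ℤ
δ S T = if does (S ⊆? T ×-dec T ⊆? S) then 1ℤ else 0ℤ

firstOr : Letter → Word → Letter
firstOr d []      = d
firstOr d (a ∷ _) = a

-- ∂ʷ α β p w is the sum over the letters of w, where p is the letter
-- preceding w; the letter following w is a_{n+1} = 1.
∂ʷ : Letter → Letter → Letter → Word → 𝒜z
∂ʷ α β p []      = 0#
∂ʷ α β p (a ∷ w) =
  (δ (a ∷ firstOr e1 w ∷ []) (α ∷ β ∷ []) ℤ.- δ (p ∷ a ∷ []) (α ∷ β ∷ [])) · word w
  + (a ◃ ∂ʷ α β a w)

∂ : Letter → Letter → 𝒜z → 𝒜z
∂ α β = linear (∂ʷ α β e0)

Const : 𝒜z → 𝒜z
Const = linear λ w → if does (all? (_∈? 01-letters) w) then word w else 0#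

𝓘ST : Pred 𝒜z 0ℓ
𝓘ST w = 𝒜z⁰ w × (∀ αs → Over 01-letters αs → Const (foldr (∂ ez) w αs) ≈ 0#)

τˡ : Letter → 𝒜z
τˡ e0 = word [ ez ] - word [ e1 ]
τˡ e1 = word [ ez ] - word [ e0 ]
τˡ ez = word [ ez ]

τʷ : Word → 𝒜z
τʷ []      = 1#
τʷ (a ∷ w) = τʷ w ∙ τˡ a

τ : 𝒜z → 𝒜z
τ = linear τʷ

-- An element of 𝒜z ⊗ 𝒜z is written as a finite sum of pure tensors.  This is
-- not unique, but tensors are only ever mapped to 𝒜z by maps induced by
-- bilinear ones, which do not depend on the choice.
Tensor : Set
Tensor = List (𝒜z × 𝒜z)

_⊗_ : Pred 𝒜z 0ℓ → Pred 𝒜z 0ℓ → Pred Tensor 0ℓ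
M ⊗ N = All λ (u , v) → M u × N v

shuffleTensor : Tensor → 𝒜z
shuffleTensor t = ∑ t λ (u , v) → u ш v

id⊗τ : Tensor → Tensor
id⊗τ = map (map₂ τ)

constantTerm : 𝒜z → ℤ
constantTerm = coeff []

id⊗const : Tensor → 𝒜z
id⊗const t = ∑ t λ (u , v) → constantTerm v · u

-- The maps reg_{z,1} and reg_{z}, N and λ are given by their graphs: the first
-- two are inverses of isomorphisms u ⊗ v ↦ u ш v.

Reg⟨z,1⟩ : 𝒜z → Pred Tensor 0ℓ
Reg⟨z,1⟩ w t = (𝒜z⁻² ⊗ (𝒜z⁰ ∩ ℤ⟨ e1 ∷ ez ∷ [] ⟩)) t × shuffleTensor t ≈ w

Reg⟨z⟩ : 𝒜z → Pred Tensor 0ℓ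
Reg⟨z⟩ w t = (𝒜z⁻² ⊗ ℤ⟨ [ ez ] ⟩) t × shuffleTensor t ≈ w

N : 𝒜z → Pred 𝒜z 0ℓ
N w n = ∃[ t ] Reg⟨z,1⟩ w t × n ≈ shuffleTensor (id⊗τ t)

z↦1 : Letter → Letter
z↦1 e0 = e0
z↦1 e1 = e1
z↦1 ez = e1

λ′ : 𝒜z → 𝒜z
λ′ = linear λ w → word (map z↦1 w)

Lambda : 𝒜z → Pred 𝒜z 0ℓ
Lambda w x = ∃[ n ] N w n × (∃[ t ] Reg⟨z⟩ n t × x ≈ λ′ (id⊗const t))

𝓘CF : Pred 𝒜z 0ℓ
𝓘CF x = ∃[ w ] 𝓘ST w × Lambda w x

{-# OPTIONS --safe #-}
module Submission where

open import Defs
open import Relation.Unary using (_⊆_)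

open import Data.Bool.Base using (Bool; true; false; if_then_else_; _∧_)
open import Data.Integer.Base as ℤ using (ℤ; 0ℤ; 1ℤ; -1ℤ)
import Data.Integer.Properties as ℤ
open import Data.Integer.Tactic.RingSolver using (solve-∀)
open import Data.List.Base
  using (List; []; _∷_; [_]; _++_; _∷ʳ_; map; foldr; replicate; upTo; applyUpTo; length)
open import Data.List.Membership.Propositional using (_∈_)
open import Data.List.Properties using (concatMap-++; map-++; ++-identityʳ)
open import Data.List.Membership.DecPropositional _≟ˡ_ using (_∈?_)
open import Data.List.Relation.Unary.All as All using (All; []; _∷_; all?)
import Data.List.Relation.Unary.All.Properties as All
open import Data.List.Relation.Unary.Any using (here; there)
open import Data.Maybe.Base using (Maybe; just; nothing)
open import Data.Nat.Base as ℕ using (ℕ; zero; suc; s≤s)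
import Data.Nat.Properties as ℕ
open import Data.Product.Base using (_×_; _,_; proj₁; proj₂; ∃-syntax; map₂)
open import Data.Unit.Base using (⊤; tt)
open import Function.Base using (id)
open import Level using (0ℓ)
open import Relation.Binary.Bundles using (Setoid)
open import Relation.Binary.PropositionalEquality
  using (_≡_; refl; sym; trans; cong; cong₂; module ≡-Reasoning)
open import Relation.Nullary.Decidable using (yes; no; does)
open import Relation.Nullary.Negation using (contradiction)
open import Relation.Unary using (Pred; _∩_; U)
import Relation.Binary.Reasoning.Setoid as SetoidReasoning

-- For u ∈ 𝒜¹ and v ∈ 𝒜⁰ let v_z be v with e₁ replaced by e_z, and put
-- p = u ш v_z - u * v_z.  Since ∂_{z,α} kills words in e₀, e₁, is a derivation
-- for ш, and satisfies ∂_{z,α}(u * x) = u * ∂_{z,α} x for the words x in e₀, e_z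
-- arising from v_z, Const ∂_{z,α₁}⋯∂_{z,α_r} p is the difference of u ш c and
-- u * c for an integer c, so it vanishes.
--
-- Stripping a final e₁ is a derivation D of ш with D(e₁ⁱ) = e₁ⁱ⁻¹, so that
-- reg_ш(w) = Σᵢ (-1)ⁱ Dⁱw ш e₁ⁱ.  As D commutes with every ∂_{z,α}, reg_ш(p) again
-- satisfies the standard relations.  It lies in 𝒜_z⁻², where λ is just z ↦ 1, and
-- z ↦ 1 commutes with D on p, so λ(reg_ш(p)) = reg_ш(u ш v - u * v).
--
-- Finally a ш w ∈ 𝓘_ST and λ(a ш w) = a ш λ(w) for a ∈ 𝒜⁰ and w ∈ 𝓘_ST, so 𝓘_CF
-- is an ideal.

-- _≈_ unfolds to a Π-type from which its sides cannot be inferred.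
infix 4 _≋_
record _≋_ (p q : 𝒜z) : Set where
  constructor ⌜_⌝
  field at : p ≈ q
open _≋_

≋-setoid : Setoid 0ℓ 0ℓ
≋-setoid = record
  { Carrier = 𝒜z
  ; _≈_ = _≋_
  ; isEquivalence = record
    { refl  = ⌜ (λ _ → refl) ⌝
    ; sym   = λ e → ⌜ (λ w → sym (at e w)) ⌝
    ; trans = λ e f → ⌜ (λ w → trans (at e w) (at f w)) ⌝
    }
  }

open Setoid ≋-setoid using ()
  renaming (refl to ≋-refl; sym to ≋-sym; trans to ≋-trans; reflexive to ≋-reflexive)
module ≋-Reasoning = SetoidReasoning ≋-setoid

coeff-+ : ∀ w p q → coeff w (p + q) ≡ coeff w p ℤ.+ coeff w q
coeff-+ w []            q = sym (ℤ.+-identityˡ _)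
coeff-+ w ((c , v) ∷ p) q with does (v ≟ʷ w)
... | true  = trans (cong (ℤ._+_ c) (coeff-+ w p q)) (sym (ℤ.+-assoc c _ _))
... | false = coeff-+ w p q

coeff-· : ∀ w c p → coeff w (c · p) ≡ c ℤ.* coeff w p
coeff-· w c []            = sym (ℤ.*-zeroʳ c)
coeff-· w c ((d , v) ∷ p) with does (v ≟ʷ w)
... | true  = trans (cong (ℤ._+_ (c ℤ.* d)) (coeff-· w c p)) (sym (ℤ.*-distribˡ-+ c d _))
... | false = coeff-· w c p

+-cong : ∀ {p p′ q q′} → p ≋ p′ → q ≋ q′ → p + q ≋ p′ + q′
+-cong {p} {p′} {q} {q′} e f = ⌜ (λ w → trans (coeff-+ w p q)
  (trans (cong₂ ℤ._+_ (at e w) (at f w)) (sym (coeff-+ w p′ q′)))) ⌝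

+-congˡ : ∀ r {p q} → p ≋ q → p + r ≋ q + r
+-congˡ r e = +-cong e (≋-refl {r})

+-congʳ : ∀ r {p q} → p ≋ q → r + p ≋ r + q
+-congʳ r e = +-cong (≋-refl {r}) e

·-cong : ∀ c {p q} → p ≋ q → c · p ≋ c · q
·-cong c {p} {q} e = ⌜ (λ w → trans (coeff-· w c p)
  (trans (cong (ℤ._*_ c) (at e w)) (sym (coeff-· w c q)))) ⌝

-cong : ∀ {p p′ q q′} → p ≋ p′ → q ≋ q′ → p - q ≋ p′ - q′
-cong e f = +-cong e (·-cong -1ℤ f)

+-assoc : ∀ p q r → (p + q) + r ≋ p + (q + r)
+-assoc p q r = ⌜ (λ w → trans (coeff-+ w (p + q) r) (trans (cong (ℤ._+ coeff w r) (coeff-+ w p q))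
  (trans (ℤ.+-assoc (coeff w p) _ _) (sym (trans (coeff-+ w p (q + r)) (cong (ℤ._+_ (coeff w p)) (coeff-+ w q r))))))) ⌝

+-comm : ∀ p q → p + q ≋ q + p
+-comm p q = ⌜ (λ w → trans (coeff-+ w p q) (trans (ℤ.+-comm (coeff w p) _) (sym (coeff-+ w q p)))) ⌝

+-identityʳ : ∀ p → p + 0# ≋ p
+-identityʳ p = ≋-reflexive (++-identityʳ p)

·-distribˡ : ∀ c p q → c · (p + q) ≋ c · p + c · q
·-distribˡ c p q = ⌜ (λ w → trans (coeff-· w c (p + q)) (trans (cong (ℤ._*_ c) (coeff-+ w p q))
  (trans (ℤ.*-distribˡ-+ c _ _) (sym (trans (coeff-+ w (c · p) (c · q)) (cong₂ ℤ._+_ (coeff-· w c p) (coeff-· w c q))))))) ⌝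

·-distribʳ : ∀ c d p → (c ℤ.+ d) · p ≋ c · p + d · p
·-distribʳ c d p = ⌜ (λ w → trans (coeff-· w (c ℤ.+ d) p) (trans (ℤ.*-distribʳ-+ (coeff w p) c d)
  (sym (trans (coeff-+ w (c · p) (d · p)) (cong₂ ℤ._+_ (coeff-· w c p) (coeff-· w d p)))))) ⌝

·-assoc : ∀ c d p → (c ℤ.* d) · p ≋ c · (d · p)
·-assoc c d p = ⌜ (λ w → trans (coeff-· w (c ℤ.* d) p) (trans (ℤ.*-assoc c d _)
  (sym (trans (coeff-· w c (d · p)) (cong (ℤ._*_ c) (coeff-· w d p)))))) ⌝

·-identity : ∀ p → 1ℤ · p ≋ p
·-identity p = ⌜ (λ w → trans (coeff-· w 1ℤ p) (ℤ.*-identityˡ _)) ⌝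

·-zero : ∀ p → 0ℤ · p ≋ 0#
·-zero p = ⌜ (λ w → trans (coeff-· w 0ℤ p) (ℤ.*-zeroˡ (coeff w p))) ⌝

-‿inverse : ∀ p → p - p ≋ 0#
-‿inverse p = ≋-trans (+-congˡ (- p) (≋-sym (·-identity p)))
  (≋-trans (≋-sym (·-distribʳ 1ℤ -1ℤ p)) (·-zero p))

p-q≋0⇒p≋q : ∀ {p q} → p - q ≋ 0# → p ≋ q
p-q≋0⇒p≋q {p} {q} e = begin
  p                 ≈⟨ +-identityʳ p ⟨
  p + 0#            ≈⟨ +-congʳ p (-‿inverse q) ⟨
  p + (q - q)       ≈⟨ +-congʳ p (+-comm q (- q)) ⟩
  p + ((- q) + q)   ≈⟨ +-assoc p (- q) q ⟨
  (p - q) + q       ≈⟨ +-congˡ q e ⟩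
  q                 ∎
  where open ≋-Reasoning

+-+-comm : ∀ p q r s → (p + q) + (r + s) ≋ (p + r) + (q + s)
+-+-comm p q r s = begin
  (p + q) + (r + s)  ≈⟨ +-assoc p q (r + s) ⟩
  p + (q + (r + s))  ≈⟨ +-congʳ p (+-assoc q r s) ⟨
  p + ((q + r) + s)  ≈⟨ +-congʳ p (+-congˡ s (+-comm q r)) ⟩
  p + ((r + q) + s)  ≈⟨ +-congʳ p (+-assoc r q s) ⟩
  p + (r + (q + s))  ≈⟨ +-assoc p r (q + s) ⟨
  (p + r) + (q + s)  ∎
  where open ≋-Reasoning

-- Linear extension respects equality of coefficients

-- The linear functional with values `g` on words. Equal elements may be written with different
-- repetitions and cancellations, so compatibility with `≋` has to be proved; it is what makes
-- `linear f` well defined.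
pair : (Word → ℤ) → 𝒜z → ℤ
pair g []            = 0ℤ
pair g ((c , v) ∷ p) = c ℤ.* g v ℤ.+ pair g p

pair-+ : ∀ g p q → pair g (p + q) ≡ pair g p ℤ.+ pair g q
pair-+ g []            q = sym (ℤ.+-identityˡ _)
pair-+ g ((c , v) ∷ p) q =
  trans (cong (ℤ._+_ (c ℤ.* g v)) (pair-+ g p q)) (sym (ℤ.+-assoc (c ℤ.* g v) _ _))

pair-· : ∀ g c p → pair g (c · p) ≡ c ℤ.* pair g p
pair-· g c []            = sym (ℤ.*-zeroʳ c)
pair-· g c ((d , v) ∷ p) =
  trans (cong₂ ℤ._+_ (ℤ.*-assoc c d (g v)) (pair-· g c p)) (sym (ℤ.*-distribˡ-+ c (d ℤ.* g v) _))

remove : Word → 𝒜z → 𝒜z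
remove v []            = []
remove v ((c , u) ∷ p) = if does (u ≟ʷ v) then remove v p else (c , u) ∷ remove v p

length-remove : ∀ v p → length (remove v p) ℕ.≤ length p
length-remove v []            = ℕ.z≤n
length-remove v ((c , u) ∷ p) with does (u ≟ʷ v)
... | true  = ℕ.m≤n⇒m≤1+n (length-remove v p)
... | false = s≤s (length-remove v p)

coeff-remove : ∀ v p w → coeff w p ≡ 0ℤ → coeff w (remove v p) ≡ 0ℤ
coeff-remove v p w e with v ≟ʷ w
... | yes refl = self p
  where
  self : ∀ p → coeff v (remove v p) ≡ 0ℤ
  self []            = refl
  self ((c , u) ∷ p) with u ≟ʷ v
  ... | yes _ = self p
  -- `coeff` compares `u` with `v` a second time, once `remove` has kept the term.
  ... | no u≢v with u ≟ʷ v
  ...   | yes u≡v = contradiction u≡v u≢v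
  ...   | no _    = self p
... | no v≢w = trans (other p) e
  where
  other : ∀ p → coeff w (remove v p) ≡ coeff w p
  other []            = refl
  other ((c , u) ∷ p) with u ≟ʷ v
  other ((c , u) ∷ p) | yes refl with v ≟ʷ w
  ... | yes v≡w = contradiction v≡w v≢w
  ... | no _    = other p
  other ((c , u) ∷ p) | no _ with does (u ≟ʷ w)
  ... | true  = cong (ℤ._+_ c) (other p)
  ... | false = other p

pair-remove : ∀ g v p → pair g p ≡ coeff v p ℤ.* g v ℤ.+ pair g (remove v p)
pair-remove g v []            = sym (trans (ℤ.+-identityʳ _) (ℤ.*-zeroˡ (g v)))
pair-remove g v ((c , u) ∷ p) with u ≟ʷ v
... | yes refl = trans (cong (ℤ._+_ (c ℤ.* g v)) (pair-remove g v p))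
        (trans (sym (ℤ.+-assoc (c ℤ.* g v) _ _)) (cong (ℤ._+ pair g (remove v p)) (sym (ℤ.*-distribʳ-+ (g v) c _))))
... | no _ = trans (cong (ℤ._+_ (c ℤ.* g u)) (pair-remove g v p)) (swap (c ℤ.* g u) (coeff v p ℤ.* g v) (pair g (remove v p)))
  where
  swap : ∀ x y z → x ℤ.+ (y ℤ.+ z) ≡ y ℤ.+ (x ℤ.+ z)
  swap = solve-∀

-- All terms with the same word as the head together contribute their total coefficient times `g v`,
-- which is 0, and removing them leaves a shorter sum. The bound `n` makes this recursion
-- structural.
pair-zero : ∀ g n p → length p ℕ.≤ n → (∀ w → coeff w p ≡ 0ℤ) → pair g p ≡ 0ℤ
pair-zero g n       []            _       z = refl
pair-zero g (suc n) ((c , v) ∷ p) (s≤s l) z = begin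
  pair g q                                ≡⟨ pair-remove g v q ⟩
  coeff v q ℤ.* g v ℤ.+ pair g (remove v q)  ≡⟨ cong₂ (λ x y → x ℤ.* g v ℤ.+ pair g y) (z v) remove-head ⟩
  0ℤ ℤ.* g v ℤ.+ pair g (remove v p)         ≡⟨ cong₂ ℤ._+_ (ℤ.*-zeroˡ (g v)) tail-zero ⟩
  0ℤ ∎
  where
  open ≡-Reasoning
  q = (c , v) ∷ p
  remove-head : remove v q ≡ remove v p
  remove-head with v ≟ʷ v
  ... | yes _  = refl
  ... | no v≢v = contradiction refl v≢v
  tail-zero : pair g (remove v p) ≡ 0ℤ
  tail-zero = pair-zero g n (remove v p) (ℕ.≤-trans (length-remove v p) l)
    (λ w → trans (cong (coeff w) (sym remove-head)) (coeff-remove v q w (z w)))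

pair-cong : ∀ g {p q} → p ≋ q → pair g p ≡ pair g q
pair-cong g {p} {q} e = ℤ.i-j≡0⇒i≡j (pair g p) (pair g q) (trans difference
  (pair-zero g _ (p - q) ℕ.≤-refl (λ w → at (≋-trans (-cong e (≋-refl {q})) (-‿inverse q)) w)))
  where
  difference : pair g p ℤ.- pair g q ≡ pair g (p - q)
  difference = sym (trans (pair-+ g p (- q)) (cong (ℤ._+_ (pair g p))
    (trans (pair-· g -1ℤ q) (ℤ.-1*i≡-i (pair g q)))))

coeff-linear : ∀ f p w → coeff w (linear f p) ≡ pair (λ v → coeff w (f v)) p
coeff-linear f []            w = refl
coeff-linear f ((c , v) ∷ p) w = trans (coeff-+ w (c · f v) (linear f p))
  (cong₂ ℤ._+_ (coeff-· w c (f v)) (coeff-linear f p w))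

-- Linear maps, submodules and induction on words

record IsLinear (F : 𝒜z → 𝒜z) : Set where
  field
    cong≋ : ∀ {p q} → p ≋ q → F p ≋ F q
    +-homo : ∀ p q → F (p + q) ≋ F p + F q
    ·-homo : ∀ c p → F (c · p) ≋ c · F p

  0-homo : F 0# ≋ 0#
  0-homo = ≋-trans (·-homo 0ℤ 0#) (·-zero (F 0#))

  -‿homo : ∀ p q → F (p - q) ≋ F p - F q
  -‿homo p q = ≋-trans (+-homo p (- q)) (+-congʳ (F p) (·-homo -1ℤ q))
open IsLinear

linear-isLinear : ∀ f → IsLinear (linear f)
linear-isLinear f .cong≋ {p} {q} e = ⌜ (λ w → trans (coeff-linear f p w)
  (trans (pair-cong _ e) (sym (coeff-linear f q w)))) ⌝
linear-isLinear f .+-homo p q = ≋-reflexive (concatMap-++ (λ (c , w) → c · f w) p q)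
linear-isLinear f .·-homo c p = ⌜ (λ w → trans (coeff-linear f (c · p) w)
  (trans (pair-· _ c p) (trans (cong (ℤ._*_ c) (sym (coeff-linear f p w))) (sym (coeff-· w c (linear f p)))))) ⌝

linear-word : ∀ f w → linear f (word w) ≋ f w
linear-word f w = ≋-trans (+-identityʳ (1ℤ · f w)) (·-identity (f w))

≋-linear⇒isLinear : ∀ {F} f → (∀ p → F p ≋ linear f p) → IsLinear F
≋-linear⇒isLinear f e .cong≋ {p} {q} p≋q =
  ≋-trans (e p) (≋-trans (cong≋ (linear-isLinear f) p≋q) (≋-sym (e q)))
≋-linear⇒isLinear f e .+-homo p q =
  ≋-trans (e _) (≋-trans (+-homo (linear-isLinear f) p q) (≋-sym (+-cong (e p) (e q))))
≋-linear⇒isLinear f e .·-homo c p =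
  ≋-trans (e _) (≋-trans (·-homo (linear-isLinear f) c p) (≋-sym (·-cong c (e p))))

◃-linear : ∀ a p → a ◃ p ≡ linear (λ w → word (a ∷ w)) p
◃-linear a []            = refl
◃-linear a ((c , w) ∷ p) = cong₂ (λ d q → (d , a ∷ w) ∷ q) (sym (ℤ.*-identityʳ c)) (◃-linear a p)

◃-isLinear : ∀ a → IsLinear (a ◃_)
◃-isLinear a = ≋-linear⇒isLinear (λ w → word (a ∷ w)) (λ p → ≋-reflexive (◃-linear a p))

id-isLinear : IsLinear (λ p → p)
id-isLinear = record { cong≋ = id ; +-homo = λ _ _ → ≋-refl ; ·-homo = λ _ _ → ≋-refl }

∘-isLinear : ∀ {F G} → IsLinear F → IsLinear G → IsLinear (λ p → F (G p))
∘-isLinear F G = record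
  { cong≋  = λ e → cong≋ F (cong≋ G e)
  ; +-homo = λ p q → ≋-trans (cong≋ F (+-homo G p q)) (+-homo F _ _)
  ; ·-homo = λ c p → ≋-trans (cong≋ F (·-homo G c p)) (·-homo F c _)
  }

+-isLinear : ∀ {F G} → IsLinear F → IsLinear G → IsLinear (λ p → F p + G p)
+-isLinear {F} {G} F-lin G-lin = record
  { cong≋  = λ e → +-cong (cong≋ F-lin e) (cong≋ G-lin e)
  ; +-homo = λ p q → ≋-trans (+-cong (+-homo F-lin p q) (+-homo G-lin p q))
      (+-+-comm (F p) (F q) (G p) (G q))
  ; ·-homo = λ c p → ≋-trans (+-cong (·-homo F-lin c p) (·-homo G-lin c p))
      (≋-sym (·-distribˡ c (F p) (G p)))
  }

·-comm : ∀ c d p → c · (d · p) ≋ d · (c · p)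
·-comm c d p = ≋-trans (≋-sym (·-assoc c d p)) (≋-trans (≋-reflexive (cong (_· p) (ℤ.*-comm c d))) (·-assoc d c p))

·-isLinear : ∀ c {F} → IsLinear F → IsLinear (λ p → c · F p)
·-isLinear c {F} F-lin = record
  { cong≋  = λ e → ·-cong c (cong≋ F-lin e)
  ; +-homo = λ p q → ≋-trans (·-cong c (+-homo F-lin p q)) (·-distribˡ c (F p) (F q))
  ; ·-homo = λ d p → ≋-trans (·-cong c (·-homo F-lin d p)) (·-comm c d (F p))
  }

-‿isLinear : ∀ {F G} → IsLinear F → IsLinear G → IsLinear (λ p → F p - G p)
-‿isLinear F-lin G-lin = +-isLinear F-lin (·-isLinear -1ℤ G-lin)

0-isLinear : IsLinear (λ _ → 0#)
0-isLinear = record { cong≋ = λ _ → ≋-refl ; +-homo = λ _ _ → ≋-refl ; ·-homo = λ _ _ → ≋-refl }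

-- A property of this kind needs checking on words only. Through `preimage` and `equalizer` this
-- covers both membership of an image in a span and identities between linear maps.
record Submodule (Q : Pred 𝒜z 0ℓ) : Set where
  field
    resp≋  : ∀ {p q} → p ≋ q → Q p → Q q
    0∈    : Q 0#
    +∈    : ∀ {p q} → Q p → Q q → Q (p + q)
    ·∈    : ∀ c {p} → Q p → Q (c · p)

  -∈ : ∀ {p q} → Q p → Q q → Q (p - q)
  -∈ P Q = +∈ P (·∈ -1ℤ Q)
open Submodule

∷≋ : ∀ c w p → c · word w + p ≋ (c , w) ∷ p
∷≋ c w p = ≋-reflexive (cong (λ d → (d , w) ∷ p) (ℤ.*-identityʳ c))

All⇒submodule : ∀ {P : Pred Word 0ℓ} {Q} → Submodule Q → (∀ {w} → P w → Q (word w)) →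
  ∀ {p} → All (λ (_ , w) → P w) p → Q p
All⇒submodule S b []                       = 0∈ S
All⇒submodule S b {(c , w) ∷ p} (Pw ∷ Pp) =
  resp≋ S (∷≋ c w p) (+∈ S (·∈ S c (b Pw)) (All⇒submodule S b Pp))

-- A record for the same reason as `_≋_`: `Span P p` mentions `p` only through its coefficients, so
-- `p` could not be inferred from it.
infix 4 _∈Span_
record _∈Span_ (p : 𝒜z) (P : Pred Word 0ℓ) : Set where
  constructor spanned
  field span : Span P p
open _∈Span_

span-induction : ∀ {P Q} → Submodule Q → (∀ {w} → P w → Q (word w)) → ∀ {p} → p ∈Span P → Q p
span-induction S b (spanned (q , p≈q , Pq)) = resp≋ S (≋-sym ⌜ p≈q ⌝) (All⇒submodule S b Pq)

word-induction : ∀ {Q} → Submodule Q → (∀ w → Q (word w)) → ∀ p → Q p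
word-induction S b p = All⇒submodule {P = U} S (λ {w} _ → b w) (All.universal (λ _ → tt) p)

word∈Span : ∀ {P : Pred Word 0ℓ} {w} → P w → word w ∈Span P
word∈Span {w = w} Pw = spanned (word w , (λ _ → refl) , Pw ∷ [])

All⇒Span : ∀ {P : Pred Word 0ℓ} {p} → All (λ (_ , w) → P w) p → p ∈Span P
All⇒Span {p = p} Pp = spanned (p , (λ _ → refl) , Pp)

Span-submodule : ∀ P → Submodule (_∈Span P)
Span-submodule P .resp≋ p≋q (spanned (r , p≈r , Pr)) = spanned (r , (λ w → trans (sym (at p≋q w)) (p≈r w)) , Pr)
Span-submodule P .0∈ = spanned ([] , (λ _ → refl) , [])
Span-submodule P .+∈ {p} {q} (spanned (r , p≈r , Pr)) (spanned (s , q≈s , Ps)) =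
  spanned (r + s , at (+-cong {p} {r} {q} {s} ⌜ p≈r ⌝ ⌜ q≈s ⌝) , All.++⁺ Pr Ps)
Span-submodule P .·∈ c {p} (spanned (r , p≈r , Pr)) = spanned (c · r , at (·-cong c {p} {r} ⌜ p≈r ⌝) , All.map⁺ Pr)

preimage : ∀ {F Q} → IsLinear F → Submodule Q → Submodule (λ p → Q (F p))
preimage F S .resp≋ e = resp≋ S (cong≋ F e)
preimage F S .0∈ = resp≋ S (≋-sym (0-homo F)) (0∈ S)
preimage F S .+∈ P Q = resp≋ S (≋-sym (+-homo F _ _)) (+∈ S P Q)
preimage F S .·∈ c P = resp≋ S (≋-sym (·-homo F c _)) (·∈ S c P)

equalizer : ∀ {F G} → IsLinear F → IsLinear G → Submodule (λ p → F p ≋ G p)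
equalizer F G .resp≋ e h = ≋-trans (cong≋ F (≋-sym e)) (≋-trans h (cong≋ G e))
equalizer F G .0∈ = ≋-trans (0-homo F) (≋-sym (0-homo G))
equalizer F G .+∈ h k = ≋-trans (+-homo F _ _) (≋-trans (+-cong h k) (≋-sym (+-homo G _ _)))
equalizer F G .·∈ c h = ≋-trans (·-homo F c _) (≋-trans (·-cong c h) (≋-sym (·-homo G c _)))

linear-ext : ∀ {F G} → IsLinear F → IsLinear G → (∀ w → F (word w) ≋ G (word w)) → ∀ p → F p ≋ G p
linear-ext F G = word-induction (equalizer F G)

bilinear-isLinearˡ : ∀ f q → IsLinear (λ p → bilinear f p q)
bilinear-isLinearˡ f q = linear-isLinear (λ u → linear (f u) q)

linear-pointwise : ∀ {f g} → (∀ w → f w ≋ g w) → ∀ p → linear f p ≋ linear g p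
linear-pointwise {f} {g} e = linear-ext (linear-isLinear f) (linear-isLinear g)
  (λ w → ≋-trans (linear-word f w) (≋-trans (e w) (≋-sym (linear-word g w))))

bilinear-isLinearʳ : ∀ f p → IsLinear (bilinear f p)
bilinear-isLinearʳ f p .cong≋ {q} {r} e =
  linear-pointwise {λ u → linear (f u) q} {λ u → linear (f u) r} (λ u → cong≋ (linear-isLinear (f u)) e) p
bilinear-isLinearʳ f p .+-homo q r =
  linear-ext (linear-isLinear Fqr) (+-isLinear (linear-isLinear Fq) (linear-isLinear Fr))
  (λ u → ≋-trans (linear-word Fqr u) (≋-trans (+-homo (linear-isLinear (f u)) q r)
    (≋-sym (+-cong (linear-word Fq u) (linear-word Fr u))))) p
  where
  Fq Fr Fqr : Word → 𝒜z
  Fq u  = linear (f u) q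
  Fr u  = linear (f u) r
  Fqr u = linear (f u) (q + r)
bilinear-isLinearʳ f p .·-homo c q =
  linear-ext (linear-isLinear Fcq) (·-isLinear c (linear-isLinear Fq))
  (λ u → ≋-trans (linear-word Fcq u) (≋-trans (·-homo (linear-isLinear (f u)) c q)
    (≋-sym (·-cong c (linear-word Fq u))))) p
  where
  Fq Fcq : Word → 𝒜z
  Fq u  = linear (f u) q
  Fcq u = linear (f u) (c · q)

bilinear-word : ∀ f u v → bilinear f (word u) (word v) ≋ f u v
bilinear-word f u v = ≋-trans (linear-word (λ u → linear (f u) (word v)) u) (linear-word (f u) v)

record IsBilinear (B : 𝒜z → 𝒜z → 𝒜z) : Set where
  field
    linearˡ : ∀ q → IsLinear (λ p → B p q)
    linearʳ : ∀ p → IsLinear (B p)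

  cong₂≋ : ∀ {p p′ q q′} → p ≋ p′ → q ≋ q′ → B p q ≋ B p′ q′
  cong₂≋ {p′ = p′} {q} e f = ≋-trans (cong≋ (linearˡ q) e) (cong≋ (linearʳ p′) f)
open IsBilinear

bilinear-isBilinear : ∀ f → IsBilinear (bilinear f)
bilinear-isBilinear f = record { linearˡ = bilinear-isLinearˡ f ; linearʳ = bilinear-isLinearʳ f }

bilinear-ext : ∀ {B C} → IsBilinear B → IsBilinear C →
  (∀ u v → B (word u) (word v) ≋ C (word u) (word v)) → ∀ p q → B p q ≋ C p q
bilinear-ext B C e p q = linear-ext (linearˡ B q) (linearˡ C q)
  (λ u → linear-ext (linearʳ B (word u)) (linearʳ C (word u)) (e u) q) p

ш-isBilinear : IsBilinear _ш_
ш-isBilinear = bilinear-isBilinear _шʷ_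

*-isBilinear : IsBilinear _*_
*-isBilinear = bilinear-isBilinear _*ʷ_

infixl 6 _⟨+⟩_ _⟨-⟩_
_⟨+⟩_ _⟨-⟩_ : ∀ {B C} → IsBilinear B → IsBilinear C → IsBilinear _
_⟨+⟩_ {B} {C} b c = record
  { linearˡ = λ q → +-isLinear (linearˡ b q) (linearˡ c q)
  ; linearʳ = λ p → +-isLinear (linearʳ b p) (linearʳ c p) }
_⟨-⟩_ {B} {C} b c = record
  { linearˡ = λ q → -‿isLinear (linearˡ b q) (linearˡ c q)
  ; linearʳ = λ p → -‿isLinear (linearʳ b p) (linearʳ c p) }

compose : ∀ {H B F G} → IsLinear H → IsBilinear B → IsLinear F → IsLinear G →
  IsBilinear (λ p q → H (B (F p) (G q)))
compose {F = F} {G} h b f g = record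
  { linearˡ = λ q → ∘-isLinear h (∘-isLinear (linearˡ b (G q)) f)
  ; linearʳ = λ p → ∘-isLinear h (∘-isLinear (linearʳ b (F p)) g) }

-- The operators ∂_{z,α} and D as one family

data Kind : Set where
  final : Kind
  inner bounded : Letter → Kind

-- The tail of a word is no longer preceded by a₀, so the recursion continues without that boundary
-- term.
core : Kind → Kind
core final       = final
core (inner α)   = inner α
core (bounded α) = inner α

weight : Kind → Letter → Letter → ℤ
weight final       a b = 0ℤ
weight (inner α)   a b = δ (a ∷ b ∷ []) (ez ∷ α ∷ [])
weight (bounded α) a b = δ (a ∷ b ∷ []) (ez ∷ α ∷ [])

weightʳ : Kind → Letter → ℤ
weightʳ final       e1 = 1ℤ
weightʳ final       _  = 0ℤ
weightʳ (inner α)   a  = δ (a ∷ e1 ∷ []) (ez ∷ α ∷ [])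
weightʳ (bounded α) a  = δ (a ∷ e1 ∷ []) (ez ∷ α ∷ [])

weightˡ : Kind → Letter → ℤ
weightˡ (bounded α) a = δ (e0 ∷ a ∷ []) (ez ∷ α ∷ [])
weightˡ _           _ = 0ℤ

-- The sum defining ∂_{z,α} is regrouped by adjacent pairs instead of letters: a pair ab contributes
-- the deletion of a minus the deletion of b. The last letter is paired with a_{n+1} = 1, which is
-- never deleted, so only one deletion is left there. For `final` the inner pairs have weight 0 and
-- a last e₁ is deleted.
Gʷ : Kind → Letter → Word → 𝒜z
Gʷ κ a []      = weightʳ κ a · 1#
Gʷ κ a (b ∷ w) = weight κ a b · (word (b ∷ w) - word (a ∷ w))

Fʷ : Kind → Word → 𝒜z
Fʷ κ []      = 0#
Fʷ κ (a ∷ w) = (a ◃ Fʷ κ w) + Gʷ κ a w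

G : Kind → Letter → 𝒜z → 𝒜z
G κ a = linear (Gʷ κ a)

-- F final is D, F (bounded α) is ∂_{z,α}, and F (inner α) is ∂_{z,α} without
-- the contribution of the boundary letter a₀.
F : Kind → 𝒜z → 𝒜z
F (bounded α) = ∂ ez α
F κ           = linear (Fʷ κ)

F-isLinear : ∀ κ → IsLinear (F κ)
F-isLinear final       = linear-isLinear _
F-isLinear (inner α)   = linear-isLinear _
F-isLinear (bounded α) = linear-isLinear _

G-isLinear : ∀ κ a → IsLinear (G κ a)
G-isLinear κ a = linear-isLinear _

F-1 : ∀ κ → F κ 1# ≋ 0#
F-1 final       = ≋-refl
F-1 (inner α)   = ≋-refl
F-1 (bounded α) = ≋-refl

-- The left-hand pair of each letter is handed over to the letter before it; what remains is the
-- pair of `p` and `a`.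
∂ʷ-Fʷ : ∀ α p a w → ∂ʷ ez α p (a ∷ w) ≋
  (a ◃ Fʷ (inner α) w) + Gʷ (inner α) a w - δ (p ∷ a ∷ []) (ez ∷ α ∷ []) · word w
∂ʷ-Fʷ α p a [] = ⌜ coefficient ⌝
  where
  x = δ (a ∷ e1 ∷ []) (ez ∷ α ∷ [])
  y = δ (p ∷ a ∷ []) (ez ∷ α ∷ [])
  ring : ∀ x y e → (x ℤ.- y) ℤ.* e ℤ.+ 0ℤ ≡ x ℤ.* e ℤ.+ -1ℤ ℤ.* (y ℤ.* e)
  ring = solve-∀
  coefficient : (x ℤ.- y) · 1# + 0# ≈ x · 1# - y · 1#
  coefficient w
    rewrite coeff-+ w ((x ℤ.- y) · 1#) 0# | coeff-+ w (x · 1#) (- (y · 1#))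
          | coeff-· w (x ℤ.- y) 1# | coeff-· w x 1# | coeff-· w -1ℤ (y · 1#) | coeff-· w y 1#
          = ring x y (coeff w 1#)
∂ʷ-Fʷ α p a (b ∷ v) = ≋-trans (+-congʳ ((x ℤ.- y) · V) (≋-trans (cong≋ (◃-isLinear a) (∂ʷ-Fʷ α a b v))
    (≋-trans (-‿homo (◃-isLinear a) X (x · word v)) (+-congʳ (a ◃ X) (·-cong -1ℤ (·-homo (◃-isLinear a) x (word v)))))))
  ⌜ coefficient ⌝
  where
  X V W : 𝒜z
  X = Fʷ (inner α) (b ∷ v)
  V = word (b ∷ v)
  W = word (a ∷ v)
  x = δ (a ∷ b ∷ []) (ez ∷ α ∷ [])
  y = δ (p ∷ a ∷ []) (ez ∷ α ∷ [])
  ring : ∀ x y AX V W → (x ℤ.- y) ℤ.* V ℤ.+ (AX ℤ.+ -1ℤ ℤ.* (x ℤ.* W))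
    ≡ AX ℤ.+ x ℤ.* (V ℤ.+ -1ℤ ℤ.* W) ℤ.+ -1ℤ ℤ.* (y ℤ.* V)
  ring = solve-∀
  coefficient : (x ℤ.- y) · V + ((a ◃ X) - x · W) ≈ (a ◃ X) + x · (V - W) - y · V
  coefficient w
    rewrite coeff-+ w ((x ℤ.- y) · V) ((a ◃ X) - x · W) | coeff-+ w (a ◃ X) (- (x · W))
          | coeff-+ w ((a ◃ X) + x · (V - W)) (- (y · V)) | coeff-+ w (a ◃ X) (x · (V - W))
          | coeff-· w (x ℤ.- y) V | coeff-· w -1ℤ (x · W) | coeff-· w x W | coeff-· w x (V - W)
          | coeff-+ w V (- W) | coeff-· w -1ℤ W | coeff-· w -1ℤ (y · V) | coeff-· w y V
          = ring x y (coeff w (a ◃ X)) (coeff w V) (coeff w W)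

F-◃ : ∀ κ a p → F κ (a ◃ p) ≋ (a ◃ F (core κ) p) + G (core κ) a p - weightˡ κ a · p
F-◃ κ a = linear-ext (∘-isLinear (F-isLinear κ) (◃-isLinear a))
    (-‿isLinear (+-isLinear (∘-isLinear (◃-isLinear a) (F-isLinear (core κ))) (G-isLinear (core κ) a))
      (·-isLinear (weightˡ κ a) id-isLinear))
    (on-words κ)
  where
  unfold : ∀ κ w → F (core κ) (word w) ≋ Fʷ (core κ) w
  unfold final       w = linear-word (Fʷ final) w
  unfold (inner α)   w = linear-word (Fʷ (inner α)) w
  unfold (bounded α) w = linear-word (Fʷ (inner α)) w
  fold : ∀ κ w → (a ◃ Fʷ (core κ) w) + Gʷ (core κ) a w - weightˡ κ a · word w ≋
    (a ◃ F (core κ) (word w)) + G (core κ) a (word w) - weightˡ κ a · word w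
  fold κ w = +-congˡ (- (weightˡ κ a · word w))
    (+-cong (cong≋ (◃-isLinear a) (≋-sym (unfold κ w))) (≋-sym (linear-word (Gʷ (core κ) a) w)))
  trivial : ∀ κ w → Fʷ κ (a ∷ w) ≋ Fʷ κ (a ∷ w) - 0ℤ · word w
  trivial κ w = ≋-sym (≋-trans (+-congʳ (Fʷ κ (a ∷ w)) (≋-trans (·-cong -1ℤ (·-zero (word w))) ≋-refl))
    (+-identityʳ (Fʷ κ (a ∷ w))))
  on-words : ∀ κ w → F κ (word (a ∷ w)) ≋
    (a ◃ F (core κ) (word w)) + G (core κ) a (word w) - weightˡ κ a · word w
  on-words final       w = ≋-trans (linear-word (Fʷ final) (a ∷ w)) (≋-trans (trivial final w) (fold final w))
  on-words (inner α)   w = ≋-trans (linear-word (Fʷ (inner α)) (a ∷ w)) (≋-trans (trivial (inner α) w) (fold (inner α) w))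
  on-words (bounded α) w = ≋-trans (linear-word (∂ʷ ez α e0) (a ∷ w)) (≋-trans (∂ʷ-Fʷ α e0 a w) (fold (bounded α) w))

G-1 : ∀ κ a → G κ a 1# ≋ weightʳ κ a · 1#
G-1 κ a = linear-word (Gʷ κ a) []

G-◃ : ∀ κ a b p → G κ a (b ◃ p) ≋ weight κ a b · ((b ◃ p) - (a ◃ p))
G-◃ κ a b = linear-ext (∘-isLinear (G-isLinear κ a) (◃-isLinear b))
  (·-isLinear (weight κ a b) (-‿isLinear (◃-isLinear b) (◃-isLinear a)))
  (λ w → linear-word (Gʷ κ a) (b ∷ w))

-- Letterwise substitutions

-- `Const`, `λ′` and `ζ` all send each letter to a multiple of a letter, with e_z going to 0 under
-- `Const`. As one family they share a single proof of multiplicativity for ш.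
data Substitution : Set where
  constant z-to-1 1-to-z : Substitution

1↦z : Letter → Letter
1↦z e0 = e0
1↦z e1 = ez
1↦z ez = ez

ζ : 𝒜z → 𝒜z
ζ = linear λ w → word (map 1↦z w)

substitute : Substitution → 𝒜z → 𝒜z
substitute constant = Const
substitute z-to-1   = λ′
substitute 1-to-z   = ζ

scalar : Substitution → Letter → ℤ
scalar constant ez = 0ℤ
scalar _        _  = 1ℤ

image : Substitution → Letter → Letter
image constant a = a
image z-to-1   a = z↦1 a
image 1-to-z   a = 1↦z a

substitute-isLinear : ∀ s → IsLinear (substitute s)
substitute-isLinear constant = linear-isLinear (λ w → if does (all? (_∈? 01-letters) w) then word w else 0#)
substitute-isLinear z-to-1   = linear-isLinear (λ w → word (map z↦1 w))
substitute-isLinear 1-to-z   = linear-isLinear (λ w → word (map 1↦z w))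

substitute-1 : ∀ s → substitute s 1# ≋ 1#
substitute-1 constant = ≋-refl
substitute-1 z-to-1   = ≋-refl
substitute-1 1-to-z   = ≋-refl

substitute-◃ : ∀ s a p → substitute s (a ◃ p) ≋ scalar s a · (image s a ◃ substitute s p)
substitute-◃ s a = linear-ext (∘-isLinear (substitute-isLinear s) (◃-isLinear a))
    (·-isLinear (scalar s a) (∘-isLinear (◃-isLinear (image s a)) (substitute-isLinear s)))
    (on-words s a)
  where
  on-words : ∀ s a w → substitute s (word (a ∷ w)) ≋ scalar s a · (image s a ◃ substitute s (word w))
  on-words constant e0 w with does (all? (_∈? 01-letters) w)
  ... | true  = ≋-refl
  ... | false = ≋-refl
  on-words constant e1 w with does (all? (_∈? 01-letters) w)
  ... | true  = ≋-refl
  ... | false = ≋-refl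
  on-words constant ez w with does (all? (_∈? 01-letters) w)
  ... | true  = ⌜ (λ v → sym (at (·-zero (word (ez ∷ w))) v)) ⌝
  ... | false = ≋-refl
  on-words z-to-1 a w = ≋-refl
  on-words 1-to-z a w = ≋-refl

-- Units and recursions of the two products

ш-word : ∀ u v → word u ш word v ≋ u шʷ v
ш-word = bilinear-word _шʷ_

*-word : ∀ u v → word u * word v ≋ u *ʷ v
*-word = bilinear-word _*ʷ_

ш-identityˡ : ∀ p → 1# ш p ≋ p
ш-identityˡ = linear-ext (linearʳ ш-isBilinear 1#) id-isLinear (ш-word [])

ш-identityʳ : ∀ p → p ш 1# ≋ p
ш-identityʳ = linear-ext (linearˡ ш-isBilinear 1#) id-isLinear on-words
  where
  on-words : ∀ w → word w ш 1# ≋ word w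
  on-words []      = ≋-refl
  on-words (a ∷ w) = ≋-refl

*-identityˡ : ∀ p → 1# * p ≋ p
*-identityˡ = linear-ext (linearʳ *-isBilinear 1#) id-isLinear (*-word [])

*-identityʳ : ∀ p → p * 1# ≋ p
*-identityʳ = linear-ext (linearˡ *-isBilinear 1#) id-isLinear on-words
  where
  on-words : ∀ w → word w * 1# ≋ word w
  on-words []      = ≋-refl
  on-words (a ∷ w) = ≋-refl

ш-◃◃ : ∀ a b p q → (a ◃ p) ш (b ◃ q) ≋ (a ◃ p ш (b ◃ q)) + (b ◃ (a ◃ p) ш q)
ш-◃◃ a b = bilinear-ext
  (compose id-isLinear ш-isBilinear (◃-isLinear a) (◃-isLinear b))
  (compose (◃-isLinear a) ш-isBilinear id-isLinear (◃-isLinear b) ⟨+⟩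
   compose (◃-isLinear b) ш-isBilinear (◃-isLinear a) id-isLinear)
  (λ u v → ≋-trans (ш-word (a ∷ u) (b ∷ v)) (≋-sym (+-cong
    (cong≋ (◃-isLinear a) (ш-word u (b ∷ v))) (cong≋ (◃-isLinear b) (ш-word (a ∷ u) v)))))

*-◃◃ : ∀ a b p q → (a ◃ p) * (b ◃ q) ≋ (a ·ˡ b) ◃ (p * (b ◃ q) + (a ◃ p) * q - (e0 ◃ p * q))
*-◃◃ a b = bilinear-ext
  (compose id-isLinear *-isBilinear (◃-isLinear a) (◃-isLinear b))
  (record
    { linearˡ = λ q → ∘-isLinear (◃-isLinear (a ·ˡ b)) (linearˡ sum q)
    ; linearʳ = λ p → ∘-isLinear (◃-isLinear (a ·ˡ b)) (linearʳ sum p) })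
  (λ u v → ≋-trans (*-word (a ∷ u) (b ∷ v)) (≋-sym (cong≋ (◃-isLinear (a ·ˡ b))
    (-cong (+-cong (*-word u (b ∷ v)) (*-word (a ∷ u) v)) (cong≋ (◃-isLinear e0) (*-word u v))))))
  where
  sum = (compose id-isLinear *-isBilinear id-isLinear (◃-isLinear b) ⟨+⟩
         compose id-isLinear *-isBilinear (◃-isLinear a) id-isLinear) ⟨-⟩
        compose (◃-isLinear e0) *-isBilinear id-isLinear id-isLinear

-- A symbolic normaliser for identities with unknown tails

data Operator : Set where
  f : Kind → Operator
  g : Kind → Letter → Operator
  s : Substitution → Operator

apply : Operator → 𝒜z → 𝒜z
apply (f κ)   = F κ
apply (g κ a) = G κ a
apply (s σ)   = substitute σ

apply-isLinear : ∀ o → IsLinear (apply o)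
apply-isLinear (f κ)   = F-isLinear κ
apply-isLinear (g κ a) = G-isLinear κ a
apply-isLinear (s σ)   = substitute-isLinear σ

-- A monomial (u , h) stands for the word u prepended to the head h, where the
-- head nothing is 1.
data Atom : Set where
  var             : ℕ → Atom
  app             : Operator → Atom → Atom
  shuffle stuffle : Word → Maybe Atom → Word → Maybe Atom → Atom

Head Monomial Poly : Set
Head     = Maybe Atom
Monomial = Word × Head
Poly     = List (ℤ × Monomial)

infixr 8 _▹_ _⊙_ _$ᵉ_
infixl 6 _⊕_ _⊖_
infixl 7 _⟨ш⟩_ _⟨*⟩_

data Expr : Set where
  var             : ℕ → Expr
  𝟙 𝟘             : Expr
  _▹_             : Letter → Expr → Expr
  _⊙_             : ℤ → Expr → Expr
  _$ᵉ_            : Operator → Expr → Expr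
  _⊕_ _⊖_         : Expr → Expr → Expr
  _⟨ш⟩_ _⟨*⟩_     : Expr → Expr → Expr

Rules : Set
Rules = List (Atom × Poly)

_≟ᵏ_ : (κ ι : Kind) → Maybe (κ ≡ ι)
final ≟ᵏ final = just refl
inner α ≟ᵏ inner β with α ≟ˡ β
... | yes refl = just refl
... | no _     = nothing
bounded α ≟ᵏ bounded β with α ≟ˡ β
... | yes refl = just refl
... | no _     = nothing
_ ≟ᵏ _ = nothing

_≟ᵒ_ : (o o′ : Operator) → Maybe (o ≡ o′)
f κ ≟ᵒ f ι with κ ≟ᵏ ι
... | just refl = just refl
... | nothing   = nothing
g κ a ≟ᵒ g ι b with κ ≟ᵏ ι | a ≟ˡ b
... | just refl | yes refl = just refl
... | _         | _        = nothing
s constant ≟ᵒ s constant = just refl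
s z-to-1   ≟ᵒ s z-to-1   = just refl
s 1-to-z   ≟ᵒ s 1-to-z   = just refl
_ ≟ᵒ _ = nothing

_≟ᵃ_ : (x y : Atom) → Maybe (x ≡ y)
_≟ʰ_ : (h k : Head) → Maybe (h ≡ k)

nothing ≟ʰ nothing = just refl
just x ≟ʰ just y with x ≟ᵃ y
... | just refl = just refl
... | nothing   = nothing
_ ≟ʰ _ = nothing

var i ≟ᵃ var j with i ℕ.≟ j
... | yes refl = just refl
... | no _     = nothing
app o x ≟ᵃ app o′ y with o ≟ᵒ o′ | x ≟ᵃ y
... | just refl | just refl = just refl
... | _         | _         = nothing
shuffle u h v k ≟ᵃ shuffle u′ h′ v′ k′ with u ≟ʷ u′ | v ≟ʷ v′ | h ≟ʰ h′ | k ≟ʰ k′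
... | yes refl | yes refl | just refl | just refl = just refl
... | _        | _        | _         | _         = nothing
stuffle u h v k ≟ᵃ stuffle u′ h′ v′ k′ with u ≟ʷ u′ | v ≟ʷ v′ | h ≟ʰ h′ | k ≟ʰ k′
... | yes refl | yes refl | just refl | just refl = just refl
... | _        | _        | _         | _         = nothing
_ ≟ᵃ _ = nothing

prefix : Letter → Poly → Poly
prefix a = map λ (c , u , h) → c , a ∷ u , h

scale : ℤ → Poly → Poly
scale c = map λ (d , m) → c ℤ.* d , m

bind : Poly → (Word → Head → Poly) → Poly
bind []              k = []
bind ((c , u , h) ∷ p) k = scale c (k u h) ++ bind p k

stuck : Rules → Atom → Poly
stuck []            x = [ (1ℤ , [] , just x) ]
stuck ((y , p) ∷ R) x with x ≟ᵃ y
... | just _  = p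
... | nothing = stuck R x

applyᵐ : Rules → Operator → Word → Head → Poly
applyᵐ R o       []      (just x) = stuck R (app o x)
applyᵐ R (f κ)   []      nothing  = []
applyᵐ R (g κ a) []      nothing  = [ (weightʳ κ a , [] , nothing) ]
applyᵐ R (s σ)   []      nothing  = [ (1ℤ , [] , nothing) ]
applyᵐ R (f κ)   (a ∷ u) h        = prefix a (applyᵐ R (f (core κ)) u h) ++ applyᵐ R (g (core κ) a) u h
  ++ [ (-1ℤ ℤ.* weightˡ κ a , u , h) ]
applyᵐ R (g κ a) (b ∷ u) h        = (weight κ a b , b ∷ u , h) ∷ (weight κ a b ℤ.* -1ℤ , a ∷ u , h) ∷ []
applyᵐ R (s σ)   (a ∷ u) h        = scale (scalar σ a) (prefix (image σ a) (applyᵐ R (s σ) u h))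

-- The recursion of the product stops where a factor is reduced to an opaque atom, whose first
-- letter is unknown; unless the other factor is 1, the product then becomes a new atom.
shuffleᵐ : Word → Head → Word → Head → Poly
shuffleᵐ []      nothing  v       k        = [ (1ℤ , v , k) ]
shuffleᵐ []      (just x) []      nothing  = [ (1ℤ , [] , just x) ]
shuffleᵐ []      (just x) []      (just y) = [ (1ℤ , [] , just (shuffle [] (just x) [] (just y))) ]
shuffleᵐ []      (just x) (b ∷ v) k        = [ (1ℤ , [] , just (shuffle [] (just x) (b ∷ v) k)) ]
shuffleᵐ (a ∷ u) h        []      nothing  = [ (1ℤ , a ∷ u , h) ]
shuffleᵐ (a ∷ u) h        []      (just y) = [ (1ℤ , [] , just (shuffle (a ∷ u) h [] (just y))) ]
shuffleᵐ (a ∷ u) h        (b ∷ v) k        = prefix a (shuffleᵐ u h (b ∷ v) k) ++ prefix b (shuffleᵐ (a ∷ u) h v k)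

stuffleᵐ : Word → Head → Word → Head → Poly
stuffleᵐ []      nothing  v       k        = [ (1ℤ , v , k) ]
stuffleᵐ []      (just x) []      nothing  = [ (1ℤ , [] , just x) ]
stuffleᵐ []      (just x) []      (just y) = [ (1ℤ , [] , just (stuffle [] (just x) [] (just y))) ]
stuffleᵐ []      (just x) (b ∷ v) k        = [ (1ℤ , [] , just (stuffle [] (just x) (b ∷ v) k)) ]
stuffleᵐ (a ∷ u) h        []      nothing  = [ (1ℤ , a ∷ u , h) ]
stuffleᵐ (a ∷ u) h        []      (just y) = [ (1ℤ , [] , just (stuffle (a ∷ u) h [] (just y))) ]
stuffleᵐ (a ∷ u) h        (b ∷ v) k        = prefix (a ·ˡ b)
  (stuffleᵐ u h (b ∷ v) k ++ stuffleᵐ (a ∷ u) h v k ++ scale -1ℤ (prefix e0 (stuffleᵐ u h v k)))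

Bindings : Set
Bindings = List (ℕ × Monomial)

valueOf : Bindings → ℕ → Poly
valueOf []            i = [ (1ℤ , [] , just (var i)) ]
valueOf ((j , m) ∷ B) i with i ℕ.≟ j
... | yes _ = [ (1ℤ , m) ]
... | no _  = valueOf B i

normalise : Rules → Bindings → Expr → Poly
normalise R B (var i)   = valueOf B i
normalise R B 𝟙         = [ (1ℤ , [] , nothing) ]
normalise R B 𝟘         = []
normalise R B (a ▹ x)   = prefix a (normalise R B x)
normalise R B (c ⊙ x)   = scale c (normalise R B x)
normalise R B (o $ᵉ x)  = bind (normalise R B x) (applyᵐ R o)
normalise R B (x ⊕ y)   = normalise R B x ++ normalise R B y
normalise R B (x ⊖ y)   = normalise R B x ++ scale -1ℤ (normalise R B y)
normalise R B (x ⟨ш⟩ y) = bind (normalise R B x) λ u h → bind (normalise R B y) (shuffleᵐ u h)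
normalise R B (x ⟨*⟩ y) = bind (normalise R B x) λ u h → bind (normalise R B y) (stuffleᵐ u h)

insert : ℤ → Monomial → Poly → Poly
insert c (u , h) []                  = [ (c , u , h) ]
insert c (u , h) ((d , v , k) ∷ p) with u ≟ʷ v | h ≟ʰ k
... | yes _ | just _ = (c ℤ.+ d , v , k) ∷ p
... | _     | _      = (d , v , k) ∷ insert c (u , h) p

collect : Poly → Poly
collect []            = []
collect ((c , m) ∷ p) = insert c m (collect p)

isZero : Poly → Bool
isZero []                      = true
isZero ((ℤ.+ zero , _) ∷ p)    = isZero p
isZero (_ ∷ p)                 = false

embedᵃ : Atom → Expr
embedʰ : Head → Expr
embedᵐ : Word → Head → Expr
embedᵃ (var i)           = var i
embedᵃ (app o x)         = o $ᵉ embedᵃ x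
embedᵃ (shuffle u h v k) = foldr _▹_ (embedʰ h) u ⟨ш⟩ foldr _▹_ (embedʰ k) v
embedᵃ (stuffle u h v k) = foldr _▹_ (embedʰ h) u ⟨*⟩ foldr _▹_ (embedʰ k) v
embedʰ nothing  = 𝟙
embedʰ (just x) = embedᵃ x
embedᵐ u h = foldr _▹_ (embedʰ h) u

embed : Poly → Expr
embed []                = 𝟘
embed ((c , u , h) ∷ p) = c ⊙ embedᵐ u h ⊕ embed p

-- A hypothesis becomes a rewrite rule if its left-hand side normalises to one atom with coefficient
-- 1; any other hypothesis is passed over, which does not affect soundness.
compile : List (Expr × Expr) → Rules
compile []             = []
compile ((l , r) ∷ es) with normalise [] [] l
... | (ℤ.+ 1 , [] , just x) ∷ [] = (x , normalise [] [] r) ∷ compile es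
... | _                          = compile es

-- The equations es, which are typically induction hypotheses, rewrite an operator
-- applied to an atom while the variables are still opaque.  Only then are the
-- variables replaced by their values in B: otherwise the left-hand sides of es
-- would be expanded before they could match.
check : List (Expr × Expr) → Bindings → Expr → Expr → Bool
check es B l r = isZero (collect (normalise [] B (embed (collect (normalise (compile es) [] (l ⊖ r))))))

-- Soundness of the normaliser

module Semantics (ρ : ℕ → 𝒜z) where

  ⟦_⟧ᵃ : Atom → 𝒜z
  ⟦_⟧ʰ : Head → 𝒜z
  ⟦ var i ⟧ᵃ           = ρ i
  ⟦ app o x ⟧ᵃ         = apply o ⟦ x ⟧ᵃ
  ⟦ shuffle u h v k ⟧ᵃ = foldr _◃_ ⟦ h ⟧ʰ u ш foldr _◃_ ⟦ k ⟧ʰ v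
  ⟦ stuffle u h v k ⟧ᵃ = foldr _◃_ ⟦ h ⟧ʰ u * foldr _◃_ ⟦ k ⟧ʰ v
  ⟦ nothing ⟧ʰ = 1#
  ⟦ just x ⟧ʰ  = ⟦ x ⟧ᵃ

  ⟦_,_⟧ᵐ : Word → Head → 𝒜z
  ⟦ u , h ⟧ᵐ = foldr _◃_ ⟦ h ⟧ʰ u

  ⟦_⟧ᵖ : Poly → 𝒜z
  ⟦ [] ⟧ᵖ              = 0#
  ⟦ (c , u , h) ∷ p ⟧ᵖ = c · ⟦ u , h ⟧ᵐ + ⟦ p ⟧ᵖ

  ⟦_⟧ : Expr → 𝒜z
  ⟦ var i ⟧   = ρ i
  ⟦ 𝟙 ⟧       = 1#
  ⟦ 𝟘 ⟧       = 0#
  ⟦ a ▹ x ⟧   = a ◃ ⟦ x ⟧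
  ⟦ c ⊙ x ⟧   = c · ⟦ x ⟧
  ⟦ o $ᵉ x ⟧  = apply o ⟦ x ⟧
  ⟦ x ⊕ y ⟧   = ⟦ x ⟧ + ⟦ y ⟧
  ⟦ x ⊖ y ⟧   = ⟦ x ⟧ - ⟦ y ⟧
  ⟦ x ⟨ш⟩ y ⟧ = ⟦ x ⟧ ш ⟦ y ⟧
  ⟦ x ⟨*⟩ y ⟧ = ⟦ x ⟧ * ⟦ y ⟧

  Holds : Expr × Expr → Set
  Holds (l , r) = ⟦ l ⟧ ≋ ⟦ r ⟧

  Valid : ℕ × Monomial → Set
  Valid (i , u , h) = ⟦ u , h ⟧ᵐ ≋ ρ i

  Sound : Atom × Poly → Set
  Sound (x , p) = ⟦ p ⟧ᵖ ≋ ⟦ x ⟧ᵃ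

  term-sound : ∀ u h → ⟦ [ (1ℤ , u , h) ] ⟧ᵖ ≋ ⟦ u , h ⟧ᵐ
  term-sound u h = ≋-trans (+-identityʳ (1ℤ · ⟦ u , h ⟧ᵐ)) (·-identity ⟦ u , h ⟧ᵐ)

  ++-sound : ∀ p q → ⟦ p ++ q ⟧ᵖ ≋ ⟦ p ⟧ᵖ + ⟦ q ⟧ᵖ
  ++-sound []                q = ≋-refl
  ++-sound ((c , u , h) ∷ p) q = ≋-trans (+-congʳ (c · ⟦ u , h ⟧ᵐ) (++-sound p q))
    (≋-sym (+-assoc (c · ⟦ u , h ⟧ᵐ) ⟦ p ⟧ᵖ ⟦ q ⟧ᵖ))

  prefix-sound : ∀ a p → ⟦ prefix a p ⟧ᵖ ≋ a ◃ ⟦ p ⟧ᵖ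
  prefix-sound a []                = ≋-refl
  prefix-sound a ((c , u , h) ∷ p) = ≋-trans
    (+-cong (≋-sym (·-homo (◃-isLinear a) c ⟦ u , h ⟧ᵐ)) (prefix-sound a p))
    (≋-sym (+-homo (◃-isLinear a) (c · ⟦ u , h ⟧ᵐ) ⟦ p ⟧ᵖ))

  scale-sound : ∀ c p → ⟦ scale c p ⟧ᵖ ≋ c · ⟦ p ⟧ᵖ
  scale-sound c []                = ≋-refl
  scale-sound c ((d , u , h) ∷ p) = ≋-trans
    (+-cong (·-assoc c d ⟦ u , h ⟧ᵐ) (scale-sound c p))
    (≋-sym (·-distribˡ c (d · ⟦ u , h ⟧ᵐ) ⟦ p ⟧ᵖ))

  bind-sound : ∀ {φ k} → IsLinear φ → (∀ u h → ⟦ k u h ⟧ᵖ ≋ φ ⟦ u , h ⟧ᵐ) →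
    ∀ p → ⟦ bind p k ⟧ᵖ ≋ φ ⟦ p ⟧ᵖ
  bind-sound         φ-lin e []                = ≋-sym (0-homo φ-lin)
  bind-sound {φ} {k} φ-lin e ((c , u , h) ∷ p) = begin
    ⟦ scale c (k u h) ++ bind p k ⟧ᵖ         ≈⟨ ++-sound (scale c (k u h)) (bind p k) ⟩
    ⟦ scale c (k u h) ⟧ᵖ + ⟦ bind p k ⟧ᵖ     ≈⟨ +-cong (≋-trans (scale-sound c (k u h)) (·-cong c (e u h))) (bind-sound φ-lin e p) ⟩
    c · φ ⟦ u , h ⟧ᵐ + φ ⟦ p ⟧ᵖ              ≈⟨ +-congˡ (φ ⟦ p ⟧ᵖ) (·-homo φ-lin c ⟦ u , h ⟧ᵐ) ⟨
    φ (c · ⟦ u , h ⟧ᵐ) + φ ⟦ p ⟧ᵖ            ≈⟨ +-homo φ-lin (c · ⟦ u , h ⟧ᵐ) ⟦ p ⟧ᵖ ⟨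
    φ (c · ⟦ u , h ⟧ᵐ + ⟦ p ⟧ᵖ)              ∎
    where open ≋-Reasoning

  stuck-sound : ∀ {R} → All Sound R → ∀ x → ⟦ stuck R x ⟧ᵖ ≋ ⟦ x ⟧ᵃ
  stuck-sound []                     x = term-sound [] (just x)
  stuck-sound {(y , p) ∷ R} (e ∷ es) x with x ≟ᵃ y
  ... | just refl = e
  ... | nothing   = stuck-sound es x

  applyᵐ-sound : ∀ {R} → All Sound R → ∀ o u h → ⟦ applyᵐ R o u h ⟧ᵖ ≋ apply o ⟦ u , h ⟧ᵐ
  applyᵐ-sound S o       []      (just x) = stuck-sound S (app o x)
  applyᵐ-sound S (f κ)   []      nothing  = ≋-sym (F-1 κ)
  applyᵐ-sound S (g κ a) []      nothing  = ≋-trans (+-identityʳ (weightʳ κ a · 1#)) (≋-sym (G-1 κ a))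
  applyᵐ-sound S (s σ)   []      nothing  = ≋-sym (substitute-1 σ)
  applyᵐ-sound {R} S (f κ) (a ∷ u) h = begin
    ⟦ prefix a x ++ y ++ z ⟧ᵖ                 ≈⟨ ++-sound (prefix a x) (y ++ z) ⟩
    ⟦ prefix a x ⟧ᵖ + ⟦ y ++ z ⟧ᵖ             ≈⟨ +-congʳ ⟦ prefix a x ⟧ᵖ (++-sound y z) ⟩
    ⟦ prefix a x ⟧ᵖ + (⟦ y ⟧ᵖ + ⟦ z ⟧ᵖ)       ≈⟨ +-assoc ⟦ prefix a x ⟧ᵖ ⟦ y ⟧ᵖ ⟦ z ⟧ᵖ ⟨
    ⟦ prefix a x ⟧ᵖ + ⟦ y ⟧ᵖ + ⟦ z ⟧ᵖ         ≈⟨ +-cong (+-cong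
      (≋-trans (prefix-sound a x) (cong≋ (◃-isLinear a) (applyᵐ-sound S (f (core κ)) u h)))
      (applyᵐ-sound S (g (core κ) a) u h))
      (≋-trans (+-identityʳ ((-1ℤ ℤ.* weightˡ κ a) · m)) (·-assoc -1ℤ (weightˡ κ a) m)) ⟩
    (a ◃ F (core κ) m) + G (core κ) a m - weightˡ κ a · m ≈⟨ F-◃ κ a m ⟨
    F κ (a ◃ m)                               ∎
    where
    open ≋-Reasoning
    m = ⟦ u , h ⟧ᵐ
    x = applyᵐ R (f (core κ)) u h
    y = applyᵐ R (g (core κ) a) u h
    z = [ (-1ℤ ℤ.* weightˡ κ a , u , h) ]
  applyᵐ-sound S (g κ a) (b ∷ u) h = begin
    c · (b ◃ m) + ((c ℤ.* -1ℤ) · (a ◃ m) + 0#)  ≈⟨ +-congʳ (c · (b ◃ m)) (≋-trans (+-identityʳ ((c ℤ.* -1ℤ) · (a ◃ m))) (·-assoc c -1ℤ (a ◃ m))) ⟩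
    c · (b ◃ m) + c · (- (a ◃ m))               ≈⟨ ·-distribˡ c (b ◃ m) (- (a ◃ m)) ⟨
    c · ((b ◃ m) - (a ◃ m))                     ≈⟨ G-◃ κ a b m ⟨
    G κ a (b ◃ m)                               ∎
    where
    open ≋-Reasoning
    m = ⟦ u , h ⟧ᵐ
    c = weight κ a b
  applyᵐ-sound {R} S (s σ) (a ∷ u) h = begin
    ⟦ scale (scalar σ a) (prefix (image σ a) p) ⟧ᵖ     ≈⟨ scale-sound (scalar σ a) (prefix (image σ a) p) ⟩
    scalar σ a · ⟦ prefix (image σ a) p ⟧ᵖ             ≈⟨ ·-cong (scalar σ a) (prefix-sound (image σ a) p) ⟩
    scalar σ a · (image σ a ◃ ⟦ p ⟧ᵖ)                  ≈⟨ ·-cong (scalar σ a) (cong≋ (◃-isLinear (image σ a)) (applyᵐ-sound S (s σ) u h)) ⟩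
    scalar σ a · (image σ a ◃ substitute σ ⟦ u , h ⟧ᵐ) ≈⟨ substitute-◃ σ a ⟦ u , h ⟧ᵐ ⟨
    substitute σ (a ◃ ⟦ u , h ⟧ᵐ)                      ∎
    where
    open ≋-Reasoning
    p = applyᵐ R (s σ) u h

  shuffleᵐ-sound : ∀ u h v k → ⟦ shuffleᵐ u h v k ⟧ᵖ ≋ ⟦ u , h ⟧ᵐ ш ⟦ v , k ⟧ᵐ
  shuffleᵐ-sound []      nothing  v       k        = ≋-trans (term-sound v k) (≋-sym (ш-identityˡ ⟦ v , k ⟧ᵐ))
  shuffleᵐ-sound []      (just x) []      nothing  = ≋-trans (term-sound [] (just x)) (≋-sym (ш-identityʳ ⟦ x ⟧ᵃ))
  shuffleᵐ-sound []      (just x) []      (just y) = term-sound [] (just (shuffle [] (just x) [] (just y)))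
  shuffleᵐ-sound []      (just x) (b ∷ v) k        = term-sound [] (just (shuffle [] (just x) (b ∷ v) k))
  shuffleᵐ-sound (a ∷ u) h        []      nothing  = ≋-trans (term-sound (a ∷ u) h) (≋-sym (ш-identityʳ ⟦ a ∷ u , h ⟧ᵐ))
  shuffleᵐ-sound (a ∷ u) h        []      (just y) = term-sound [] (just (shuffle (a ∷ u) h [] (just y)))
  shuffleᵐ-sound (a ∷ u) h        (b ∷ v) k        = begin
    ⟦ prefix a x ++ prefix b y ⟧ᵖ        ≈⟨ ++-sound (prefix a x) (prefix b y) ⟩
    ⟦ prefix a x ⟧ᵖ + ⟦ prefix b y ⟧ᵖ    ≈⟨ +-cong
      (≋-trans (prefix-sound a x) (cong≋ (◃-isLinear a) (shuffleᵐ-sound u h (b ∷ v) k)))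
      (≋-trans (prefix-sound b y) (cong≋ (◃-isLinear b) (shuffleᵐ-sound (a ∷ u) h v k))) ⟩
    (a ◃ m ш (b ◃ n)) + (b ◃ (a ◃ m) ш n) ≈⟨ ш-◃◃ a b m n ⟨
    (a ◃ m) ш (b ◃ n)                    ∎
    where
    open ≋-Reasoning
    m = ⟦ u , h ⟧ᵐ
    n = ⟦ v , k ⟧ᵐ
    x = shuffleᵐ u h (b ∷ v) k
    y = shuffleᵐ (a ∷ u) h v k

  stuffleᵐ-sound : ∀ u h v k → ⟦ stuffleᵐ u h v k ⟧ᵖ ≋ ⟦ u , h ⟧ᵐ * ⟦ v , k ⟧ᵐ
  stuffleᵐ-sound []      nothing  v       k        = ≋-trans (term-sound v k) (≋-sym (*-identityˡ ⟦ v , k ⟧ᵐ))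
  stuffleᵐ-sound []      (just x) []      nothing  = ≋-trans (term-sound [] (just x)) (≋-sym (*-identityʳ ⟦ x ⟧ᵃ))
  stuffleᵐ-sound []      (just x) []      (just y) = term-sound [] (just (stuffle [] (just x) [] (just y)))
  stuffleᵐ-sound []      (just x) (b ∷ v) k        = term-sound [] (just (stuffle [] (just x) (b ∷ v) k))
  stuffleᵐ-sound (a ∷ u) h        []      nothing  = ≋-trans (term-sound (a ∷ u) h) (≋-sym (*-identityʳ ⟦ a ∷ u , h ⟧ᵐ))
  stuffleᵐ-sound (a ∷ u) h        []      (just y) = term-sound [] (just (stuffle (a ∷ u) h [] (just y)))
  stuffleᵐ-sound (a ∷ u) h        (b ∷ v) k        = begin
    ⟦ prefix (a ·ˡ b) (x ++ y ++ w) ⟧ᵖ                 ≈⟨ prefix-sound (a ·ˡ b) (x ++ y ++ w) ⟩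
    (a ·ˡ b) ◃ ⟦ x ++ y ++ w ⟧ᵖ                        ≈⟨ cong≋ (◃-isLinear (a ·ˡ b)) (begin
      ⟦ x ++ y ++ w ⟧ᵖ                 ≈⟨ ++-sound x (y ++ w) ⟩
      ⟦ x ⟧ᵖ + ⟦ y ++ w ⟧ᵖ             ≈⟨ +-congʳ ⟦ x ⟧ᵖ (++-sound y w) ⟩
      ⟦ x ⟧ᵖ + (⟦ y ⟧ᵖ + ⟦ w ⟧ᵖ)       ≈⟨ +-assoc ⟦ x ⟧ᵖ ⟦ y ⟧ᵖ ⟦ w ⟧ᵖ ⟨
      ⟦ x ⟧ᵖ + ⟦ y ⟧ᵖ + ⟦ w ⟧ᵖ         ≈⟨ +-cong (+-cong (stuffleᵐ-sound u h (b ∷ v) k) (stuffleᵐ-sound (a ∷ u) h v k))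
        (≋-trans (scale-sound -1ℤ (prefix e0 z)) (·-cong -1ℤ (≋-trans (prefix-sound e0 z)
          (cong≋ (◃-isLinear e0) (stuffleᵐ-sound u h v k))))) ⟩
      m * (b ◃ n) + (a ◃ m) * n - (e0 ◃ m * n) ∎) ⟩
    (a ·ˡ b) ◃ (m * (b ◃ n) + (a ◃ m) * n - (e0 ◃ m * n)) ≈⟨ *-◃◃ a b m n ⟨
    (a ◃ m) * (b ◃ n)                                  ∎
    where
    open ≋-Reasoning
    m = ⟦ u , h ⟧ᵐ
    n = ⟦ v , k ⟧ᵐ
    x = stuffleᵐ u h (b ∷ v) k
    y = stuffleᵐ (a ∷ u) h v k
    z = stuffleᵐ u h v k
    w = scale -1ℤ (prefix e0 z)

  valueOf-sound : ∀ {B} → All Valid B → ∀ i → ⟦ valueOf B i ⟧ᵖ ≋ ρ i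
  valueOf-sound []                         i = term-sound [] (just (var i))
  valueOf-sound {(j , u , h) ∷ B} (e ∷ es) i with i ℕ.≟ j
  ... | yes refl = ≋-trans (term-sound u h) e
  ... | no _     = valueOf-sound es i

  module _ {R B} (S : All Sound R) (V : All Valid B) where

    normalise-sound : ∀ x → ⟦ normalise R B x ⟧ᵖ ≋ ⟦ x ⟧
    normalise-sound (var i)   = valueOf-sound V i
    normalise-sound 𝟙         = term-sound [] nothing
    normalise-sound 𝟘         = ≋-refl
    normalise-sound (a ▹ x)   = ≋-trans (prefix-sound a (normalise R B x)) (cong≋ (◃-isLinear a) (normalise-sound x))
    normalise-sound (c ⊙ x)   = ≋-trans (scale-sound c (normalise R B x)) (·-cong c (normalise-sound x))
    normalise-sound (o $ᵉ x)  = ≋-trans (bind-sound (apply-isLinear o) (applyᵐ-sound S o) (normalise R B x))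
      (cong≋ (apply-isLinear o) (normalise-sound x))
    normalise-sound (x ⊕ y)   = ≋-trans (++-sound (normalise R B x) (normalise R B y))
      (+-cong (normalise-sound x) (normalise-sound y))
    normalise-sound (x ⊖ y)   = ≋-trans (++-sound (normalise R B x) (scale -1ℤ (normalise R B y)))
      (+-cong (normalise-sound x) (≋-trans (scale-sound -1ℤ (normalise R B y)) (·-cong -1ℤ (normalise-sound y))))
    normalise-sound (x ⟨ш⟩ y) = ≋-trans
      (bind-sound (linearˡ ш-isBilinear ⟦ normalise R B y ⟧ᵖ)
        (λ u h → bind-sound (linearʳ ш-isBilinear ⟦ u , h ⟧ᵐ) (shuffleᵐ-sound u h) (normalise R B y)) (normalise R B x))
      (cong₂≋ ш-isBilinear (normalise-sound x) (normalise-sound y))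
    normalise-sound (x ⟨*⟩ y) = ≋-trans
      (bind-sound (linearˡ *-isBilinear ⟦ normalise R B y ⟧ᵖ)
        (λ u h → bind-sound (linearʳ *-isBilinear ⟦ u , h ⟧ᵐ) (stuffleᵐ-sound u h) (normalise R B y)) (normalise R B x))
      (cong₂≋ *-isBilinear (normalise-sound x) (normalise-sound y))

  insert-sound : ∀ c u h p → ⟦ insert c (u , h) p ⟧ᵖ ≋ c · ⟦ u , h ⟧ᵐ + ⟦ p ⟧ᵖ
  insert-sound c u h []                = ≋-refl
  insert-sound c u h ((d , v , k) ∷ p) with u ≟ʷ v | h ≟ʰ k
  ... | yes refl | just refl = ≋-trans (+-congˡ ⟦ p ⟧ᵖ (·-distribʳ c d ⟦ u , h ⟧ᵐ))
          (+-assoc (c · ⟦ u , h ⟧ᵐ) (d · ⟦ u , h ⟧ᵐ) ⟦ p ⟧ᵖ)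
  ... | yes refl | nothing   = swap c u h d v k p (insert-sound c u h p)
    where
    swap : ∀ c u h d v k p {q} → q ≋ c · ⟦ u , h ⟧ᵐ + ⟦ p ⟧ᵖ →
      d · ⟦ v , k ⟧ᵐ + q ≋ c · ⟦ u , h ⟧ᵐ + (d · ⟦ v , k ⟧ᵐ + ⟦ p ⟧ᵖ)
    swap c u h d v k p e = ≋-trans (+-congʳ (d · ⟦ v , k ⟧ᵐ) e) (≋-trans
      (≋-sym (+-assoc (d · ⟦ v , k ⟧ᵐ) (c · ⟦ u , h ⟧ᵐ) ⟦ p ⟧ᵖ)) (≋-trans
      (+-congˡ ⟦ p ⟧ᵖ (+-comm (d · ⟦ v , k ⟧ᵐ) (c · ⟦ u , h ⟧ᵐ)))
      (+-assoc (c · ⟦ u , h ⟧ᵐ) (d · ⟦ v , k ⟧ᵐ) ⟦ p ⟧ᵖ)))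
  ... | no _     | _         = ≋-trans (+-congʳ (d · ⟦ v , k ⟧ᵐ) (insert-sound c u h p)) (≋-trans
      (≋-sym (+-assoc (d · ⟦ v , k ⟧ᵐ) (c · ⟦ u , h ⟧ᵐ) ⟦ p ⟧ᵖ)) (≋-trans
      (+-congˡ ⟦ p ⟧ᵖ (+-comm (d · ⟦ v , k ⟧ᵐ) (c · ⟦ u , h ⟧ᵐ)))
      (+-assoc (c · ⟦ u , h ⟧ᵐ) (d · ⟦ v , k ⟧ᵐ) ⟦ p ⟧ᵖ)))

  collect-sound : ∀ p → ⟦ collect p ⟧ᵖ ≋ ⟦ p ⟧ᵖ
  collect-sound []                = ≋-refl
  collect-sound ((c , u , h) ∷ p) = ≋-trans (insert-sound c u h (collect p))
    (+-congʳ (c · ⟦ u , h ⟧ᵐ) (collect-sound p))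

  isZero-sound : ∀ p → isZero p ≡ true → ⟦ p ⟧ᵖ ≋ 0#
  isZero-sound []                             _ = ≋-refl
  isZero-sound ((ℤ.+ zero , u , h) ∷ p)       e = ≋-trans (+-cong (·-zero ⟦ u , h ⟧ᵐ) (isZero-sound p e)) ≋-refl

  embedᵃ-sound : ∀ x → ⟦ embedᵃ x ⟧ ≡ ⟦ x ⟧ᵃ
  embedʰ-sound : ∀ h → ⟦ embedʰ h ⟧ ≡ ⟦ h ⟧ʰ
  prepend-sound : ∀ {x p} u → ⟦ x ⟧ ≡ p → ⟦ foldr _▹_ x u ⟧ ≡ foldr _◃_ p u
  embedᵃ-sound (var i)           = refl
  embedᵃ-sound (app o x)         = cong (apply o) (embedᵃ-sound x)
  embedᵃ-sound (shuffle u h v k) = cong₂ _ш_ (prepend-sound u (embedʰ-sound h)) (prepend-sound v (embedʰ-sound k))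
  embedᵃ-sound (stuffle u h v k) = cong₂ _*_ (prepend-sound u (embedʰ-sound h)) (prepend-sound v (embedʰ-sound k))
  embedʰ-sound nothing  = refl
  embedʰ-sound (just x) = embedᵃ-sound x
  prepend-sound []      e = e
  prepend-sound (a ∷ u) e = cong (a ◃_) (prepend-sound u e)

  embed-sound : ∀ p → ⟦ embed p ⟧ ≋ ⟦ p ⟧ᵖ
  embed-sound []                = ≋-refl
  embed-sound ((c , u , h) ∷ p) =
    +-cong (·-cong c (≋-reflexive (prepend-sound u (embedʰ-sound h)))) (embed-sound p)

  compile-sound : ∀ {es} → All Holds es → All Sound (compile es)
  compile-sound []                       = []
  compile-sound {(l , r) ∷ es} (e ∷ hs) with normalise [] [] l | normalise-sound [] [] l
  ... | []                                  | _ = compile-sound hs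
  ... | (ℤ.+ 0 , _) ∷ _                     | _ = compile-sound hs
  ... | (ℤ.+ suc (suc _) , _) ∷ _           | _ = compile-sound hs
  ... | (ℤ.-[1+ _ ] , _) ∷ _                | _ = compile-sound hs
  ... | (ℤ.+ 1 , _ ∷ _ , _) ∷ _             | _ = compile-sound hs
  ... | (ℤ.+ 1 , [] , nothing) ∷ _          | _ = compile-sound hs
  ... | (ℤ.+ 1 , [] , just x) ∷ _ ∷ _       | _ = compile-sound hs
  ... | (ℤ.+ 1 , [] , just x) ∷ []          | n =
    ≋-trans (normalise-sound [] [] r) (≋-trans (≋-sym e) (≋-trans (≋-sym n) (term-sound [] (just x)))) ∷ compile-sound hs

  solve : ∀ {es B} → All Holds es → All Valid B → ∀ l r → check es B l r ≡ true → ⟦ l ⟧ ≋ ⟦ r ⟧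
  solve {es} {B} hs V l r e = p-q≋0⇒p≋q (begin
    ⟦ l ⟧ - ⟦ r ⟧                           ≈⟨ normalise-sound (compile-sound hs) [] (l ⊖ r) ⟨
    ⟦ p ⟧ᵖ                                  ≈⟨ collect-sound p ⟨
    ⟦ collect p ⟧ᵖ                          ≈⟨ embed-sound (collect p) ⟨
    ⟦ embed (collect p) ⟧                   ≈⟨ normalise-sound [] V (embed (collect p)) ⟨
    ⟦ q ⟧ᵖ                                  ≈⟨ collect-sound q ⟨
    ⟦ collect q ⟧ᵖ                          ≈⟨ isZero-sound (collect q) e ⟩
    0#                                      ∎)
    where
    open ≋-Reasoning
    p = normalise (compile es) [] (l ⊖ r)
    q = normalise [] B (embed (collect p))

-- Identities for all choices of letters

-- `check` evaluates only at concrete letters. Evaluating it at all elements of a finite domain lets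
-- `refl` prove an identity for every choice of letters at once; `members` keeps the membership
-- proofs, so that letters can be restricted to a subset.
record Finite (A : Set) : Set where
  field
    all   : (A → Bool) → Bool
    sound : ∀ φ → all φ ≡ true → ∀ x → φ x ≡ true
open Finite

members : ∀ {A : Set} (xs : List A) → Finite (∃[ x ] x ∈ xs)
members [] .all φ = true
members [] .sound φ e (x , ())
members (x ∷ xs) .all φ = φ (x , here refl) ∧ members xs .all (λ (y , y∈xs) → φ (y , there y∈xs))
members (x ∷ xs) .sound φ e (y , here refl) with true ← φ (x , here refl) = refl
members (x ∷ xs) .sound φ e (y , there y∈xs) with true ← φ (x , here refl) =
  members xs .sound (λ (y , y∈xs) → φ (y , there y∈xs)) e (y , y∈xs)

enumerated : ∀ {A : Set} (xs : List A) → (∀ x → x ∈ xs) → Finite A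
enumerated xs complete .all φ = members xs .all (λ (x , _) → φ x)
enumerated xs complete .sound φ e x = members xs .sound (λ (x , _) → φ x) e (x , complete x)

infixr 2 _×ᶠ_
_×ᶠ_ : ∀ {A B : Set} → Finite A → Finite B → Finite (A × B)
(A ×ᶠ B) .all φ = A .all (λ x → B .all (λ y → φ (x , y)))
(A ×ᶠ B) .sound φ e (x , y) = B .sound (λ y → φ (x , y)) (A .sound (λ x → B .all (λ y → φ (x , y))) e x) y

letters : Finite Letter
letters = enumerated (e0 ∷ e1 ∷ ez ∷ []) λ where
  e0 → here refl
  e1 → there (here refl)
  ez → there (there (here refl))

kinds : Finite Kind
kinds = enumerated
  (final ∷ inner e0 ∷ inner e1 ∷ inner ez ∷ bounded e0 ∷ bounded e1 ∷ bounded ez ∷ []) λ where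
  final        → here refl
  (inner e0)   → there (here refl)
  (inner e1)   → there (there (here refl))
  (inner ez)   → there (there (there (here refl)))
  (bounded e0) → there (there (there (there (here refl))))
  (bounded e1) → there (there (there (there (there (here refl)))))
  (bounded ez) → there (there (there (there (there (there (here refl))))))

infix 3 _≐_
_≐_ : Expr → Expr → Expr × Expr
l ≐ r = l , r

record Problem : Set where
  constructor problem
  field
    bindings   : Bindings
    hypotheses : List (Expr × Expr)
    goal       : Expr × Expr
open Problem

environment : List 𝒜z → ℕ → 𝒜z
environment []       _       = 0#
environment (p ∷ ps) zero    = p
environment (p ∷ ps) (suc i) = environment ps i

module _ (ρ : List 𝒜z) where
  open Semantics (environment ρ) public using (Holds; Valid)

prove : ∀ {A} (D : Finite A) (P : A → Problem) →
  D .all (λ x → check (P x .hypotheses) (P x .bindings) (proj₁ (P x .goal)) (proj₂ (P x .goal))) ≡ true →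
  ∀ x ρ → All (Valid ρ) (P x .bindings) → All (Holds ρ) (P x .hypotheses) → Holds ρ (P x .goal)
prove D P e x ρ V H = Semantics.solve (environment ρ) H V (proj₁ (P x .goal)) (proj₂ (P x .goal))
  (D .sound (λ x → check (P x .hypotheses) (P x .bindings) (proj₁ (P x .goal)) (proj₂ (P x .goal))) e x)

-- Shuffle product: derivations, associativity and substitutions

private
  G-шˡ-goal G-шʳ-goal : Kind → Letter → Letter → Expr → Expr → Problem
  G-шˡ-goal κ a b u v = problem [] [] (g κ a $ᵉ (u ⟨ш⟩ b ▹ v) ≐
    (g κ a $ᵉ u) ⟨ш⟩ b ▹ v ⊖ b ▹ ((g κ a $ᵉ u) ⟨ш⟩ v) ⊕ weight κ a b ⊙ (b ▹ (u ⟨ш⟩ v) ⊖ a ▹ (u ⟨ш⟩ v)))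
  G-шʳ-goal κ a b u v = problem [] [] (g κ b $ᵉ (a ▹ u ⟨ш⟩ v) ≐
    a ▹ u ⟨ш⟩ (g κ b $ᵉ v) ⊖ a ▹ (u ⟨ш⟩ (g κ b $ᵉ v)) ⊕ weight κ a b ⊙ (a ▹ (u ⟨ш⟩ v) ⊖ b ▹ (u ⟨ш⟩ v)))

-- `G κ a` compares `a` with the first letter of each word of u ш e_b v. If that letter comes from
-- `u`, the contribution is found in `G κ a` of `u` shuffled with e_b v, after removing the words
-- whose first letter comes from e_b v. If it is b, the contribution is the last summand.
G-шˡ : ∀ κ a b u v → G κ a (word u ш word (b ∷ v)) ≋
  G κ a (word u) ш word (b ∷ v) - (b ◃ G κ a (word u) ш word v)
    + weight κ a b · ((b ◃ word u ш word v) - (a ◃ word u ш word v))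
G-шˡ κ a b []      v = prove (kinds ×ᶠ letters ×ᶠ letters)
  (λ (κ , a , b) → G-шˡ-goal κ a b 𝟙 (var 0)) refl (κ , a , b) (word v ∷ []) [] []
G-шˡ κ a b (c ∷ u) v = prove (kinds ×ᶠ letters ×ᶠ letters ×ᶠ letters)
  (λ (κ , a , b , c) → G-шˡ-goal κ a b (c ▹ var 1) (var 0)) refl (κ , a , b , c) (word v ∷ word u ∷ []) [] []

G-шʳ : ∀ κ a b u v → G κ b (word (a ∷ u) ш word v) ≋
  word (a ∷ u) ш G κ b (word v) - (a ◃ word u ш G κ b (word v))
    + weight κ a b · ((a ◃ word u ш word v) - (b ◃ word u ш word v))
G-шʳ κ a b u []      = prove (kinds ×ᶠ letters ×ᶠ letters)
  (λ (κ , a , b) → G-шʳ-goal κ a b (var 0) 𝟙) refl (κ , a , b) (word u ∷ []) [] []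
G-шʳ κ a b u (c ∷ v) = prove (kinds ×ᶠ letters ×ᶠ letters ×ᶠ letters)
  (λ (κ , a , b , c) → G-шʳ-goal κ a b (var 0) (c ▹ var 1)) refl (κ , a , b , c) (word u ∷ word v ∷ []) [] []

-- Splitting off the first letters leaves, besides the induction hypotheses, the pairs formed by the
-- first letters of the two factors. The order ab in `G-шˡ` and the order ba in `G-шʳ` contribute
-- opposite amounts, because `weight` is symmetric.
F-ш-word : ∀ κ u v → F κ (word u ш word v) ≋ F κ (word u) ш word v + word u ш F κ (word v)
F-ш-word κ []      v       = prove kinds
  (λ κ → problem [] [] (f κ $ᵉ (𝟙 ⟨ш⟩ var 0) ≐ (f κ $ᵉ 𝟙) ⟨ш⟩ var 0 ⊕ 𝟙 ⟨ш⟩ (f κ $ᵉ var 0))) refl κ (word v ∷ []) [] []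
F-ш-word κ (a ∷ u) []      = prove kinds
  (λ κ → problem [] [] (f κ $ᵉ (var 0 ⟨ш⟩ 𝟙) ≐ (f κ $ᵉ var 0) ⟨ш⟩ 𝟙 ⊕ var 0 ⟨ш⟩ (f κ $ᵉ 𝟙))) refl κ (word (a ∷ u) ∷ []) [] []
F-ш-word κ (a ∷ u) (b ∷ v) = prove (kinds ×ᶠ letters ×ᶠ letters)
  (λ (κ , a , b) → let u = var 0; v = var 1 in problem []
    ( (f (core κ) $ᵉ (u ⟨ш⟩ b ▹ v) ≐ (f (core κ) $ᵉ u) ⟨ш⟩ b ▹ v ⊕ u ⟨ш⟩ (f (core κ) $ᵉ b ▹ v))
    ∷ (f (core κ) $ᵉ (a ▹ u ⟨ш⟩ v) ≐ (f (core κ) $ᵉ a ▹ u) ⟨ш⟩ v ⊕ a ▹ u ⟨ш⟩ (f (core κ) $ᵉ v))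
    ∷ G-шˡ-goal (core κ) a b u v .goal ∷ G-шʳ-goal (core κ) a b u v .goal ∷ [])
    (f κ $ᵉ (a ▹ u ⟨ш⟩ b ▹ v) ≐ (f κ $ᵉ a ▹ u) ⟨ш⟩ b ▹ v ⊕ a ▹ u ⟨ш⟩ (f κ $ᵉ b ▹ v)))
  refl (κ , a , b) (word u ∷ word v ∷ []) []
  (F-ш-word (core κ) u (b ∷ v) ∷ F-ш-word (core κ) (a ∷ u) v ∷ G-шˡ (core κ) a b u v ∷ G-шʳ (core κ) a b u v ∷ [])

F-ш : ∀ κ p q → F κ (p ш q) ≋ F κ p ш q + p ш F κ q
F-ш κ = bilinear-ext (compose (F-isLinear κ) ш-isBilinear id-isLinear id-isLinear)
  (compose id-isLinear ш-isBilinear (F-isLinear κ) id-isLinear ⟨+⟩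
   compose id-isLinear ш-isBilinear id-isLinear (F-isLinear κ))
  (F-ш-word κ)

ш-assoc-word : ∀ u v w → word u ш word v ш word w ≋ word u ш (word v ш word w)
ш-assoc-word []      v       w       = ≋-trans (cong≋ (linearˡ ш-isBilinear (word w)) (ш-identityˡ (word v)))
  (≋-sym (ш-identityˡ (word v ш word w)))
ш-assoc-word (a ∷ u) []      w       = ≋-trans (cong≋ (linearˡ ш-isBilinear (word w)) (ш-identityʳ (word (a ∷ u))))
  (cong≋ (linearʳ ш-isBilinear (word (a ∷ u))) (≋-sym (ш-identityˡ (word w))))
ш-assoc-word (a ∷ u) (b ∷ v) []      = ≋-trans (ш-identityʳ (word (a ∷ u) ш word (b ∷ v)))
  (cong≋ (linearʳ ш-isBilinear (word (a ∷ u))) (≋-sym (ш-identityʳ (word (b ∷ v)))))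
ш-assoc-word (a ∷ u) (b ∷ v) (c ∷ w) = begin
  word (a ∷ u) ш word (b ∷ v) ш word (c ∷ w)    ≈⟨ prove (letters ×ᶠ letters ×ᶠ letters)
    (λ (a , b , c) → problem [] [] ((a ▹ x ⟨ш⟩ b ▹ y) ⟨ш⟩ c ▹ z ≐
      a ▹ ((x ⟨ш⟩ b ▹ y) ⟨ш⟩ c ▹ z) ⊕ b ▹ ((a ▹ x ⟨ш⟩ y) ⟨ш⟩ c ▹ z) ⊕ c ▹ ((a ▹ x ⟨ш⟩ b ▹ y) ⟨ш⟩ z)))
    refl (a , b , c) (word u ∷ word v ∷ word w ∷ []) [] [] ⟩
  (a ◃ word u ш word (b ∷ v) ш word (c ∷ w)) + (b ◃ word (a ∷ u) ш word v ш word (c ∷ w))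
    + (c ◃ word (a ∷ u) ш word (b ∷ v) ш word w)  ≈⟨ +-cong (+-cong
      (cong≋ (◃-isLinear a) (ш-assoc-word u (b ∷ v) (c ∷ w)))
      (cong≋ (◃-isLinear b) (ш-assoc-word (a ∷ u) v (c ∷ w))))
      (cong≋ (◃-isLinear c) (ш-assoc-word (a ∷ u) (b ∷ v) w)) ⟩
  (a ◃ word u ш (word (b ∷ v) ш word (c ∷ w))) + (b ◃ word (a ∷ u) ш (word v ш word (c ∷ w)))
    + (c ◃ word (a ∷ u) ш (word (b ∷ v) ш word w))  ≈⟨ prove (letters ×ᶠ letters ×ᶠ letters)
    (λ (a , b , c) → problem [] [] (a ▹ (x ⟨ш⟩ (b ▹ y ⟨ш⟩ c ▹ z)) ⊕ b ▹ (a ▹ x ⟨ш⟩ (y ⟨ш⟩ c ▹ z))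
      ⊕ c ▹ (a ▹ x ⟨ш⟩ (b ▹ y ⟨ш⟩ z)) ≐ a ▹ x ⟨ш⟩ (b ▹ y ⟨ш⟩ c ▹ z)))
    refl (a , b , c) (word u ∷ word v ∷ word w ∷ []) [] [] ⟩
  word (a ∷ u) ш (word (b ∷ v) ш word (c ∷ w))  ∎
  where
  open ≋-Reasoning
  x y z : Expr
  x = var 0
  y = var 1
  z = var 2

ш-assoc : ∀ p q r → p ш q ш r ≋ p ш (q ш r)
ш-assoc p q r = linear-ext
  (∘-isLinear (linearˡ ш-isBilinear r) (linearˡ ш-isBilinear q)) (linearˡ ш-isBilinear (q ш r))
  (λ u → linear-ext
    (∘-isLinear (linearˡ ш-isBilinear r) (linearʳ ш-isBilinear (word u)))
    (∘-isLinear (linearʳ ш-isBilinear (word u)) (linearˡ ш-isBilinear r))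
    (λ v → linear-ext
      (linearʳ ш-isBilinear (word u ш word v))
      (∘-isLinear (linearʳ ш-isBilinear (word u)) (linearʳ ш-isBilinear (word v)))
      (ш-assoc-word u v) r)
    q)
  p

substitutions : Finite Substitution
substitutions = enumerated (constant ∷ z-to-1 ∷ 1-to-z ∷ []) λ where
  constant → here refl
  z-to-1   → there (here refl)
  1-to-z   → there (there (here refl))

substitute-ш-word : ∀ σ u v → substitute σ (word u ш word v) ≋ substitute σ (word u) ш substitute σ (word v)
substitute-ш-word σ []      v       = prove substitutions
  (λ σ → problem [] [] (s σ $ᵉ (𝟙 ⟨ш⟩ var 0) ≐ (s σ $ᵉ 𝟙) ⟨ш⟩ (s σ $ᵉ var 0))) refl σ (word v ∷ []) [] []
substitute-ш-word σ (a ∷ u) []      = prove substitutions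
  (λ σ → problem [] [] (s σ $ᵉ (var 0 ⟨ш⟩ 𝟙) ≐ (s σ $ᵉ var 0) ⟨ш⟩ (s σ $ᵉ 𝟙))) refl σ (word (a ∷ u) ∷ []) [] []
substitute-ш-word σ (a ∷ u) (b ∷ v) = prove (substitutions ×ᶠ letters ×ᶠ letters)
  (λ (σ , a , b) → let u = var 0; v = var 1 in problem []
    ( (s σ $ᵉ (u ⟨ш⟩ b ▹ v) ≐ (s σ $ᵉ u) ⟨ш⟩ (s σ $ᵉ b ▹ v))
    ∷ (s σ $ᵉ (a ▹ u ⟨ш⟩ v) ≐ (s σ $ᵉ a ▹ u) ⟨ш⟩ (s σ $ᵉ v)) ∷ [])
    (s σ $ᵉ (a ▹ u ⟨ш⟩ b ▹ v) ≐ (s σ $ᵉ a ▹ u) ⟨ш⟩ (s σ $ᵉ b ▹ v)))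
  refl (σ , a , b) (word u ∷ word v ∷ []) [] (substitute-ш-word σ u (b ∷ v) ∷ substitute-ш-word σ (a ∷ u) v ∷ [])

substitute-ш : ∀ σ p q → substitute σ (p ш q) ≋ substitute σ p ш substitute σ q
substitute-ш σ = bilinear-ext (compose (substitute-isLinear σ) ш-isBilinear id-isLinear id-isLinear)
  (compose id-isLinear ш-isBilinear (substitute-isLinear σ) (substitute-isLinear σ))
  (substitute-ш-word σ)

-- Stripping a final e₁ commutes with ∂ and Const

private
  commutation : Kind → Expr → Expr × Expr
  commutation κ x = f final $ᵉ f κ $ᵉ x ≐ f κ $ᵉ f final $ᵉ x

-- Stripping a final e₁ moves the end of the word but not the letter read after it, because a_{n+1}
-- = 1 as well.
final-F-word : ∀ κ w → F final (F κ (word w)) ≋ F κ (F final (word w))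
final-F-word κ []              = prove kinds
  (λ κ → problem [] [] (commutation κ 𝟙)) refl κ [] [] []
final-F-word κ (a ∷ [])        = prove (kinds ×ᶠ letters)
  (λ (κ , a) → problem [] [] (commutation κ (a ▹ 𝟙))) refl (κ , a) [] [] []
final-F-word κ (a ∷ b ∷ [])    = prove (kinds ×ᶠ letters ×ᶠ letters)
  (λ (κ , a , b) → problem [] [] (commutation κ (a ▹ b ▹ 𝟙))) refl (κ , a , b) [] [] []
-- Three letters, so that stripping the last one cannot touch the pair ab that `G` reads.
final-F-word κ (a ∷ b ∷ c ∷ w) = prove (kinds ×ᶠ letters ×ᶠ letters ×ᶠ letters)
  (λ (κ , a , b , c) → problem ((0 , b ∷ c ∷ [] , just (var 1)) ∷ []) (commutation (core κ) (var 0) ∷ [])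
    (commutation κ (a ▹ var 0)))
  refl (κ , a , b , c) (word (b ∷ c ∷ w) ∷ word w ∷ []) (≋-refl ∷ []) (final-F-word (core κ) (b ∷ c ∷ w) ∷ [])

final-F : ∀ κ p → F final (F κ p) ≋ F κ (F final p)
final-F κ = linear-ext (∘-isLinear (F-isLinear final) (F-isLinear κ)) (∘-isLinear (F-isLinear κ) (F-isLinear final))
  (final-F-word κ)

-- `Const` only looks for letters e_z, and `D` never removes one.
final-Const-word : ∀ w → F final (Const (word w)) ≋ Const (F final (word w))
final-Const-word []          = ≋-refl
final-Const-word (a ∷ [])    = prove letters
  (λ a → problem [] [] (f final $ᵉ s constant $ᵉ a ▹ 𝟙 ≐ s constant $ᵉ f final $ᵉ a ▹ 𝟙)) refl a [] [] []
final-Const-word (a ∷ b ∷ w) = prove (letters ×ᶠ letters)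
  (λ (a , b) → problem ((0 , b ∷ [] , just (var 1)) ∷ []) ((f final $ᵉ s constant $ᵉ var 0 ≐ s constant $ᵉ f final $ᵉ var 0) ∷ [])
    (f final $ᵉ s constant $ᵉ a ▹ var 0 ≐ s constant $ᵉ f final $ᵉ a ▹ var 0))
  refl (a , b) (word (b ∷ w) ∷ word w ∷ []) (≋-refl ∷ []) (final-Const-word (b ∷ w) ∷ [])

final-Const : ∀ p → F final (Const p) ≋ Const (F final p)
final-Const = linear-ext (∘-isLinear (F-isLinear final) (substitute-isLinear constant))
  (∘-isLinear (substitute-isLinear constant) (F-isLinear final)) final-Const-word

-- Stuffle product and ∂

0z-letters : List Letter
0z-letters = e0 ∷ ez ∷ []

01ᶠ : Finite (∃[ a ] a ∈ 01-letters)
01ᶠ = members 01-letters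

0zᶠ : Finite (∃[ a ] a ∈ 0z-letters)
0zᶠ = members 0z-letters

F-01-word : ∀ {α u} → α ∈ 01-letters → Over 01-letters u → F (inner α) (word u) ≋ 0#
F-01-word {α}             α∈ []             = F-1 (inner α)
F-01-word {α} {a ∷ []}    α∈ (a∈ ∷ [])      = prove (01ᶠ ×ᶠ 01ᶠ)
  (λ ((α , _) , (a , _)) → problem [] [] (f (inner α) $ᵉ a ▹ 𝟙 ≐ 𝟘)) refl ((α , α∈) , (a , a∈)) [] [] []
F-01-word {α} {a ∷ b ∷ u} α∈ (a∈ ∷ b∈ ∷ u∈) = prove (01ᶠ ×ᶠ 01ᶠ ×ᶠ 01ᶠ)
  (λ ((α , _) , (a , _) , (b , _)) → problem ((0 , b ∷ [] , just (var 1)) ∷ []) ((f (inner α) $ᵉ var 0 ≐ 𝟘) ∷ [])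
    (f (inner α) $ᵉ a ▹ var 0 ≐ 𝟘))
  refl ((α , α∈) , (a , a∈) , (b , b∈)) (word (b ∷ u) ∷ word u ∷ []) (≋-refl ∷ []) (F-01-word α∈ (b∈ ∷ u∈) ∷ [])

∂-01-word : ∀ {α u} → α ∈ 01-letters → Over 01-letters u → ∂ ez α (word u) ≋ 0#
∂-01-word {α}         α∈ []        = F-1 (bounded α)
∂-01-word {α} {a ∷ u} α∈ (a∈ ∷ u∈) = ≋-trans (prove (01ᶠ ×ᶠ 01ᶠ)
  (λ ((α , _) , (a , _)) → problem [] [] (f (bounded α) $ᵉ a ▹ var 0 ≐ f (inner α) $ᵉ a ▹ var 0))
  refl ((α , α∈) , (a , a∈)) (word u ∷ []) [] []) (F-01-word α∈ (a∈ ∷ u∈))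

defect : Letter → Letter → ℤ
defect e0 ez = 1ℤ
defect _  _  = 0ℤ

-- In ∂_{z,0}(u * v) this term is cancelled by the boundary letter a₀ = 0.
correction : Letter → Word → Word → 𝒜z
correction α []      v       = 0#
correction α (a ∷ u) []      = 0#
correction α (a ∷ u) (b ∷ v) = defect α b · (word u * word (ez ∷ v) - (e0 ◃ word u * word v))

private
  inner-*-goal : Letter → Letter → Letter → Expr → Expr → Expr × Expr
  inner-*-goal α a b u v = f (inner α) $ᵉ (a ▹ u ⟨*⟩ b ▹ v) ≐
    a ▹ u ⟨*⟩ (f (inner α) $ᵉ b ▹ v) ⊕ defect α b ⊙ (u ⟨*⟩ ez ▹ v ⊖ e0 ▹ (u ⟨*⟩ v))

-- Each of the three summands in the recursion of `*ʷ` has an induction hypothesis with its own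
-- `correction`. These, and `G`, read the first letters of the tails of both factors, hence the
-- separate cases for empty tails and the explicit letters `a′` and `b′`.
inner-*-word : ∀ {α u v} → α ∈ 01-letters → Over 01-letters u → Over 0z-letters v →
  F (inner α) (word u * word v) ≋ word u * F (inner α) (word v) + correction α u v
inner-*-word {α} {[]} {v} α∈ [] v∈ = begin
  F (inner α) (1# * word v)        ≈⟨ cong≋ (F-isLinear (inner α)) (*-identityˡ (word v)) ⟩
  F (inner α) (word v)             ≈⟨ *-identityˡ (F (inner α) (word v)) ⟨
  1# * F (inner α) (word v)        ≈⟨ +-identityʳ (1# * F (inner α) (word v)) ⟨
  1# * F (inner α) (word v) + 0#   ∎
  where open ≋-Reasoning
inner-*-word {α} {a ∷ u} {[]} α∈ u∈ [] = begin
  F (inner α) (word (a ∷ u) * 1#)       ≈⟨ cong≋ (F-isLinear (inner α)) (*-identityʳ (word (a ∷ u))) ⟩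
  F (inner α) (word (a ∷ u))            ≈⟨ F-01-word α∈ u∈ ⟩
  0#                                    ≈⟨ 0-homo (linearʳ *-isBilinear (word (a ∷ u))) ⟨
  word (a ∷ u) * 0#                     ≈⟨ +-identityʳ (word (a ∷ u) * 0#) ⟨
  word (a ∷ u) * 0# + 0#                ∎
  where open ≋-Reasoning
inner-*-word {α} {a ∷ []} {b ∷ []} α∈ (a∈ ∷ []) (b∈ ∷ []) = prove (01ᶠ ×ᶠ 01ᶠ ×ᶠ 0zᶠ)
  (λ ((α , _) , (a , _) , (b , _)) → problem [] [] (inner-*-goal α a b 𝟙 𝟙))
  refl ((α , α∈) , (a , a∈) , (b , b∈)) [] [] []
inner-*-word {α} {a ∷ []} {b ∷ b′ ∷ v} α∈ (a∈ ∷ []) (b∈ ∷ b′∈ ∷ v∈) = prove (01ᶠ ×ᶠ 01ᶠ ×ᶠ 0zᶠ ×ᶠ 0zᶠ)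
  (λ ((α , _) , (a , _) , (b , _) , (b′ , _)) → let v = var 0; v′ = var 1 in
    problem ((0 , b′ ∷ [] , just (var 1)) ∷ [])
      ((f (inner α) $ᵉ (a ▹ 𝟙 ⟨*⟩ v) ≐ a ▹ 𝟙 ⟨*⟩ (f (inner α) $ᵉ v) ⊕ defect α b′ ⊙ (𝟙 ⟨*⟩ ez ▹ v′ ⊖ e0 ▹ (𝟙 ⟨*⟩ v′))) ∷ [])
      (inner-*-goal α a b 𝟙 v))
  refl ((α , α∈) , (a , a∈) , (b , b∈) , (b′ , b′∈)) (word (b′ ∷ v) ∷ word v ∷ []) (≋-refl ∷ [])
  (inner-*-word α∈ (a∈ ∷ []) (b′∈ ∷ v∈) ∷ [])
inner-*-word {α} {a ∷ a′ ∷ u} {b ∷ []} α∈ (a∈ ∷ a′∈ ∷ u∈) (b∈ ∷ []) = prove (01ᶠ ×ᶠ 01ᶠ ×ᶠ 0zᶠ ×ᶠ 01ᶠ)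
  (λ ((α , _) , (a , _) , (b , _) , (a′ , _)) → let u = var 0; u′ = var 1 in
    problem ((0 , a′ ∷ [] , just (var 1)) ∷ [])
      ((f (inner α) $ᵉ (u ⟨*⟩ b ▹ 𝟙) ≐ u ⟨*⟩ (f (inner α) $ᵉ b ▹ 𝟙) ⊕ defect α b ⊙ (u′ ⟨*⟩ ez ▹ 𝟙 ⊖ e0 ▹ (u′ ⟨*⟩ 𝟙)))
        -- With the second factor down to one letter, two of the summands are the words e_a u and
        -- e₀u in e₀, e₁; this hypothesis makes the operator vanish on them.
        ∷ (f (inner α) $ᵉ u ≐ 𝟘) ∷ [])
      (inner-*-goal α a b u 𝟙))
  refl ((α , α∈) , (a , a∈) , (b , b∈) , (a′ , a′∈)) (word (a′ ∷ u) ∷ word u ∷ []) (≋-refl ∷ [])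
  (inner-*-word α∈ (a′∈ ∷ u∈) (b∈ ∷ []) ∷ F-01-word α∈ (a′∈ ∷ u∈) ∷ [])
inner-*-word {α} {a ∷ a′ ∷ u} {b ∷ b′ ∷ v} α∈ (a∈ ∷ a′∈ ∷ u∈) (b∈ ∷ b′∈ ∷ v∈) = prove (01ᶠ ×ᶠ 01ᶠ ×ᶠ 0zᶠ ×ᶠ 01ᶠ ×ᶠ 0zᶠ)
  (λ ((α , _) , (a , _) , (b , _) , (a′ , _) , (b′ , _)) → let u = var 0; u′ = var 1; v = var 2; v′ = var 3 in
    problem ((0 , a′ ∷ [] , just (var 1)) ∷ (2 , b′ ∷ [] , just (var 3)) ∷ [])
      ( (f (inner α) $ᵉ (u ⟨*⟩ b ▹ v) ≐ u ⟨*⟩ (f (inner α) $ᵉ b ▹ v) ⊕ defect α b ⊙ (u′ ⟨*⟩ ez ▹ v ⊖ e0 ▹ (u′ ⟨*⟩ v)))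
      ∷ (f (inner α) $ᵉ (a ▹ u ⟨*⟩ v) ≐ a ▹ u ⟨*⟩ (f (inner α) $ᵉ v) ⊕ defect α b′ ⊙ (u ⟨*⟩ ez ▹ v′ ⊖ e0 ▹ (u ⟨*⟩ v′)))
      ∷ (f (inner α) $ᵉ (u ⟨*⟩ v) ≐ u ⟨*⟩ (f (inner α) $ᵉ v) ⊕ defect α b′ ⊙ (u′ ⟨*⟩ ez ▹ v′ ⊖ e0 ▹ (u′ ⟨*⟩ v′)))
      ∷ [])
      (inner-*-goal α a b u v))
  refl ((α , α∈) , (a , a∈) , (b , b∈) , (a′ , a′∈) , (b′ , b′∈))
  (word (a′ ∷ u) ∷ word u ∷ word (b′ ∷ v) ∷ word v ∷ []) (≋-refl ∷ ≋-refl ∷ [])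
  (inner-*-word α∈ (a′∈ ∷ u∈) (b∈ ∷ b′∈ ∷ v∈) ∷ inner-*-word α∈ (a∈ ∷ a′∈ ∷ u∈) (b′∈ ∷ v∈)
    ∷ inner-*-word α∈ (a′∈ ∷ u∈) (b′∈ ∷ v∈) ∷ [])

data Wordz : Pred Word 0ℓ where
  empty : Wordz []
  start : ∀ {w} → Over 0z-letters w → Wordz (ez ∷ w)

-- For α = 0 the boundary letter deletes the leading e_z on both sides: this subtracts `remainder`
-- on the left but only e₁u * v on the right, and the difference of the two is the `correction`.
-- That the left factor begins with e₁ ensures that the product begins with e_z.
∂-*-word : ∀ {α u v} → α ∈ 01-letters → Word¹ u → Wordz v →
  ∂ ez α (word u * word v) ≋ word u * ∂ ez α (word v)
∂-*-word {α} {v = v} α∈ empty v∈ = ≋-trans (cong≋ (F-isLinear (bounded α)) (*-identityˡ (word v)))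
  (≋-sym (*-identityˡ (∂ ez α (word v))))
∂-*-word {α} {u} α∈ (inner u∈) empty = begin
  ∂ ez α (word u * 1#)    ≈⟨ cong≋ (F-isLinear (bounded α)) (*-identityʳ (word u)) ⟩
  ∂ ez α (word u)         ≈⟨ ∂-01-word α∈ (there (here refl) ∷ u∈) ⟩
  0#                      ≈⟨ 0-homo (linearʳ *-isBilinear (word u)) ⟨
  word u * ∂ ez α 1#      ∎
  where open ≋-Reasoning
∂-*-word {α} {e1 ∷ u} {ez ∷ v} α∈ (inner u∈) (start v∈) = begin
  ∂ ez α (word (e1 ∷ u) * word (ez ∷ v))
    ≈⟨ prove 01ᶠ (λ (α , _) → problem [] [] (f (bounded α) $ᵉ (e1 ▹ x ⟨*⟩ ez ▹ y) ≐
         f (inner α) $ᵉ (e1 ▹ x ⟨*⟩ ez ▹ y) ⊖ weightˡ (bounded α) ez ⊙ rest))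
       refl (α , α∈) (word u ∷ word v ∷ []) [] [] ⟩
  F (inner α) (word (e1 ∷ u) * word (ez ∷ v)) - weightˡ (bounded α) ez · remainder
    ≈⟨ +-congˡ (- (weightˡ (bounded α) ez · remainder)) (inner-*-word α∈ (there (here refl) ∷ u∈) (there (here refl) ∷ v∈)) ⟩
  word (e1 ∷ u) * F (inner α) (word (ez ∷ v)) + correction α (e1 ∷ u) (ez ∷ v) - weightˡ (bounded α) ez · remainder
    ≈⟨ prove 01ᶠ (λ (α , _) → problem [] [] (
         e1 ▹ x ⟨*⟩ (f (inner α) $ᵉ ez ▹ y) ⊕ defect α ez ⊙ (x ⟨*⟩ ez ▹ y ⊖ e0 ▹ (x ⟨*⟩ y)) ⊖ weightˡ (bounded α) ez ⊙ rest
         ≐ e1 ▹ x ⟨*⟩ (f (bounded α) $ᵉ ez ▹ y)))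
       refl (α , α∈) (word u ∷ word v ∷ []) [] [] ⟩
  word (e1 ∷ u) * ∂ ez α (word (ez ∷ v)) ∎
  where
  open ≋-Reasoning
  x y rest : Expr
  x = var 0
  y = var 1
  rest = x ⟨*⟩ ez ▹ y ⊕ e1 ▹ x ⟨*⟩ y ⊖ e0 ▹ (x ⟨*⟩ y)
  remainder : 𝒜z
  remainder = word u * word (ez ∷ v) + word (e1 ∷ u) * word v - (e0 ◃ word u * word v)

All-◃ : ∀ {P Q : Pred Word 0ℓ} {a p} → (∀ {w} → P w → Q (a ∷ w)) →
  All (λ (_ , w) → P w) p → All (λ (_ , w) → Q w) (a ◃ p)
All-◃ h ps = All.map⁺ (All.map h ps)

Span-◃ : ∀ {P Q : Pred Word 0ℓ} a → (∀ {w} → P w → Q (a ∷ w)) → ∀ {p} → p ∈Span P → a ◃ p ∈Span Q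
Span-◃ {Q = Q} a h = span-induction (preimage (◃-isLinear a) (Span-submodule Q)) (λ Pw → word∈Span (h Pw))

Span-⊆ : ∀ {P Q : Pred Word 0ℓ} → (∀ {w} → P w → Q w) → ∀ {p} → p ∈Span P → p ∈Span Q
Span-⊆ {Q = Q} h = span-induction (Span-submodule Q) (λ Pw → word∈Span (h Pw))

0∈Span : ∀ {P : Pred Word 0ℓ} {p} → p ≋ 0# → p ∈Span P
0∈Span {P} e = resp≋ (Span-submodule P) (≋-sym e) (0∈ (Span-submodule P))

Fʷ-0z : ∀ {α w} → Over 0z-letters w → All (λ (_ , v) → Over 0z-letters v) (Fʷ (inner α) w)
Fʷ-0z []                  = []
Fʷ-0z (a∈ ∷ [])           = [] ∷ []
Fʷ-0z (a∈ ∷ w∈@(b∈ ∷ v∈)) = All.++⁺ (All-◃ (a∈ ∷_) (Fʷ-0z w∈)) (w∈ ∷ (a∈ ∷ v∈) ∷ [])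

-- Deleting the leading e_z in front of e₀ would leave a word that begins with e₀. For α = 0 this
-- happens twice with opposite signs, from the pair of e_z and e₀ and from the boundary letter a₀ =
-- 0; for α = 1 both weights are 0.
∂-Wordz-word : ∀ {α v} → α ∈ 01-letters → Wordz v → ∂ ez α (word v) ∈Span Wordz
∂-Wordz-word {α} α∈ empty              = 0∈Span (F-1 (bounded α))
∂-Wordz-word {α} α∈ (start [])         = resp≋ (Span-submodule Wordz)
  (≋-sym (prove 01ᶠ (λ (α , _) → problem [] [] (f (bounded α) $ᵉ ez ▹ 𝟙 ≐ boundary α ⊙ 𝟙)) refl (α , α∈) [] [] []))
  (·∈ (Span-submodule Wordz) (boundary α) (word∈Span empty))
  where
  -- ∂(e_z) is -1 for α = 0, because of a₀ = 0, and 1 for α = 1, because of a₂ = 1.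
  boundary : Letter → ℤ
  boundary e0 = -1ℤ
  boundary _  = 1ℤ
∂-Wordz-word {α} {ez ∷ b ∷ v} α∈ (start (b∈ ∷ v∈)) = resp≋ (Span-submodule Wordz)
  (≋-sym (prove (01ᶠ ×ᶠ 0zᶠ) (λ ((α , _) , (b , _)) → problem [] []
    (f (bounded α) $ᵉ ez ▹ b ▹ var 0 ≐ ez ▹ (f (inner α) $ᵉ b ▹ var 0) ⊕ boundary α ⊙ ez ▹ var 0))
    refl ((α , α∈) , (b , b∈)) (word v ∷ []) [] []))
  (+∈ (Span-submodule Wordz)
    (Span-◃ ez start interior)
    (·∈ (Span-submodule Wordz) (boundary α) (word∈Span (start v∈))))
  where
  interior : F (inner α) (word (b ∷ v)) ∈Span Over 0z-letters
  interior = resp≋ (Span-submodule (Over 0z-letters)) (≋-sym (linear-word (Fʷ (inner α)) (b ∷ v)))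
    (All⇒Span (Fʷ-0z {α} (b∈ ∷ v∈)))
  -- For α = 0 one copy of -e_z v survives: from deleting b if b = 0, and from deleting the leading
  -- e_z if b = z.
  boundary : Letter → ℤ
  boundary e0 = -1ℤ
  boundary _  = 0ℤ

∂-Wordz : ∀ {α} → α ∈ 01-letters → ∀ {p} → p ∈Span Wordz → ∂ ez α p ∈Span Wordz
∂-Wordz {α} α∈ = span-induction (preimage (F-isLinear (bounded α)) (Span-submodule Wordz)) (∂-Wordz-word α∈)

∂-* : ∀ {α u} → α ∈ 01-letters → Word¹ u → ∀ {p} → p ∈Span Wordz → ∂ ez α (word u * p) ≋ word u * ∂ ez α p
∂-* {α} {u} α∈ u∈ = span-induction
  (equalizer (∘-isLinear (F-isLinear (bounded α)) (linearʳ *-isBilinear (word u)))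
             (∘-isLinear (linearʳ *-isBilinear (word u)) (F-isLinear (bounded α))))
  (∂-*-word α∈ u∈)

∂-01 : ∀ {α} → α ∈ 01-letters → ∀ {p} → p ∈Span Over 01-letters → ∂ ez α p ≋ 0#
∂-01 {α} α∈ = span-induction (equalizer (F-isLinear (bounded α)) 0-isLinear) (∂-01-word α∈)

∂-ш-01ˡ : ∀ {α} → α ∈ 01-letters → ∀ {p} → p ∈Span Over 01-letters → ∀ q → ∂ ez α (p ш q) ≋ p ш ∂ ez α q
∂-ш-01ˡ {α} α∈ {p} p∈ q = ≋-trans (F-ш (bounded α) p q)
  (+-congˡ (p ш ∂ ez α q) (≋-trans (cong≋ (linearˡ ш-isBilinear q) (∂-01 α∈ p∈)) (0-homo (linearˡ ш-isBilinear q))))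

∂-ш-01ʳ : ∀ {α} → α ∈ 01-letters → ∀ {q} → q ∈Span Over 01-letters → ∀ p → ∂ ez α (p ш q) ≋ ∂ ez α p ш q
∂-ш-01ʳ {α} α∈ {q} q∈ p = ≋-trans (F-ш (bounded α) p q) (≋-trans
  (+-congʳ (∂ ez α p ш q) (≋-trans (cong≋ (linearʳ ш-isBilinear p) (∂-01 α∈ q∈)) (0-homo (linearʳ ш-isBilinear p))))
  (+-identityʳ (∂ ez α p ш q)))

-- Standard relations for the marked double shuffle element

∂* : List Letter → 𝒜z → 𝒜z
∂* αs p = foldr (∂ ez) p αs

∂*-isLinear : ∀ αs → IsLinear (∂* αs)
∂*-isLinear []       = id-isLinear
∂*-isLinear (α ∷ αs) = ∘-isLinear (F-isLinear (bounded α)) (∂*-isLinear αs)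

∂*-ш-01ˡ : ∀ {αs} → Over 01-letters αs → ∀ {p} → p ∈Span Over 01-letters → ∀ q → ∂* αs (p ш q) ≋ p ш ∂* αs q
∂*-ш-01ˡ []                     p∈ q = ≋-refl
∂*-ш-01ˡ {α ∷ αs} (α∈ ∷ αs∈)   p∈ q = ≋-trans (cong≋ (F-isLinear (bounded α)) (∂*-ш-01ˡ αs∈ p∈ q))
  (∂-ш-01ˡ α∈ p∈ (∂* αs q))

∂*-ш-01ʳ : ∀ {αs} → Over 01-letters αs → ∀ {q} → q ∈Span Over 01-letters → ∀ p → ∂* αs (p ш q) ≋ ∂* αs p ш q
∂*-ш-01ʳ []                     q∈ p = ≋-refl
∂*-ш-01ʳ {α ∷ αs} (α∈ ∷ αs∈)   q∈ p = ≋-trans (cong≋ (F-isLinear (bounded α)) (∂*-ш-01ʳ αs∈ q∈ p))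
  (∂-ш-01ʳ α∈ q∈ (∂* αs p))

∂*-Wordz : ∀ {αs} → Over 01-letters αs → ∀ {p} → p ∈Span Wordz → ∂* αs p ∈Span Wordz
∂*-Wordz []         p∈ = p∈
∂*-Wordz (α∈ ∷ αs∈) p∈ = ∂-Wordz α∈ (∂*-Wordz αs∈ p∈)

∂*-* : ∀ {αs u} → Over 01-letters αs → Word¹ u → ∀ {p} → p ∈Span Wordz → ∂* αs (word u * p) ≋ word u * ∂* αs p
∂*-* []                   u∈ p∈ = ≋-refl
∂*-* {α ∷ αs} (α∈ ∷ αs∈) u∈ p∈ = ≋-trans (cong≋ (F-isLinear (bounded α)) (∂*-* αs∈ u∈ p∈))
  (∂-* α∈ u∈ (∂*-Wordz αs∈ p∈))

unitᶠ : Finite ⊤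
unitᶠ = enumerated (tt ∷ []) (λ _ → here refl)

-- If both words are nonempty, every word of either product contains e_z: in the shuffle it comes
-- from the right factor, in the stuffle it is the leading label 1 · z. If one of them is empty, the
-- two products coincide.
Const-ш≋* : ∀ {u} → Word¹ u → ∀ {p} → p ∈Span Wordz → Const (word u ш p) ≋ Const (word u * p)
Const-ш≋* {u} u∈ = span-induction
  (equalizer (∘-isLinear (substitute-isLinear constant) (linearʳ ш-isBilinear (word u)))
             (∘-isLinear (substitute-isLinear constant) (linearʳ *-isBilinear (word u))))
  (on-words u∈)
  where
  on-words : ∀ {u v} → Word¹ u → Wordz v → Const (word u ш word v) ≋ Const (word u * word v)
  on-words {u} {v} empty v∈ = cong≋ (substitute-isLinear constant) (≋-trans (ш-identityˡ (word v)) (≋-sym (*-identityˡ (word v))))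
  on-words {u} u∈ empty = cong≋ (substitute-isLinear constant) (≋-trans (ш-identityʳ (word u)) (≋-sym (*-identityʳ (word u))))
  on-words {e1 ∷ u} {ez ∷ v} (inner u∈) (start v∈) = ≋-trans (substitute-ш constant (word (e1 ∷ u)) (word (ez ∷ v)))
    (prove unitᶠ (λ _ → problem [] [] ((s constant $ᵉ e1 ▹ var 0) ⟨ш⟩ (s constant $ᵉ ez ▹ var 1) ≐
      s constant $ᵉ (e1 ▹ var 0 ⟨*⟩ ez ▹ var 1))) refl tt (word u ∷ word v ∷ []) [] [])

ζ-Word⁰ : ∀ {v} → Word⁰ v → Wordz (map 1↦z v)
ζ-Word⁰ empty              = empty
ζ-Word⁰ (inner {w} w∈) = start (All.map⁺ (All.map 0z (All.∷ʳ⁺ w∈ (here refl))))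
  where
  0z : ∀ {a} → a ∈ 01-letters → 1↦z a ∈ 0z-letters
  0z (here refl)         = here refl
  0z (there (here refl)) = there (here refl)

Word⁰⇒01 : ∀ {w} → Word⁰ w → Over 01-letters w
Word⁰⇒01 empty      = []
Word⁰⇒01 (inner w∈) = there (here refl) ∷ All.∷ʳ⁺ w∈ (here refl)

Word¹⇒01 : ∀ {w} → Word¹ w → Over 01-letters w
Word¹⇒01 empty      = []
Word¹⇒01 (inner w∈) = there (here refl) ∷ w∈

doubleShuffle : 𝒜z → 𝒜z → 𝒜z
doubleShuffle p q = p ш ζ q - p * ζ q

doubleShuffle-isBilinear : IsBilinear doubleShuffle
doubleShuffle-isBilinear = compose id-isLinear ш-isBilinear id-isLinear (substitute-isLinear 1-to-z)
  ⟨-⟩ compose id-isLinear *-isBilinear id-isLinear (substitute-isLinear 1-to-z)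

bilinear-span-induction : ∀ {P Q R B} → IsBilinear B → Submodule R →
  (∀ {u v} → P u → Q v → R (B (word u) (word v))) → ∀ {p q} → p ∈Span P → q ∈Span Q → R (B p q)
bilinear-span-induction {B = B} b S h {q = q} p∈ q∈ = span-induction (preimage (linearˡ b q) S)
  (λ {u} Pu → span-induction (preimage (linearʳ b (word u)) S) (h Pu) q∈) p∈

doubleShuffle-standard : ∀ {αs} → Over 01-letters αs → ∀ {p q} → p ∈Span Word¹ → q ∈Span Word⁰ →
  Const (∂* αs (doubleShuffle p q)) ≋ 0#
doubleShuffle-standard {αs} αs∈ = bilinear-span-induction doubleShuffle-isBilinear
  (equalizer (∘-isLinear (substitute-isLinear constant) (∂*-isLinear αs)) 0-isLinear) on-words
  where
  open ≋-Reasoning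
  on-words : ∀ {u v} → Word¹ u → Word⁰ v → Const (∂* αs (doubleShuffle (word u) (word v))) ≋ 0#
  on-words {u} {v} u∈ v∈ = begin
    Const (∂* αs (word u ш V - word u * V))                ≈⟨ cong≋ (substitute-isLinear constant) (-‿homo (∂*-isLinear αs) (word u ш V) (word u * V)) ⟩
    Const (∂* αs (word u ш V) - ∂* αs (word u * V))        ≈⟨ -‿homo (substitute-isLinear constant) (∂* αs (word u ш V)) (∂* αs (word u * V)) ⟩
    Const (∂* αs (word u ш V)) - Const (∂* αs (word u * V)) ≈⟨ -cong
      (cong≋ (substitute-isLinear constant) (∂*-ш-01ˡ αs∈ (word∈Span (Word¹⇒01 u∈)) V))
      (cong≋ (substitute-isLinear constant) (∂*-* αs∈ u∈ V∈)) ⟩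
    Const (word u ш ∂* αs V) - Const (word u * ∂* αs V)    ≈⟨ -cong (Const-ш≋* u∈ (∂*-Wordz αs∈ V∈)) (≋-refl {Const (word u * ∂* αs V)}) ⟩
    Const (word u * ∂* αs V) - Const (word u * ∂* αs V)    ≈⟨ -‿inverse (Const (word u * ∂* αs V)) ⟩
    0#                                                     ∎
    where
    V : 𝒜z
    V = word (map 1↦z v)
    V∈ : V ∈Span Wordz
    V∈ = word∈Span (ζ-Word⁰ v∈)

-- Unmarking the double shuffle element

z-to-1-01 : ∀ {w} → Over 01-letters w → map z↦1 w ≡ w
z-to-1-01 []                            = refl
z-to-1-01 (here refl ∷ w∈)         = cong (e0 ∷_) (z-to-1-01 w∈)
z-to-1-01 (there (here refl) ∷ w∈) = cong (e1 ∷_) (z-to-1-01 w∈)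

z-to-1-to-z : ∀ {w} → Over 01-letters w → map z↦1 (map 1↦z w) ≡ w
z-to-1-to-z []                            = refl
z-to-1-to-z (here refl ∷ w∈)         = cong (e0 ∷_) (z-to-1-to-z w∈)
z-to-1-to-z (there (here refl) ∷ w∈) = cong (e1 ∷_) (z-to-1-to-z w∈)

λ′-01-word : ∀ {w} → Over 01-letters w → λ′ (word w) ≋ word w
λ′-01-word w∈ = ≋-reflexive (cong word (z-to-1-01 w∈))

λ′-ζ-word : ∀ {w} → Over 01-letters w → λ′ (ζ (word w)) ≋ word w
λ′-ζ-word w∈ = ≋-reflexive (cong word (z-to-1-to-z w∈))

-- `z↦1` undoes `1↦z` also on product labels: for `a` in {0, 1} it sends `a ·ˡ 1↦z b` to `a ·ˡ b`.
λ′-*-word : ∀ {u v} → Over 01-letters u → Over 01-letters v → λ′ (word u * ζ (word v)) ≋ word u * word v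
λ′-*-word {[]} {v} [] v∈ = ≋-trans (cong≋ (substitute-isLinear z-to-1) (*-identityˡ (ζ (word v))))
  (≋-trans (λ′-ζ-word v∈) (≋-sym (*-identityˡ (word v))))
λ′-*-word {a ∷ u} {[]} u∈ [] = ≋-trans (cong≋ (substitute-isLinear z-to-1) (*-identityʳ (word (a ∷ u))))
  (≋-trans (λ′-01-word u∈) (≋-sym (*-identityʳ (word (a ∷ u)))))
λ′-*-word {a ∷ u} {b ∷ v} u∈@(a∈ ∷ u′∈) v∈@(b∈ ∷ v′∈) = prove (01ᶠ ×ᶠ 01ᶠ)
  (λ ((a , _) , (b , _)) → let u = var 0; v = var 1 in problem []
    ( (s z-to-1 $ᵉ (u ⟨*⟩ (s 1-to-z $ᵉ b ▹ v)) ≐ u ⟨*⟩ b ▹ v)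
    ∷ (s z-to-1 $ᵉ (a ▹ u ⟨*⟩ (s 1-to-z $ᵉ v)) ≐ a ▹ u ⟨*⟩ v)
    ∷ (s z-to-1 $ᵉ (u ⟨*⟩ (s 1-to-z $ᵉ v)) ≐ u ⟨*⟩ v) ∷ [])
    (s z-to-1 $ᵉ (a ▹ u ⟨*⟩ (s 1-to-z $ᵉ b ▹ v)) ≐ a ▹ u ⟨*⟩ b ▹ v))
  refl ((a , a∈) , (b , b∈)) (word u ∷ word v ∷ []) []
  (λ′-*-word u′∈ v∈ ∷ λ′-*-word u∈ v′∈ ∷ λ′-*-word u′∈ v′∈ ∷ [])

λ′-doubleShuffle : ∀ {p q} → p ∈Span Word¹ → q ∈Span Word⁰ → λ′ (doubleShuffle p q) ≋ p ш q - p * q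
-- Passing to the difference of the two sides leaves a single bilinear map, to which
-- `bilinear-span-induction` applies.
λ′-doubleShuffle p∈ q∈ = p-q≋0⇒p≋q (bilinear-span-induction {R = λ x → x ≋ 0#}
  (compose (substitute-isLinear z-to-1) doubleShuffle-isBilinear id-isLinear id-isLinear ⟨-⟩ (ш-isBilinear ⟨-⟩ *-isBilinear))
  (equalizer id-isLinear 0-isLinear) on-words p∈ q∈)
  where
  on-words : ∀ {u v} → Word¹ u → Word⁰ v → λ′ (doubleShuffle (word u) (word v)) - (word u ш word v - word u * word v) ≋ 0#
  on-words {u} {v} u∈ v∈ = ≋-trans (-cong (≋-trans (-‿homo (substitute-isLinear z-to-1) (word u ш ζ (word v)) (word u * ζ (word v)))
    (-cong (≋-trans (substitute-ш z-to-1 (word u) (ζ (word v))) (cong₂≋ ш-isBilinear (λ′-01-word (Word¹⇒01 u∈)) (λ′-ζ-word (Word⁰⇒01 v∈))))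
      (λ′-*-word (Word¹⇒01 u∈) (Word⁰⇒01 v∈))))
    (≋-refl {word u ш word v - word u * word v}))
    (-‿inverse (word u ш word v - word u * word v))

-- First and last letters of the words in a product

1z-letters : List Letter
1z-letters = e1 ∷ ez ∷ []

-- Equivalent to the form `w ∷ʳ b` with `b` in `T`, but inductive from the head, where the products
-- recurse.
data Ends (T : List Letter) : Pred Word 0ℓ where
  last  : ∀ {a} → a ∈ T → Ends T (a ∷ [])
  there : ∀ {a w} → Ends T w → Ends T (a ∷ w)

data Ends₀ (T : List Letter) : Pred Word 0ℓ where
  empty    : Ends₀ T []
  nonempty : ∀ {w} → Ends T w → Ends₀ T w

-- `0z-letters` for `T` gives the words of 𝒜_z⁰, and `e0 ∷ []` those of 𝒜_z⁻².
data Admissible (T : List Letter) : Pred Word 0ℓ where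
  empty : Admissible T []
  start : ∀ {a w} → a ∈ 1z-letters → Ends T (a ∷ w) → Admissible T (a ∷ w)

AllWords : Pred Word 0ℓ → 𝒜z → Set
AllWords P = All λ (_ , w) → P w

nonempty-∷ : ∀ {T b v} → Ends₀ T (b ∷ v) → Ends T (b ∷ v)
nonempty-∷ (nonempty e) = e

tail₀ : ∀ {T a w} → Ends T (a ∷ w) → Ends₀ T w
tail₀ (last _)  = empty
tail₀ (there e) = nonempty e

-- A word of u ш v ends with the last letter of `u` or of `v`, so one factor may be empty as long as
-- the other is not. Removing a first letter may empty either factor, whence the mutual recursion.
ш-Endsˡ : ∀ {T u v} → Ends₀ T u → Ends T v → AllWords (Ends T) (u шʷ v)
ш-Endsʳ : ∀ {T u v} → Ends T u → Ends₀ T v → AllWords (Ends T) (u шʷ v)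
ш-Endsˡ {u = []}              _ ev = ev ∷ []
ш-Endsˡ {u = a ∷ u} {b ∷ v} eu ev = All.++⁺ (All-◃ there (ш-Endsˡ (tail₀ (nonempty-∷ eu)) ev))
  (All-◃ there (ш-Endsʳ (nonempty-∷ eu) (tail₀ ev)))
ш-Endsʳ {u = a ∷ u} {[]}    eu _  = eu ∷ []
ш-Endsʳ {u = a ∷ u} {b ∷ v} eu ev = All.++⁺ (All-◃ there (ш-Endsˡ (tail₀ eu) (nonempty-∷ ev)))
  (All-◃ there (ш-Endsʳ eu (tail₀ (nonempty-∷ ev))))

ш-Admissible : ∀ {T u v} → Admissible T u → Admissible T v → AllWords (Admissible T) (u шʷ v)
ш-Admissible empty          v∈             = v∈ ∷ []
ш-Admissible u∈@(start _ _) empty          = u∈ ∷ []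
ш-Admissible (start a∈ eu)  (start b∈ ev) = All.++⁺
  (All-◃ (λ e → start a∈ (there e)) (ш-Endsˡ (tail₀ eu) ev))
  (All-◃ (λ e → start b∈ (there e)) (ш-Endsʳ eu (tail₀ ev)))

∷ʳ-Ends : ∀ {T b} w → b ∈ T → Ends T (w ∷ʳ b)
∷ʳ-Ends []      b∈ = last b∈
∷ʳ-Ends (a ∷ w) b∈ = there (∷ʳ-Ends w b∈)

Ends-∷ʳ : ∀ {T w} → Ends T w → ∃[ v ] ∃[ b ] b ∈ T × w ≡ v ∷ʳ b
Ends-∷ʳ (last {b} b∈) = [] , b , b∈ , refl
Ends-∷ʳ (there {a} e) with v , b , b∈ , refl ← Ends-∷ʳ e = a ∷ v , b , b∈ , refl

Word⁰⇒Admissible : ∀ {T w} → e0 ∈ T → Word⁰ w → Admissible T w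
Word⁰⇒Admissible e0∈ empty          = empty
Word⁰⇒Admissible e0∈ (inner {w} _) = start (here refl) (there (∷ʳ-Ends w e0∈))

Wordz⁰⇒Admissible : ∀ {w} → Wordz⁰ w → Admissible 0z-letters w
Wordz⁰⇒Admissible empty             = empty
Wordz⁰⇒Admissible single            = start (there (here refl)) (last (there (here refl)))
Wordz⁰⇒Admissible (inner w a∈ b∈) = start a∈ (there (∷ʳ-Ends w b∈))

Admissible⇒Wordz⁰ : ∀ {w} → Admissible 0z-letters w → Wordz⁰ w
Admissible⇒Wordz⁰ empty                                                     = empty
Admissible⇒Wordz⁰ (start (here refl)         (last (here ())))
Admissible⇒Wordz⁰ (start (here refl)         (last (there (here ()))))
Admissible⇒Wordz⁰ (start (there (here refl)) (last _))                      = single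
Admissible⇒Wordz⁰ (start a∈ (there e)) with v , b , b∈ , refl ← Ends-∷ʳ e = inner v a∈ b∈

Wordz⁻²⇒Admissible : ∀ {w} → Wordz⁻² w → Admissible (e0 ∷ []) w
Wordz⁻²⇒Admissible empty          = empty
Wordz⁻²⇒Admissible (inner w a∈) = start a∈ (there (∷ʳ-Ends w (here refl)))

Admissible⇒Wordz⁻² : ∀ {w} → Admissible (e0 ∷ []) w → Wordz⁻² w
Admissible⇒Wordz⁻² empty                                            = empty
Admissible⇒Wordz⁻² (start (here refl)         (last (here ())))
Admissible⇒Wordz⁻² (start (there (here refl)) (last (here ())))
Admissible⇒Wordz⁻² (start a∈ (there e)) with v , b , here refl , refl ← Ends-∷ʳ e = inner v a∈

Wordz⁻²⇒Wordz⁰ : ∀ {w} → Wordz⁻² w → Wordz⁰ w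
Wordz⁻²⇒Wordz⁰ empty        = empty
Wordz⁻²⇒Wordz⁰ (inner w a∈) = inner w a∈ (here refl)

ш-Span : ∀ {P Q R : Pred Word 0ℓ} → (∀ {u v} → P u → Q v → AllWords R (u шʷ v)) →
  ∀ {p q} → p ∈Span P → q ∈Span Q → p ш q ∈Span R
ш-Span {R = R} h = bilinear-span-induction ш-isBilinear (Span-submodule R)
  (λ {u} {v} Pu Qv → resp≋ (Span-submodule R) (≋-sym (ш-word u v)) (All⇒Span (h Pu Qv)))

ш-𝒜z⁰ : ∀ {p q} → p ∈Span Word⁰ → q ∈Span Wordz⁰ → p ш q ∈Span Wordz⁰
ш-𝒜z⁰ = ш-Span (λ u∈ v∈ → All.map Admissible⇒Wordz⁰
  (ш-Admissible (Word⁰⇒Admissible (here refl) u∈) (Wordz⁰⇒Admissible v∈)))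

ш-𝒜z⁻² : ∀ {p q} → p ∈Span Word⁰ → q ∈Span Wordz⁻² → p ш q ∈Span Wordz⁻²
ш-𝒜z⁻² = ш-Span (λ u∈ v∈ → All.map Admissible⇒Wordz⁻²
  (ш-Admissible (Word⁰⇒Admissible (here refl) u∈) (Wordz⁻²⇒Admissible v∈)))

-- Words on which the regularization is carried out

-- No word of this form ends in e_z, which is why z ↦ 1 commutes with D on their span.
data Trailing01 : Pred Word 0ℓ where
  here  : ∀ {w} → Over 01-letters w → Trailing01 (e0 ∷ w)
  there : ∀ {a w} → Trailing01 w → Trailing01 (a ∷ w)

-- The e₀ supplied by `Trailing01` stops the stripping of final letters e₁ before it can expose an
-- e_z or reach the first letter. The span is therefore closed under `D` and under ш with powers of
-- e₁, hence under `reg`.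
data Regularizable : Pred Word 0ℓ where
  start : ∀ {a w} → a ∈ 1z-letters → Trailing01 w → Regularizable (a ∷ w)

Ends⇒Trailing01 : ∀ {w} → Ends (e0 ∷ []) w → Trailing01 w
Ends⇒Trailing01 (last (here refl)) = here []
Ends⇒Trailing01 (there e)          = there (Ends⇒Trailing01 e)

01-ш : ∀ {S u v} → Over S u → Over S v → AllWords (Over S) (u шʷ v)
01-ш []           v∈            = v∈ ∷ []
01-ш (a∈ ∷ u∈)  []            = (a∈ ∷ u∈) ∷ []
01-ш (a∈ ∷ u∈)  (b∈ ∷ v∈) = All.++⁺ (All-◃ (a∈ ∷_) (01-ш u∈ (b∈ ∷ v∈))) (All-◃ (b∈ ∷_) (01-ш (a∈ ∷ u∈) v∈))

01-ш-Trailing01 : ∀ {u v} → Over 01-letters u → Ends (e0 ∷ []) v → AllWords Trailing01 (u шʷ v)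
01-ш-Trailing01 []          ev                 = Ends⇒Trailing01 ev ∷ []
01-ш-Trailing01 (a∈ ∷ u∈) (last (here refl)) =
  All.++⁺ (All-◃ there (01-ш-Trailing01 u∈ (last (here refl)))) (here (a∈ ∷ u∈) ∷ [])
01-ш-Trailing01 (a∈ ∷ u∈) (there ev)         =
  All.++⁺ (All-◃ there (01-ш-Trailing01 u∈ (there ev))) (All-◃ there (01-ш-Trailing01 (a∈ ∷ u∈) ev))

Trailing01-ш-01 : ∀ {u v} → Trailing01 u → Over 01-letters v → AllWords Trailing01 (u шʷ v)
Trailing01-ш-01 (here u∈)  []          = here u∈ ∷ []
Trailing01-ш-01 (here u∈)  (b∈ ∷ v∈) = All.++⁺ (All-◃ here (01-ш u∈ (b∈ ∷ v∈))) (All-◃ there (Trailing01-ш-01 (here u∈) v∈))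
Trailing01-ш-01 (there u∈) []          = there u∈ ∷ []
Trailing01-ш-01 (there u∈) (b∈ ∷ v∈) =
  All.++⁺ (All-◃ there (Trailing01-ш-01 u∈ (b∈ ∷ v∈))) (All-◃ there (Trailing01-ш-01 (there u∈) v∈))

-- Once the second factor is reduced to its last e₀, the leading label `a ·ˡ e0` is e₀, and what
-- follows it is either a word in e₀, e₁ or covered by the recursion on `u`.
01-*-Trailing01 : ∀ {u v} → Over 01-letters u → Ends (e0 ∷ []) v → AllWords Trailing01 (u *ʷ v)
01-*-Trailing01 []          ev                 = Ends⇒Trailing01 ev ∷ []
01-*-Trailing01 {a ∷ u} (a∈ ∷ u∈) (there ev) = All-◃ there
  (All.++⁺ (All.++⁺ (01-*-Trailing01 u∈ (there ev)) (01-*-Trailing01 (a∈ ∷ u∈) ev))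
    (All.map⁺ (All-◃ there (01-*-Trailing01 u∈ ev))))
01-*-Trailing01 {a ∷ u} (a∈ ∷ u∈) (last (here refl)) = All.map⁺ (All.++⁺ (All.++⁺
    (All.map there (01-*-Trailing01 u∈ (last (here refl)))) (e0-start a∈ (a∈ ∷ u∈) ∷ []))
    (All.map⁺ (All-◃ (λ w∈ → e0-start a∈ (here refl ∷ w∈)) (01-*-[] u∈))))
  where
  e0-start : ∀ {a w} → a ∈ 01-letters → Over 01-letters w → Trailing01 ((a ·ˡ e0) ∷ w)
  e0-start (here refl)         w∈ = here w∈
  e0-start (there (here refl)) w∈ = here w∈
  01-*-[] : ∀ {u} → Over 01-letters u → AllWords (Over 01-letters) (u *ʷ [])
  01-*-[] []          = [] ∷ []
  01-*-[] (a∈ ∷ u∈) = (a∈ ∷ u∈) ∷ []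

doubleShuffle-Regularizable : ∀ {p q} → p ∈Span Word¹ → q ∈Span Word⁰ → doubleShuffle p q ∈Span Regularizable
doubleShuffle-Regularizable = bilinear-span-induction doubleShuffle-isBilinear (Span-submodule Regularizable) on-words
  where
  ez-Ends : ∀ w → Ends (e0 ∷ []) (map 1↦z (w ∷ʳ e0))
  ez-Ends []      = last (here refl)
  ez-Ends (a ∷ w) = there (ez-Ends w)
  ш∈ : ∀ {u v} → Word¹ u → Ends (e0 ∷ []) v → AllWords Regularizable (u шʷ (ez ∷ v))
  ш∈ empty      ev = start (there (here refl)) (Ends⇒Trailing01 ev) ∷ []
  ш∈ (inner u∈) ev = All.++⁺ (All-◃ (start (here refl)) (01-ш-Trailing01 u∈ (there ev)))
    (All-◃ (start (there (here refl))) (01-ш-Trailing01 (there (here refl) ∷ u∈) ev))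
  *∈ : ∀ {u v} → Word¹ u → Ends (e0 ∷ []) v → AllWords Regularizable (u *ʷ (ez ∷ v))
  *∈ empty      ev = start (there (here refl)) (Ends⇒Trailing01 ev) ∷ []
  *∈ (inner u∈) ev = All-◃ (start (there (here refl)))
    (All.++⁺ (All.++⁺ (01-*-Trailing01 u∈ (there ev)) (01-*-Trailing01 (there (here refl) ∷ u∈) ev))
      (All.map⁺ (All-◃ there (01-*-Trailing01 u∈ ev))))
  on-words : ∀ {u v} → Word¹ u → Word⁰ v → doubleShuffle (word u) (word v) ∈Span Regularizable
  -- For v = 1 both products are u, which need not be regularizable itself, but they cancel.
  on-words {u} u∈ empty = 0∈Span (≋-trans
    (-cong (ш-identityʳ (word u)) (*-identityʳ (word u))) (-‿inverse (word u)))
  on-words {u} u∈ (inner {w} _) = resp≋ (Span-submodule Regularizable)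
    (≋-sym (-cong (ш-word u v) (*-word u v)))
    (-∈ (Span-submodule Regularizable) (All⇒Span (ш∈ u∈ (ez-Ends w))) (All⇒Span (*∈ u∈ (ez-Ends w))))
    where
    v : Word
    v = ez ∷ map 1↦z (w ∷ʳ e0)

-- The derivation D and its kernel

D : 𝒜z → 𝒜z
D = F final

D-isLinear : IsLinear D
D-isLinear = F-isLinear final

ones : ℕ → 𝒜z
ones k = word (replicate k e1)

ones-01 : ∀ k → Over 01-letters (replicate k e1)
ones-01 k = All.replicate⁺ k (there (here refl))

D-∷∷ : ∀ a b w → D (word (a ∷ b ∷ w)) ≋ a ◃ D (word (b ∷ w))
D-∷∷ a b w = prove (letters ×ᶠ letters)
  (λ (a , b) → problem [] [] (f final $ᵉ a ▹ b ▹ var 0 ≐ a ▹ (f final $ᵉ b ▹ var 0)))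
  refl (a , b) (word w ∷ []) [] []

D-[e1] : D (word [ e1 ]) ≋ 1#
D-[e1] = prove unitᶠ (λ _ → problem [] [] (f final $ᵉ e1 ▹ 𝟙 ≐ 𝟙)) refl tt [] [] []

D-[0z] : ∀ {a} → a ∈ 0z-letters → D (word [ a ]) ≋ 0#
D-[0z] {a} a∈ = prove 0zᶠ (λ (a , _) → problem [] [] (f final $ᵉ a ▹ 𝟙 ≐ 𝟘)) refl (a , a∈) [] [] []

D-ones : ∀ k → D (ones (suc k)) ≋ ones k
D-ones zero    = D-[e1]
D-ones (suc k) = ≋-trans (D-∷∷ e1 e1 (replicate k e1)) (cong≋ (◃-isLinear e1) (D-ones k))

D-Ends : ∀ {w} → Ends 0z-letters w → D (word w) ≋ 0#
D-Ends (last a∈)                     = D-[0z] a∈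
D-Ends (there {a} {b ∷ w} e) = ≋-trans (D-∷∷ a b w) (≋-trans (cong≋ (◃-isLinear a) (D-Ends e)) ≋-refl)

D-𝒜z⁰ : ∀ {p} → p ∈Span Wordz⁰ → D p ≋ 0#
D-𝒜z⁰ = span-induction (equalizer D-isLinear 0-isLinear) (λ w∈ → on-words (Wordz⁰⇒Admissible w∈))
  where
  on-words : ∀ {w} → Admissible 0z-letters w → D (word w) ≋ 0#
  on-words empty       = ≋-refl
  on-words (start _ e) = D-Ends e

D-01 : ∀ {w} → Over 01-letters w → D (word w) ∈Span Over 01-letters
D-01 []                               = 0∈Span ≋-refl
D-01 (here refl ∷ [])                 = 0∈Span (D-[0z] (here refl))
D-01 (there (here refl) ∷ [])         = resp≋ (Span-submodule _) (≋-sym D-[e1]) (word∈Span [])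
D-01 {a ∷ b ∷ w} (a∈ ∷ w∈@(_ ∷ _)) = resp≋ (Span-submodule _) (≋-sym (D-∷∷ a b w)) (Span-◃ a (a∈ ∷_) (D-01 w∈))

D-Trailing01 : ∀ {w} → Trailing01 w → D (word w) ∈Span Trailing01
D-Trailing01 (here [])                   = 0∈Span (D-[0z] (here refl))
D-Trailing01 {_ ∷ b ∷ w} (here w∈@(_ ∷ _)) = resp≋ (Span-submodule _) (≋-sym (D-∷∷ e0 b w)) (Span-◃ e0 here (D-01 w∈))
D-Trailing01 {a ∷ b ∷ w} (there w∈)     = resp≋ (Span-submodule _) (≋-sym (D-∷∷ a b w)) (Span-◃ a there (D-Trailing01 w∈))

D-Regularizable : ∀ {p} → p ∈Span Regularizable → D p ∈Span Regularizable
D-Regularizable = span-induction (preimage D-isLinear (Span-submodule Regularizable)) on-words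
  where
  on-words : ∀ {w} → Regularizable w → D (word w) ∈Span Regularizable
  on-words {a ∷ b ∷ w} (start a∈ w∈) =
    resp≋ (Span-submodule _) (≋-sym (D-∷∷ a b w)) (Span-◃ a (start a∈) (D-Trailing01 w∈))

ш-ones-Regularizable : ∀ k {p} → p ∈Span Regularizable → p ш ones k ∈Span Regularizable
ш-ones-Regularizable k = span-induction (preimage (linearˡ ш-isBilinear (ones k)) (Span-submodule Regularizable))
  (λ {w} w∈ → resp≋ (Span-submodule _) (≋-sym (ш-word w (replicate k e1))) (All⇒Span (on-words w∈ k)))
  where
  on-words : ∀ {w} → Regularizable w → ∀ k → AllWords Regularizable (w шʷ replicate k e1)
  on-words (start a∈ w∈) zero    = start a∈ w∈ ∷ []
  on-words (start a∈ w∈) (suc k) = All.++⁺ (All-◃ (start a∈) (Trailing01-ш-01 w∈ (ones-01 (suc k))))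
    (All-◃ (start (here refl)) (Trailing01-ш-01 (there w∈) (ones-01 k)))

snoc-e1 : 𝒜z → 𝒜z
snoc-e1 = linear λ w → word (w ∷ʳ e1)

snoc-e1-isLinear : IsLinear snoc-e1
snoc-e1-isLinear = linear-isLinear (λ w → word (w ∷ʳ e1))

snoc-e1-◃ : ∀ a p → snoc-e1 (a ◃ p) ≋ a ◃ snoc-e1 p
snoc-e1-◃ a = linear-ext (∘-isLinear snoc-e1-isLinear (◃-isLinear a)) (∘-isLinear (◃-isLinear a) snoc-e1-isLinear)
  (λ w → ≋-refl)

-- Kills the words ending in e₁ and fixes all others.
drop-final : 𝒜z → 𝒜z
drop-final p = p - snoc-e1 (D p)

drop-final-isLinear : IsLinear drop-final
drop-final-isLinear = -‿isLinear id-isLinear (∘-isLinear snoc-e1-isLinear D-isLinear)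

drop-final-∷∷ : ∀ a b w → drop-final (word (a ∷ b ∷ w)) ≋ a ◃ drop-final (word (b ∷ w))
drop-final-∷∷ a b w = ≋-trans
  (-cong (≋-refl {word (a ∷ b ∷ w)}) (≋-trans (cong≋ snoc-e1-isLinear (D-∷∷ a b w)) (snoc-e1-◃ a (D (word (b ∷ w))))))
  (≋-sym (-‿homo (◃-isLinear a) (word (b ∷ w)) (snoc-e1 (D (word (b ∷ w))))))

drop-final-[e0] : drop-final (word [ e0 ]) ≋ word [ e0 ]
drop-final-[e0] = ≋-trans (-cong (≋-refl {word [ e0 ]}) (≋-trans (cong≋ snoc-e1-isLinear (D-[0z] (here refl))) (≋-refl {0#})))
  (+-identityʳ (word [ e0 ]))

drop-final-[e1] : drop-final (word [ e1 ]) ≋ 0#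
drop-final-[e1] = ≋-trans (-cong (≋-refl {word [ e1 ]}) (cong≋ snoc-e1-isLinear D-[e1])) (-‿inverse (word [ e1 ]))

drop-final-∷ : ∀ {P : Pred Word 0ℓ} a {b w} → (∀ {v} → Ends (e0 ∷ []) v → P (a ∷ v)) →
  drop-final (word (b ∷ w)) ∈Span Ends (e0 ∷ []) → drop-final (word (a ∷ b ∷ w)) ∈Span P
drop-final-∷ a {b} {w} h w∈ = resp≋ (Span-submodule _) (≋-sym (drop-final-∷∷ a b w)) (Span-◃ a h w∈)

drop-final-01 : ∀ {a w} → Over 01-letters (a ∷ w) → drop-final (word (a ∷ w)) ∈Span Ends (e0 ∷ [])
drop-final-01 (here refl ∷ [])         = resp≋ (Span-submodule _) (≋-sym drop-final-[e0]) (word∈Span (last (here refl)))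
drop-final-01 (there (here refl) ∷ []) = 0∈Span drop-final-[e1]
drop-final-01 (a∈ ∷ w∈@(_ ∷ _))        = drop-final-∷ _ there (drop-final-01 w∈)

drop-final-Trailing01 : ∀ {w} → Trailing01 w → drop-final (word w) ∈Span Ends (e0 ∷ [])
drop-final-Trailing01 (here w∈)                   = drop-final-01 (here refl ∷ w∈)
drop-final-Trailing01 {a ∷ b ∷ w} (there w∈) = drop-final-∷ a there (drop-final-Trailing01 w∈)

drop-final-Regularizable : ∀ {p} → p ∈Span Regularizable → drop-final p ∈Span Wordz⁻²
drop-final-Regularizable = span-induction (preimage drop-final-isLinear (Span-submodule Wordz⁻²)) on-words
  where
  on-words : ∀ {w} → Regularizable w → drop-final (word w) ∈Span Wordz⁻²
  on-words {a ∷ b ∷ w} (start a∈ w∈) =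
    drop-final-∷ a (λ e → Admissible⇒Wordz⁻² (start a∈ (there e))) (drop-final-Trailing01 w∈)

-- When `D p` vanishes, `drop-final p` is `p` itself, and the regularizable words that `drop-final`
-- keeps end in e₀. No representative of `p` without words ending in e₁ has to be chosen.
Regularizable-D≋0⇒𝒜z⁻² : ∀ {p} → p ∈Span Regularizable → D p ≋ 0# → p ∈Span Wordz⁻²
Regularizable-D≋0⇒𝒜z⁻² {p} p∈ e = resp≋ (Span-submodule Wordz⁻²)
  (≋-trans (-cong (≋-refl {p}) (≋-trans (cong≋ snoc-e1-isLinear e) (≋-refl {0#}))) (+-identityʳ p))
  (drop-final-Regularizable p∈)

λ′-D-step : ∀ {a b w} → D (λ′ (word (b ∷ w))) ≋ λ′ (D (word (b ∷ w))) →
  D (λ′ (word (a ∷ b ∷ w))) ≋ λ′ (D (word (a ∷ b ∷ w)))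
λ′-D-step {a} {b} {w} e = prove (letters ×ᶠ letters)
  (λ (a , b) → problem ((0 , b ∷ [] , just (var 1)) ∷ [])
    ((f final $ᵉ s z-to-1 $ᵉ var 0 ≐ s z-to-1 $ᵉ f final $ᵉ var 0) ∷ [])
    (f final $ᵉ s z-to-1 $ᵉ a ▹ var 0 ≐ s z-to-1 $ᵉ f final $ᵉ a ▹ var 0))
  refl (a , b) (word (b ∷ w) ∷ word w ∷ []) (≋-refl ∷ []) (e ∷ [])

λ′-D-01 : ∀ {a w} → Over 01-letters (a ∷ w) → D (λ′ (word (a ∷ w))) ≋ λ′ (D (word (a ∷ w)))
λ′-D-01 {a} (a∈ ∷ []) = prove 01ᶠ
  (λ (a , _) → problem [] [] (f final $ᵉ s z-to-1 $ᵉ a ▹ 𝟙 ≐ s z-to-1 $ᵉ f final $ᵉ a ▹ 𝟙)) refl (a , a∈) [] [] []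
λ′-D-01 (a∈ ∷ w∈@(_ ∷ _)) = λ′-D-step (λ′-D-01 w∈)

λ′-D-Trailing01 : ∀ {w} → Trailing01 w → D (λ′ (word w)) ≋ λ′ (D (word w))
λ′-D-Trailing01 (here w∈)                   = λ′-D-01 (here refl ∷ w∈)
λ′-D-Trailing01 {a ∷ b ∷ w} (there w∈) = λ′-D-step (λ′-D-Trailing01 w∈)

λ′-D : ∀ {p} → p ∈Span Regularizable → λ′ (D p) ≋ D (λ′ p)
λ′-D = span-induction
  (equalizer (∘-isLinear (substitute-isLinear z-to-1) D-isLinear) (∘-isLinear D-isLinear (substitute-isLinear z-to-1)))
  on-words
  where
  on-words : ∀ {w} → Regularizable w → λ′ (D (word w)) ≋ D (λ′ (word w))
  on-words {a ∷ b ∷ w} (start a∈ w∈) = ≋-sym (λ′-D-step (λ′-D-Trailing01 w∈))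

-- The formula for shuffle regularization

-- reg n 0 p = Σ_{i<n} (-1)ⁱ Dⁱ p ш e₁ⁱ, which is the shuffle regularization of p
-- as soon as Dⁿ p = 0.
reg : ℕ → ℕ → 𝒜z → 𝒜z
reg zero    k p = 0#
reg (suc n) k p = p ш ones k - reg n (suc k) (D p)

reg-isLinear : ∀ n k → IsLinear (reg n k)
reg-isLinear zero    k = 0-isLinear
reg-isLinear (suc n) k = -‿isLinear (linearˡ ш-isBilinear (ones k)) (∘-isLinear (reg-isLinear n (suc k)) D-isLinear)

-- The predicate `P` is carried along for the sake of `λ′`, which fails to commute with `D` on a
-- word ending in e_z: that letter would become an e₁ and be stripped. For `Const` after `∂*` the
-- commutation holds everywhere, with `U` for `P`.
reg-natural : ∀ {P : Pred 𝒜z 0ℓ} {φ} → IsLinear φ → (∀ {p} → P p → P (D p)) → (∀ {p} → P p → φ (D p) ≋ D (φ p)) →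
  (∀ k p → φ (p ш ones k) ≋ φ p ш ones k) → ∀ n k {p} → P p → φ (reg n k p) ≋ reg n k (φ p)
reg-natural φ-lin closed commutes equivariant zero    k     p∈ = 0-homo φ-lin
reg-natural φ-lin closed commutes equivariant (suc n) k {p} p∈ = ≋-trans
  (-‿homo φ-lin (p ш ones k) (reg n (suc k) (D p)))
  (-cong (equivariant k p) (≋-trans (reg-natural φ-lin closed commutes equivariant n (suc k) (closed p∈))
    (cong≋ (reg-isLinear n (suc k)) (commutes p∈))))

reg-Regularizable : ∀ n k {p} → p ∈Span Regularizable → reg n k p ∈Span Regularizable
reg-Regularizable zero    k p∈ = 0∈ (Span-submodule Regularizable)
reg-Regularizable (suc n) k p∈ = -∈ (Span-submodule Regularizable) (ш-ones-Regularizable k p∈)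
  (reg-Regularizable n (suc k) (D-Regularizable p∈))

D^ : ℕ → 𝒜z → 𝒜z
D^ zero    p = p
D^ (suc n) p = D^ n (D p)

D^-isLinear : ∀ n → IsLinear (D^ n)
D^-isLinear zero    = id-isLinear
D^-isLinear (suc n) = ∘-isLinear (D^-isLinear n) D-isLinear

D^-+ : ∀ m n p → D^ (m ℕ.+ n) p ≡ D^ n (D^ m p)
D^-+ zero    n p = refl
D^-+ (suc m) n p = D^-+ m n (D p)

D^-mono : ∀ m n {p} → D^ m p ≋ 0# → D^ (m ℕ.+ n) p ≋ 0#
D^-mono m n {p} e = ≋-trans (≋-reflexive (D^-+ m n p)) (≋-trans (cong≋ (D^-isLinear n) e) (0-homo (D^-isLinear n)))

D-G : ∀ a p → D (G final a p) ≋ 0#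
D-G a = linear-ext (∘-isLinear D-isLinear (G-isLinear final a)) 0-isLinear on-words
  where
  on-words : ∀ w → D (G final a (word w)) ≋ 0#
  on-words []      = prove letters (λ a → problem [] [] (f final $ᵉ g final a $ᵉ 𝟙 ≐ 𝟘)) refl a [] [] []
  on-words (b ∷ w) = prove (letters ×ᶠ letters)
    (λ (a , b) → problem [] [] (f final $ᵉ g final a $ᵉ b ▹ var 0 ≐ 𝟘)) refl (a , b) (word w ∷ []) [] []

-- D(e_a p) and e_a D(p) differ by `G final a p`, a multiple of 1, which `D` kills. So each letter
-- put in front raises the order of nilpotency by at most one.
DD-◃ : ∀ a p → D (D (a ◃ p)) ≋ D (a ◃ D p)
DD-◃ a p = begin
  D (D (a ◃ p))                    ≈⟨ cong≋ D-isLinear (prove letters (λ a → problem [] []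
    (f final $ᵉ a ▹ var 0 ≐ a ▹ (f final $ᵉ var 0) ⊕ g final a $ᵉ var 0)) refl a (p ∷ []) [] []) ⟩
  D ((a ◃ D p) + G final a p)      ≈⟨ +-homo D-isLinear (a ◃ D p) (G final a p) ⟩
  D (a ◃ D p) + D (G final a p)    ≈⟨ +-congʳ (D (a ◃ D p)) (D-G a p) ⟩
  D (a ◃ D p) + 0#                 ≈⟨ +-identityʳ (D (a ◃ D p)) ⟩
  D (a ◃ D p)                      ∎
  where open ≋-Reasoning

D^-◃ : ∀ n a {p} → D^ n p ≋ 0# → D^ (suc n) (a ◃ p) ≋ 0#
D^-◃ zero    a e = ≋-trans (cong≋ D-isLinear (cong≋ (◃-isLinear a) e)) ≋-refl
D^-◃ (suc n) a {p} e = ≋-trans (cong≋ (D^-isLinear n) (DD-◃ a p)) (D^-◃ n a e)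

D-nilpotent-word : ∀ w → ∃[ n ] D^ n (word w) ≋ 0#
D-nilpotent-word []      = 1 , ≋-refl
D-nilpotent-word (a ∷ w) with n , e ← D-nilpotent-word w = suc n , D^-◃ n a e

D-nilpotent : ∀ p → ∃[ n ] D^ n p ≋ 0#
D-nilpotent []            = 0 , ≋-refl
D-nilpotent ((c , w) ∷ p) = m ℕ.+ n , (begin
  D^ (m ℕ.+ n) ((c , w) ∷ p)                       ≈⟨ cong≋ (D^-isLinear (m ℕ.+ n)) (∷≋ c w p) ⟨
  D^ (m ℕ.+ n) (c · word w + p)                    ≈⟨ +-homo (D^-isLinear (m ℕ.+ n)) (c · word w) p ⟩
  D^ (m ℕ.+ n) (c · word w) + D^ (m ℕ.+ n) p       ≈⟨ +-cong
    (≋-trans (·-homo (D^-isLinear (m ℕ.+ n)) c (word w)) (·-cong c (D^-mono m n (proj₂ (D-nilpotent-word w)))))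
    (≋-trans (≋-reflexive (cong (λ k → D^ k p) (ℕ.+-comm m n))) (D^-mono n m (proj₂ (D-nilpotent p)))) ⟩
  0#                                               ∎)
  where
  open ≋-Reasoning
  m n : ℕ
  m = proj₁ (D-nilpotent-word w)
  n = proj₁ (D-nilpotent p)

D-ш-ones : ∀ k p → D (p ш ones (suc k)) ≋ D p ш ones (suc k) + p ш ones k
D-ш-ones k p = ≋-trans (F-ш final p (ones (suc k)))
  (+-congʳ (D p ш ones (suc k)) (cong≋ (linearʳ ш-isBilinear p) (D-ones k)))

p+q-p≋q : ∀ p q → p + q - p ≋ q
p+q-p≋q p q = begin
  p + q - p        ≈⟨ +-congˡ (- p) (+-comm p q) ⟩
  q + p - p        ≈⟨ +-assoc q p (- p) ⟩
  q + (p - p)      ≈⟨ +-congʳ q (-‿inverse p) ⟩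
  q + 0#           ≈⟨ +-identityʳ q ⟩
  q                ∎
  where open ≋-Reasoning

-- By the derivation rule, D(Dⁱp ш e₁^(k+1+i)) consists of Dⁱ⁺¹p ш e₁^(k+1+i) and Dⁱp ш e₁^(k+i). In
-- the alternating sum the former cancels against the latter for i + 1, and the last term is 0
-- because Dⁿp = 0.
D-reg-suc : ∀ n k {p} → D^ n p ≋ 0# → D (reg n (suc k) p) ≋ p ш ones k
D-reg-suc zero    k {p} e = ≋-sym (≋-trans (cong≋ (linearˡ ш-isBilinear (ones k)) e) (0-homo (linearˡ ш-isBilinear (ones k))))
D-reg-suc (suc n) k {p} e = begin
  D (p ш ones (suc k) - reg n (suc (suc k)) (D p))          ≈⟨ -‿homo D-isLinear (p ш ones (suc k)) (reg n (suc (suc k)) (D p)) ⟩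
  D (p ш ones (suc k)) - D (reg n (suc (suc k)) (D p))      ≈⟨ -cong (D-ш-ones k p) (D-reg-suc n (suc k) e) ⟩
  D p ш ones (suc k) + p ш ones k - D p ш ones (suc k)      ≈⟨ p+q-p≋q (D p ш ones (suc k)) (p ш ones k) ⟩
  p ш ones k                                                ∎
  where open ≋-Reasoning

D-reg : ∀ n {p} → D^ n p ≋ 0# → D (reg n 0 p) ≋ 0#
D-reg zero    e = ≋-refl
D-reg (suc n) {p} e = begin
  D (p ш 1# - reg n 1 (D p))           ≈⟨ -‿homo D-isLinear (p ш 1#) (reg n 1 (D p)) ⟩
  D (p ш 1#) - D (reg n 1 (D p))       ≈⟨ -cong (≋-trans (cong≋ D-isLinear (ш-identityʳ p)) (≋-sym (ш-identityʳ (D p)))) (D-reg-suc n 0 e) ⟩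
  D p ш 1# - D p ш 1#                  ≈⟨ -‿inverse (D p ш 1#) ⟩
  0#                                   ∎
  where open ≋-Reasoning

p-0≋p : ∀ {p q} → q ≋ 0# → p - q ≋ p
p-0≋p {p} e = ≋-trans (-cong (≋-refl {p}) e) (+-identityʳ p)

module _ {x} (Dx≋0 : D x ≋ 0#) where

  D-ш-ones₀ : ∀ k → D (x ш ones (suc k)) ≋ x ш ones k
  D-ш-ones₀ k = ≋-trans (D-ш-ones k x) (+-congˡ (x ш ones k)
    (≋-trans (cong≋ (linearˡ ш-isBilinear (ones (suc k))) Dx≋0) (0-homo (linearˡ ш-isBilinear (ones (suc k))))))

  reg-D[x]≋0 : ∀ n k → reg n k (D (x ш 1#)) ≋ 0#
  reg-D[x]≋0 n k = ≋-trans (cong≋ (reg-isLinear n k) (≋-trans (cong≋ D-isLinear (ш-identityʳ x)) Dx≋0)) (0-homo (reg-isLinear n k))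

  -- The alternating sum over i of e₁ʲ⁻ⁱ ш e₁ᵏ⁺¹⁺ⁱ telescopes.
  reg-suc-ш-ones : ∀ {n j} k → j ℕ.< n → reg n (suc k) (x ш ones j) ≋ x ш (e1 ◃ ones j ш ones k)
  reg-suc-ш-ones {suc n} {zero}  k _         = begin
    x ш 1# ш ones (suc k) - reg n (suc (suc k)) (D (x ш 1#))  ≈⟨ p-0≋p (reg-D[x]≋0 n (suc (suc k))) ⟩
    x ш 1# ш ones (suc k)                                     ≈⟨ cong≋ (linearˡ ш-isBilinear (ones (suc k))) (ш-identityʳ x) ⟩
    x ш ones (suc k)                                          ≈⟨ cong≋ (linearʳ ш-isBilinear x) (cong≋ (◃-isLinear e1) (ш-identityˡ (ones k))) ⟨
    x ш (e1 ◃ 1# ш ones k)                                    ∎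
    where open ≋-Reasoning
  reg-suc-ш-ones {suc n} {suc j} k (s≤s j<n) = begin
    x ш ones (suc j) ш ones (suc k) - reg n (suc (suc k)) (D (x ш ones (suc j)))
      ≈⟨ -cong (ш-assoc x (ones (suc j)) (ones (suc k)))
          (≋-trans (cong≋ (reg-isLinear n (suc (suc k))) (D-ш-ones₀ j)) (reg-suc-ш-ones (suc k) j<n)) ⟩
    x ш (ones (suc j) ш ones (suc k)) - x ш (e1 ◃ ones j ш ones (suc k))
      ≈⟨ prove unitᶠ (λ _ → let x = var 0; a = var 1; b = var 2 in problem [] []
          (x ⟨ш⟩ (e1 ▹ a ⟨ш⟩ e1 ▹ b) ⊖ x ⟨ш⟩ e1 ▹ (a ⟨ш⟩ e1 ▹ b) ≐ x ⟨ш⟩ e1 ▹ (e1 ▹ a ⟨ш⟩ b)))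
          refl tt (x ∷ ones j ∷ ones k ∷ []) [] [] ⟩
    x ш (e1 ◃ ones (suc j) ш ones k) ∎
    where open ≋-Reasoning

  reg-fixes : ∀ n → reg (suc n) 0 x ≋ x
  reg-fixes n = ≋-trans (-cong (ш-identityʳ x) (≋-trans (cong≋ (reg-isLinear n 1) Dx≋0) (0-homo (reg-isLinear n 1)))) (+-identityʳ x)

  reg-kills : ∀ {n j} → j ℕ.< n → reg (suc n) 0 (x ш ones (suc j)) ≋ 0#
  reg-kills {n} {j} j<n = begin
    x ш ones (suc j) ш 1# - reg n 1 (D (x ш ones (suc j)))   ≈⟨ -cong (ш-identityʳ (x ш ones (suc j)))
      (≋-trans (cong≋ (reg-isLinear n 1) (D-ш-ones₀ j)) (reg-suc-ш-ones 0 j<n)) ⟩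
    x ш ones (suc j) - x ш (e1 ◃ ones j ш 1#)                ≈⟨ -cong (≋-refl {x ш ones (suc j)})
      (cong≋ (linearʳ ш-isBilinear x) (cong≋ (◃-isLinear e1) (ш-identityʳ (ones j)))) ⟩
    x ш ones (suc j) - x ш ones (suc j)                      ≈⟨ -‿inverse (x ш ones (suc j)) ⟩
    0#                                                       ∎
    where open ≋-Reasoning

-- `D` vanishes on 𝒜_z⁰, so `reg` fixes every x there and, for n large enough, kills x ш e₁ʲ⁺¹; only
-- w₀ survives from the expansion. Stating this for all n beyond a bound allows it to be combined
-- with the bound from `D-nilpotent`.
Regш-unique : ∀ {w w₀} → Regш w w₀ → ∃[ m ] (∀ n → m ℕ.≤ n → reg n 0 w ≋ w₀)
Regш-unique {w} {w₀} (M , wᵢ , wᵢ∈ , w≈ , w₀≈) = suc M , λ where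
    (suc n) (s≤s M≤n) → begin
      reg (suc n) 0 w                                        ≈⟨ cong≋ (reg-isLinear (suc n) 0) w≋∑ ⟩
      reg (suc n) 0 (term 0 + ∑ (applyUpTo suc M) term)      ≈⟨ +-homo (reg-isLinear (suc n) 0) (term 0) (∑ (applyUpTo suc M) term) ⟩
      reg (suc n) 0 (term 0) + reg (suc n) 0 (∑ (applyUpTo suc M) term) ≈⟨ +-cong
        (≋-trans (cong≋ (reg-isLinear (suc n) 0) (ш-identityʳ (wᵢ 0))) (reg-fixes (Dwᵢ≋0 0) n))
        (reg-∑ n (All.applyUpTo⁺₁ suc M (λ {i} i<M → i , refl , ℕ.≤-trans i<M M≤n))) ⟩
      wᵢ 0 + 0#                                              ≈⟨ +-identityʳ (wᵢ 0) ⟩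
      wᵢ 0                                                   ≈⟨ ⌜ w₀≈ ⌝ ⟨
      w₀                                                     ∎
  where
  open ≋-Reasoning
  term : ℕ → 𝒜z
  term i = wᵢ i ш ones i
  w≋∑ : w ≋ ∑ (upTo (suc M)) term
  w≋∑ = ⌜ w≈ ⌝
  Dwᵢ≋0 : ∀ i → D (wᵢ i) ≋ 0#
  Dwᵢ≋0 i = D-𝒜z⁰ (spanned {wᵢ i} (wᵢ∈ i))
  reg-∑ : ∀ n {is} → All (λ i → ∃[ j ] i ≡ suc j × j ℕ.< n) is → reg (suc n) 0 (∑ is term) ≋ 0#
  reg-∑ n []                                      = 0-homo (reg-isLinear (suc n) 0)
  reg-∑ n {_ ∷ is} ((j , refl , j<n) ∷ is<) = ≋-trans
    (+-homo (reg-isLinear (suc n) 0) (term (suc j)) (∑ is term))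
    (+-cong (reg-kills {x = wᵢ (suc j)} (Dwᵢ≋0 (suc j)) j<n) (reg-∑ n is<))

-- The confluence relations form an ideal

shuffleTensor-++ : ∀ t t′ → shuffleTensor (t ++ t′) ≋ shuffleTensor t + shuffleTensor t′
shuffleTensor-++ t t′ = ≋-reflexive (concatMap-++ (λ (u , v) → u ш v) t t′)

id⊗const-++ : ∀ t t′ → id⊗const (t ++ t′) ≋ id⊗const t + id⊗const t′
id⊗const-++ t t′ = ≋-reflexive (concatMap-++ (λ (u , v) → constantTerm v · u) t t′)

-- `τ` and the constant term act on right factors, so multiplying the left factors is compatible
-- with every stage of λ before `λ′`, which is itself multiplicative.
multiply : 𝒜z → Tensor → Tensor
multiply a = map λ (u , v) → a ш u , v

shuffleTensor-multiply : ∀ a t → shuffleTensor (multiply a t) ≋ a ш shuffleTensor t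
shuffleTensor-multiply a []            = ≋-sym (0-homo (linearʳ ш-isBilinear a))
shuffleTensor-multiply a ((u , v) ∷ t) = ≋-trans (+-cong (ш-assoc a u v) (shuffleTensor-multiply a t))
  (≋-sym (+-homo (linearʳ ш-isBilinear a) (u ш v) (shuffleTensor t)))

id⊗const-multiply : ∀ a t → id⊗const (multiply a t) ≋ a ш id⊗const t
id⊗const-multiply a []            = ≋-sym (0-homo (linearʳ ш-isBilinear a))
id⊗const-multiply a ((u , v) ∷ t) = ≋-trans
  (+-cong (≋-sym (·-homo (linearʳ ш-isBilinear a) (constantTerm v) u)) (id⊗const-multiply a t))
  (≋-sym (+-homo (linearʳ ш-isBilinear a) (constantTerm v · u) (id⊗const t)))

id⊗τ-multiply : ∀ a t → id⊗τ (multiply a t) ≡ multiply a (id⊗τ t)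
id⊗τ-multiply a []      = refl
id⊗τ-multiply a (_ ∷ t) = cong (_ ∷_) (id⊗τ-multiply a t)

⊗-multiply : ∀ {a N t} → a ∈Span Word⁰ → (𝒜z⁻² ⊗ N) t → (𝒜z⁻² ⊗ N) (multiply a t)
⊗-multiply a∈ t∈ = All.map⁺ (All.map (λ {(u , _)} (u∈ , v∈) → span (ш-𝒜z⁻² a∈ (spanned {u} u∈)) , v∈) t∈)

𝒜⁰⇒01 : ∀ {p} → p ∈Span Word⁰ → p ∈Span Over 01-letters
𝒜⁰⇒01 = Span-⊆ Word⁰⇒01

λ′-𝒜⁰ : ∀ {p} → p ∈Span Word⁰ → λ′ p ≋ p
λ′-𝒜⁰ = span-induction (equalizer (substitute-isLinear z-to-1) id-isLinear) (λ w∈ → λ′-01-word (Word⁰⇒01 w∈))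

-- The witnesses of `𝓘CF` unpacked, with the value of `N` fixed as `shuffleTensor (id⊗τ t)`. As λ is
-- given by its graph, closure under sums and products is obtained by operating on the two tensors.
record Confluence (x : 𝒜z) : Set where
  field
    {source}    : 𝒜z
    source∈   : source ∈Span Wordz⁰
    standard    : ∀ αs → Over 01-letters αs → Const (∂* αs source) ≋ 0#
    t t′        : Tensor
    t∈          : (𝒜z⁻² ⊗ (𝒜z⁰ ∩ ℤ⟨ e1 ∷ ez ∷ [] ⟩)) t
    t-shuffle   : shuffleTensor t ≋ source
    t′∈         : (𝒜z⁻² ⊗ ℤ⟨ [ ez ] ⟩) t′
    t′-shuffle  : shuffleTensor t′ ≋ shuffleTensor (id⊗τ t)
    value       : x ≋ λ′ (id⊗const t′)

Confluence⇒𝓘CF : ∀ {x} → Confluence x → 𝓘CF x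
Confluence⇒𝓘CF c = source , (span source∈ , λ αs αs∈ → at (standard αs αs∈)) ,
  shuffleTensor (id⊗τ t) , (t , (t∈ , at t-shuffle) , λ _ → refl) , t′ , (t′∈ , at t′-shuffle) , at value
  where open Confluence c

Confluence-resp : ∀ {x y} → x ≋ y → Confluence x → Confluence y
Confluence-resp x≋y c = record { Confluence c ; value = ≋-trans (≋-sym x≋y) (Confluence.value c) }

Confluence-0 : Confluence 0#
Confluence-0 = record
  { source∈  = 0∈ (Span-submodule Wordz⁰)
  ; standard   = λ αs _ → ≋-trans (cong≋ (substitute-isLinear constant) (0-homo (∂*-isLinear αs))) ≋-refl
  ; t          = []
  ; t′         = []
  ; t∈         = []
  ; t-shuffle  = ≋-refl
  ; t′∈        = []
  ; t′-shuffle = ≋-refl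
  ; value      = ≋-refl
  }

Confluence-+ : ∀ {x y} → Confluence x → Confluence y → Confluence (x + y)
Confluence-+ c d = record
  { source∈  = +∈ (Span-submodule Wordz⁰) C.source∈ E.source∈
  ; standard   = λ αs αs∈ → ≋-trans
      (≋-trans (cong≋ (substitute-isLinear constant) (+-homo (∂*-isLinear αs) C.source E.source))
        (+-homo (substitute-isLinear constant) (∂* αs C.source) (∂* αs E.source)))
      (+-cong (C.standard αs αs∈) (E.standard αs αs∈))
  ; t          = C.t ++ E.t
  ; t′         = C.t′ ++ E.t′
  ; t∈         = All.++⁺ C.t∈ E.t∈
  ; t-shuffle  = ≋-trans (shuffleTensor-++ C.t E.t) (+-cong C.t-shuffle E.t-shuffle)
  ; t′∈        = All.++⁺ C.t′∈ E.t′∈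
  ; t′-shuffle = ≋-trans (shuffleTensor-++ C.t′ E.t′) (≋-trans (+-cong C.t′-shuffle E.t′-shuffle)
      (≋-trans (≋-sym (shuffleTensor-++ (id⊗τ C.t) (id⊗τ E.t)))
        (≋-reflexive (cong shuffleTensor (sym (map-++ (map₂ τ) C.t E.t))))))
  ; value      = ≋-trans (+-cong C.value E.value)
      (≋-trans (≋-sym (+-homo (substitute-isLinear z-to-1) (id⊗const C.t′) (id⊗const E.t′)))
        (cong≋ (substitute-isLinear z-to-1) (≋-sym (id⊗const-++ C.t′ E.t′))))
  }
  where
  module C = Confluence c
  module E = Confluence d

Confluence-ш : ∀ {a x} → a ∈Span Word⁰ → Confluence x → Confluence (a ш x)
Confluence-ш {a} {x} a∈ c = record
  { source∈  = ш-𝒜z⁰ a∈ C.source∈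
  ; standard   = λ αs αs∈ → begin
      Const (∂* αs (a ш C.source))         ≈⟨ cong≋ (substitute-isLinear constant) (∂*-ш-01ˡ αs∈ (𝒜⁰⇒01 a∈) C.source) ⟩
      Const (a ш ∂* αs C.source)           ≈⟨ substitute-ш constant a (∂* αs C.source) ⟩
      Const a ш Const (∂* αs C.source)     ≈⟨ cong≋ (linearʳ ш-isBilinear (Const a)) (C.standard αs αs∈) ⟩
      Const a ш 0#                           ≈⟨ 0-homo (linearʳ ш-isBilinear (Const a)) ⟩
      0#                                     ∎
  ; t          = multiply a C.t
  ; t′         = multiply a C.t′
  ; t∈         = ⊗-multiply a∈ C.t∈
  ; t-shuffle  = ≋-trans (shuffleTensor-multiply a C.t) (cong≋ (linearʳ ш-isBilinear a) C.t-shuffle)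
  ; t′∈        = ⊗-multiply a∈ C.t′∈
  ; t′-shuffle = begin
      shuffleTensor (multiply a C.t′)        ≈⟨ shuffleTensor-multiply a C.t′ ⟩
      a ш shuffleTensor C.t′                 ≈⟨ cong≋ (linearʳ ш-isBilinear a) C.t′-shuffle ⟩
      a ш shuffleTensor (id⊗τ C.t)           ≈⟨ shuffleTensor-multiply a (id⊗τ C.t) ⟨
      shuffleTensor (multiply a (id⊗τ C.t))  ≡⟨ cong shuffleTensor (id⊗τ-multiply a C.t) ⟨
      shuffleTensor (id⊗τ (multiply a C.t))  ∎
  ; value      = begin
      a ш x                                  ≈⟨ cong₂≋ ш-isBilinear (≋-sym (λ′-𝒜⁰ a∈)) C.value ⟩
      λ′ a ш λ′ (id⊗const C.t′)              ≈⟨ substitute-ш z-to-1 a (id⊗const C.t′) ⟨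
      λ′ (a ш id⊗const C.t′)                 ≈⟨ cong≋ (substitute-isLinear z-to-1) (id⊗const-multiply a C.t′) ⟨
      λ′ (id⊗const (multiply a C.t′))        ∎
  }
  where
  open ≋-Reasoning
  module C = Confluence c

-- On 𝒜_z⁻² both reg_{z,1} and reg_{z} are w ↦ w ⊗ 1.
standard⇒Confluence : ∀ {w} → w ∈Span Wordz⁻² → (∀ αs → Over 01-letters αs → Const (∂* αs w) ≋ 0#) → Confluence (λ′ w)
standard⇒Confluence {w} w∈ st = record
  { source∈  = Span-⊆ Wordz⁻²⇒Wordz⁰ w∈
  ; standard   = st
  ; t          = [ (w , 1#) ]
  ; t′         = [ (w , 1#) ]
  ; t∈         = (span w∈ , span (word∈Span empty) , span (word∈Span [])) ∷ []
  ; t-shuffle  = ≋-trans (+-identityʳ (w ш 1#)) (ш-identityʳ w)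
  ; t′∈        = (span w∈ , span (word∈Span [])) ∷ []
  -- `τ 1#` evaluates to `1#`.
  ; t′-shuffle = ≋-refl
  ; value      = cong≋ (substitute-isLinear z-to-1) (≋-sym (≋-trans (+-identityʳ (1ℤ · w)) (·-identity w)))
  }

-- Generators and the ideal they generate

Confluence-generator : ∀ {x} → RDSGenerator x → Confluence x
Confluence-generator {x} (u , v , u∈ , v∈ , r) = Confluence-resp λ′w≋x
  (standard⇒Confluence w∈ w-standard)
  where
  open ≋-Reasoning
  p : 𝒜z
  p = doubleShuffle u v
  p∈ : p ∈Span Regularizable
  p∈ = doubleShuffle-Regularizable (spanned {u} u∈) (spanned {v} v∈)
  m n : ℕ
  m = proj₁ (Regш-unique {u ш v - u * v} {x} r)
  -- Large enough for two purposes: Dⁿ kills `p`, and `reg n 0` takes its stable value on u ш v - u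
  -- * v.
  n = proj₁ (D-nilpotent p) ℕ.+ m
  w : 𝒜z
  w = reg n 0 p
  w∈ : w ∈Span Wordz⁻²
  w∈ = Regularizable-D≋0⇒𝒜z⁻² (reg-Regularizable n 0 p∈) (D-reg n (D^-mono (proj₁ (D-nilpotent p)) m (proj₂ (D-nilpotent p))))
  ∂*-D : ∀ αs q → ∂* αs (D q) ≋ D (∂* αs q)
  ∂*-D []       q = ≋-refl
  ∂*-D (α ∷ αs) q = ≋-trans (cong≋ (F-isLinear (bounded α)) (∂*-D αs q)) (≋-sym (final-F (bounded α) (∂* αs q)))
  w-standard : ∀ αs → Over 01-letters αs → Const (∂* αs w) ≋ 0#
  w-standard αs αs∈ = begin
    -- The powers of e₁ in `reg` are killed by each ∂ and fixed by `Const`, so they pass through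
    -- both.
    Const (∂* αs (reg n 0 p))      ≈⟨ reg-natural {P = U}
      (∘-isLinear (substitute-isLinear constant) (∂*-isLinear αs)) (λ _ → tt)
      (λ {q} _ → ≋-trans (cong≋ (substitute-isLinear constant) (∂*-D αs q)) (≋-sym (final-Const (∂* αs q))))
      (λ k q → ≋-trans (cong≋ (substitute-isLinear constant) (∂*-ш-01ʳ αs∈ (word∈Span (ones-01 k)) q))
        (≋-trans (substitute-ш constant (∂* αs q) (ones k)) (cong≋ (linearʳ ш-isBilinear (Const (∂* αs q))) (Const-ones k))))
      n 0 tt ⟩
    reg n 0 (Const (∂* αs p))      ≈⟨ cong≋ (reg-isLinear n 0) (doubleShuffle-standard αs∈ (spanned {u} u∈) (spanned {v} v∈)) ⟩
    reg n 0 0#                     ≈⟨ 0-homo (reg-isLinear n 0) ⟩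
    0#                             ∎
    where
    Const-ones : ∀ k → Const (ones k) ≋ ones k
    Const-ones zero    = ≋-refl
    Const-ones (suc k) = ≋-trans (substitute-◃ constant e1 (ones k))
      (≋-trans (·-identity (e1 ◃ Const (ones k))) (cong≋ (◃-isLinear e1) (Const-ones k)))
  λ′w≋x : λ′ w ≋ x
  λ′w≋x = begin
    λ′ (reg n 0 p)                 ≈⟨ reg-natural {P = _∈Span Regularizable} (substitute-isLinear z-to-1) D-Regularizable λ′-D
      (λ k q → ≋-trans (substitute-ш z-to-1 q (ones k)) (cong≋ (linearʳ ш-isBilinear (λ′ q)) (λ′-01-word (ones-01 k))))
      n 0 p∈ ⟩
    reg n 0 (λ′ p)                 ≈⟨ cong≋ (reg-isLinear n 0) (λ′-doubleShuffle (spanned {u} u∈) (spanned {v} v∈)) ⟩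
    reg n 0 (u ш v - u * v)        ≈⟨ proj₂ (Regш-unique {u ш v - u * v} {x} r) n (ℕ.m≤n+m m (proj₁ (D-nilpotent p))) ⟩
    x                              ∎

𝓘RDS⇒Confluence : ∀ {x} → 𝓘RDS x → Confluence x
𝓘RDS⇒Confluence (gen r)    = Confluence-generator r
𝓘RDS⇒Confluence zero       = Confluence-0
𝓘RDS⇒Confluence (add p q)  = Confluence-+ (𝓘RDS⇒Confluence p) (𝓘RDS⇒Confluence q)
𝓘RDS⇒Confluence (mul {a} a∈ p) = Confluence-ш (spanned {a} a∈) (𝓘RDS⇒Confluence p)
𝓘RDS⇒Confluence (resp {p} {q} p≈q p∈) = Confluence-resp {p} {q} ⌜ p≈q ⌝ (𝓘RDS⇒Confluence p∈)

theorem26 : 𝓘RDS ⊆ 𝓘CF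
theorem26 {x} x∈ = Confluence⇒𝓘CF {x} (𝓘RDS⇒Confluence {x} x∈)
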